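{- Let $n\ge 3$ and consider the inhomogeneous TASEP on a ring of $n$ sites with all $y_i=0$. For every state $w\in S_n$, the largest monomial $\eta(w)$ in $x_1,\dots,x_{n-1}$ dividing the unnormalized steady state probability $\psi_w$ is $$\eta(w)=\prod_{i=1}^{n-2} x_i^{\alpha_i(w)+\alpha_{i+1}(w)+\cdots+\alpha_{n-2}(w)}.$$ Moreover, if two states $w,w'\in S_n$ satisfy $\eta(w)=\eta(w')$, then $w$ and $w'$ are cyclically equivalent.
   Context: Inhomogeneous TASEP on a ring: the states are the permutations $w=(w_1,\dots,w_n)$ of $\{1,\dots,n\}$, viewed as labelings of $n$ sites arranged on a ring (positions taken modulo $n$, so position $n$ is adjacent to position $1$); the entry $i$ is a particle of weight $i$. For each pair of adjacent positions $(p,p+1)$ (mod $n$), if $w_p=i<j=w_{p+1}$ the two particles swap at rate $x_i-y_{n+1-j}$; if $w_p>w_{p+1}$ nothing happens. The unnormalized steady state probabilities $\psi_w$ are the components of the stationary vector of this chain (over the field of rational functions in the $x$'s and $y$'s), scaled so that $\psi_{(1,2,\dots,n)}=\prod_{1\le i<j\le n}(x_i-y_{n+1-j})^{j-i-1}$; with this normalization each $\psi_w$ is a polynomial. Here all $y_i$ are set to $0$, so $\psi_w\in\mathbb{Z}[x_1,\dots,x_{n-1}]$. Two states are cyclically equivalent if one is a cyclic shift of the other, e.g. $(w_1,\dots,w_n)\sim(w_2,\dots,w_n,w_1)$. For $1\le i\le n-2$, let $r$ be the position of $i+1$ in $w$ and $s$ the position of $i$. Then $\alpha_i(w)$ is the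 number of integers greater than $i+1$ among $w_r,w_{r+1},\dots,w_s$ (indices modulo $n$, i.e. reading cyclically to the right from the position of $i+1$ to the position of $i$). -}

module Defs where

open import Data.Nat as ℕ using (ℕ; zero; suc; _≤_; _<ᵇ_; _≤ᵇ_; _∸_)
open import Data.Integer as ℤ using (ℤ; 0ℤ; 1ℤ)
open import Data.Fin as Fin using (Fin; toℕ; fromℕ<)
open import Data.Vec as Vec using (Vec; []; _∷_; lookup; tabulate; allFin; _[_]≔_; _∷ʳ_; toList)
open import Data.Vec.Properties using (≡-dec)
open import Data.List as List using (List; upTo; concatMap; foldr)
open import Data.List.Relation.Unary.Unique.Propositional using (Unique)
open import Data.Bool using (Bool; true; false; if_then_else_; _∧_)
open import Data.Product using (Σ; ∃; _×_)
open import Relation.Nullary using (¬_; does; yes; no)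
open import Relation.Binary.PropositionalEquality using (_≡_)
open import Function using (_∘_)

-- Multivariate polynomials over ℤ in V variables x_0 … x_{V-1}
-- (0-based; variable index i stands for the paper's x_{i+1}),
-- represented by their coefficient function on exponent vectors.

Exp : ℕ → Set
Exp V = Vec ℕ V

Poly : ℕ → Set
Poly V = Exp V → ℤ

IsPoly : ∀ {V} → Poly V → Set
IsPoly {V} p = ∃ λ (D : ℕ) → ∀ (e : Exp V) → ¬ (p e ≡ 0ℤ) → ∀ (i : Fin V) → lookup e i ≤ D

_≈_ : ∀ {V} → Poly V → Poly V → Set
p ≈ q = ∀ e → p e ≡ q e

sumℤ : List ℤ → ℤ
sumℤ = foldr ℤ._+_ 0ℤ

below : ∀ {V} → Exp V → List (Exp V)
below [] = List.[ [] ]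
below (k ∷ e) = concatMap (λ i → List.map (i ∷_) (below e)) (upTo (suc k))

0P : ∀ {V} → Poly V
0P _ = 0ℤ

_+P_ : ∀ {V} → Poly V → Poly V → Poly V
(p +P q) e = p e ℤ.+ q e

_*P_ : ∀ {V} → Poly V → Poly V → Poly V
(p *P q) e = sumℤ (List.map (λ a → p a ℤ.* q (Vec.zipWith _∸_ e a)) (below e))

sumP : ∀ {V} → List (Poly V) → Poly V
sumP = foldr _+P_ 0P

mono : ∀ {V} → Exp V → Poly V
mono a e = if does (≡-dec ℕ._≟_ e a) then 1ℤ else 0ℤ

var : ∀ {V} → Fin V → Poly V
var i = mono (tabulate (λ j → if does (i Fin.≟ j) then 1 else 0))

_∣P_ : ∀ {V} → Exp V → Poly V → Set
a ∣P p = ∃ λ q → IsPoly q × (p ≈ (mono a *P q))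

IsLargestMonoDiv : ∀ {V} → Exp V → Poly V → Set
IsLargestMonoDiv {V} a p = (a ∣P p) × (∀ b → b ∣P p → ∀ (i : Fin V) → lookup b i ≤ lookup a i)

-- States: labelings of the n sites of the ring (positions 0 … n-1) by
-- particles; the entry k : Fin n stands for the particle of weight k+1.

State : ℕ → Set
State n = Vec (Fin n) n

IsPerm : ∀ {n} → State n → Set
IsPerm w = Unique (toList w)

next : ∀ {n} → Fin n → Fin n
next {suc m} i with suc (toℕ i) ℕ.<? suc m
... | yes p = fromℕ< p
... | no _ = Fin.zero

swapAt : ∀ {n} → State n → Fin n → State n
swapAt w p = (w [ p ]≔ lookup w (next p)) [ next p ]≔ lookup w p

-- Stationarity (global balance) of ψ at state w, for the inhomogeneous
-- TASEP with all y_i = 0: if w_p = i < j = w_{p+1} the particles swap at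
-- rate x_i (the variable of the smaller particle).
--   (Σ_{p : w_p < w_{p+1}} x_{w_p}) ψ_w
--      = Σ_{p : w_p > w_{p+1}} x_{w_{p+1}} ψ_{swap_p w}
Balance : ∀ {n} → (State n → Poly n) → State n → Set
Balance {n} ψ w =
  (sumP (List.map (λ p → if toℕ (lookup w p) <ᵇ toℕ (lookup w (next p))
                           then var (lookup w p) else 0P) (List.allFin n))
     *P ψ w)
  ≈ sumP (List.map (λ p → if toℕ (lookup w (next p)) <ᵇ toℕ (lookup w p)
                            then var (lookup w (next p)) *P ψ (swapAt w p) else 0P)
                   (List.allFin n))

sumℕ : List ℕ → ℕ
sumℕ = foldr ℕ._+_ 0

normExp : (n : ℕ) → Exp n
normExp n = tabulate (λ i → sumℕ (List.map (λ j → if toℕ i <ᵇ toℕ j then toℕ j ∸ toℕ i ∸ 1 else 0)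
                                           (List.allFin n)))

nth : ∀ {m} → Vec ℕ m → ℕ → ℕ
nth [] _ = 0
nth (x ∷ xs) zero = x
nth (x ∷ xs) (suc k) = nth xs k

posℕ : ∀ {m} → Vec ℕ m → ℕ → ℕ
posℕ [] v = 0
posℕ (x ∷ xs) v = if does (x ℕ.≟ v) then 0 else suc (posℕ xs v)

nextℕ : ℕ → ℕ → ℕ
nextℕ n k = if suc k <ᵇ n then suc k else 0

iter : ℕ → (ℕ → ℕ) → ℕ → ℕ
iter zero f x = x
iter (suc k) f x = f (iter k f x)

cycDist : ℕ → ℕ → ℕ → ℕ
cycDist n r s = if r ≤ᵇ s then s ∸ r else (n ℕ.+ s) ∸ r

-- alpha w b  is the paper's α_{b+1}(w)  (0 ≤ b ≤ n-3):
-- r = position of the particle of weight b+2, s = position of weight b+1,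
-- count entries of weight > b+2 among w_r, w_{r+1}, …, w_s (cyclically).
alpha : ∀ {n} → State n → ℕ → ℕ
alpha {n} w b =
  let w' = Vec.map toℕ w
      r  = posℕ w' (suc b)
      s  = posℕ w' b
  in sumℕ (List.map (λ k → if suc b <ᵇ nth w' (iter k (nextℕ n) r) then 1 else 0)
                    (upTo (suc (cycDist n r s))))

-- exponent vector of η(w) = ∏_{i=1}^{n-2} x_i^{α_i(w) + … + α_{n-2}(w)}
-- (0-based: exponent of variable i is Σ_{b = i}^{n-3} alpha w b; it is 0
--  for the variables x_{n-1}, x_n)
eta : ∀ {n} → State n → Exp n
eta {n} w = tabulate (λ i → sumℕ (List.map (λ b → if (toℕ i ≤ᵇ b) ∧ (3 ℕ.+ b ≤ᵇ n) then alpha w b else 0)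
                                            (upTo n)))

rotate : ∀ {A : Set} {n} → Vec A n → Vec A n
rotate [] = []
rotate (x ∷ xs) = xs ∷ʳ x

rotateⁿ : ∀ {A : Set} {n} → ℕ → Vec A n → Vec A n
rotateⁿ zero w = w
rotateⁿ (suc k) w = rotate (rotateⁿ k w)

CycEquiv : ∀ {n} → State n → State n → Set
CycEquiv w w' = ∃ λ k → rotateⁿ k w ≡ w'

{-# OPTIONS --safe #-}
module Submission where

-- Fix a variable xᵢ and give the rate xᵢ the order 1, all other rates the order 0. A swap k j → j k (k < j)
-- lowers α_{k-1} by one and raises α_k by one, except that α_k drops to 0 when j = k+1. Hence u = ηᵢ does not
-- increase along transitions of order 0, increases by at most 1 along those of order 1, and the transitions
-- with j ≥ k+2 are tight. If xᵢ^{u(w)} divides every ψ_w, then the coefficients c_w of xᵢ^{u(w)} in ψ_w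
-- satisfy the balance equations of the tight transitions. Order ℤ[x] by the sign of the lexicographically
-- first coefficient. Summing the balance equations over the states of one level of u with c_w < 0 shows that
-- this set is closed under transitions of order 0; up to rotation it would contain the decreasing word
-- n … 2 1, which is reached by an insertion sort never moving i to the right. And a zero c_w forces zeros
-- backwards along tight transitions, again down to the decreasing word. So the c_w are all zero or all
-- nonzero. Applied to xᵢ^K ψ for decreasing K, with ψ of the identity known, this gives that ηᵢ(w) is the
-- exact power of xᵢ in ψ_w.
--
-- Rotation invariance of ψ is needed first: the same summation, applied to ψ_w − ψ_{rotate w}, works because
-- the smallest particle, carried once around the ring, rotates the state.
--
-- Conversely η determines the α_b, and α_b tells where b sits in the cyclic word of the letters above b.

open import Defs
open import Data.Nat as ℕ using (ℕ; zero; suc; _≤_; _<_; _>_; z≤n; s≤s; _+_; _∸_; _<ᵇ_; _≤ᵇ_)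
import Data.Nat.Properties as ℕₚ
open import Data.Nat.Induction using (<-rec)
open import Data.Integer as ℤ using (ℤ; 0ℤ; 1ℤ)
import Data.Integer.Properties as ℤₚ
open import Algebra.Properties.AbelianGroup ℤₚ.+-0-abelianGroup using (identityʳ-unique; inverseʳ-unique)
open import Algebra.Properties.CommutativeSemigroup ℕₚ.+-commutativeSemigroup using (interchange)
open import Data.Fin as Fin using (Fin; toℕ; fromℕ<)
import Data.Fin.Properties as Finₚ
open import Data.Vec as Vec using (Vec; []; _∷_; lookup; _[_]≔_; tabulate; toList; _∷ʳ_; allFin)
open import Data.Vec.Properties using (≡-dec; lookup-zipWith; lookup∘update; lookup∘update′; lookup∘tabulate; tabulate∘lookup; tabulate-cong; toList-∷ʳ; toList-map; length-toList)
open import Data.List as List using (List; []; _∷_; [_]; _++_; length; upTo; downFrom; applyUpTo; concatMap; cartesianProductWith; filter)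
open import Data.List.Properties using (map-∘; map-cong; map-upTo; map-++; map-tabulate; length-map; length-++; ++-assoc; ++-identityʳ; ∷-injectiveˡ; ∷-injectiveʳ; filter-none; filter-all; filter-++; filter-accept; filter-reject)
open import Data.List.Membership.Propositional using (_∈_; _∉_)
open import Data.List.Membership.Propositional.Properties using (∈-++⁻; ∈-++⁺ˡ; ∈-++⁺ʳ; ∈-∃++; ∈-map⁺; ∈-map⁻; ∈-allFin; ∈-downFrom⁺; ∈-downFrom⁻; ∈-cartesianProductWith⁺)
open import Data.List.Membership.Propositional.Properties.WithK using (unique∧set⇒bag)
open import Data.List.Membership.DecPropositional ℕ._≟_ using (_∈?_)
open import Data.List.Relation.Binary.BagAndSetEquality using (∼bag⇒↭)
open import Data.List.Relation.Binary.Permutation.Propositional as Perm using (_↭_; ↭-sym; ↭-refl; ↭⇒↭ₛ)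
open import Data.List.Relation.Binary.Permutation.Propositional.Properties using (++-comm; map⁺)
import Data.List.Relation.Binary.Permutation.Setoid.Properties as Permₛ
open import Data.List.Relation.Unary.Any using (here; there)
open import Data.List.Relation.Unary.All as All using (All; []; _∷_)
open import Data.List.Relation.Unary.AllPairs using (AllPairs; []; _∷_)
open import Data.List.Relation.Unary.Unique.Propositional using (Unique)
open import Data.List.Relation.Unary.Unique.Propositional.Properties as Uniqueₚ using (allFin⁺; cartesianProductWith⁺; Unique[x∷xs]⇒x∉xs)
open import Data.List.Relation.Unary.Unique.DecPropositional using (unique?)
open import Data.Product using (∃; _×_; _,_; proj₁; proj₂)
open import Data.Sum using (_⊎_; inj₁; inj₂)
open import Data.Bool using (Bool; true; false; if_then_else_; _∧_; T)
open import Data.Unit using (⊤; tt)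
open import Data.Empty using (⊥-elim)
open import Relation.Nullary using (¬_; Dec; yes; no; does)
open import Relation.Nullary.Decidable using (_×-dec_; ¬?; dec-true; dec-false)
open import Relation.Binary using (tri<; tri≈; tri>)
open import Relation.Binary.PropositionalEquality using (_≡_; _≢_; refl; sym; trans; cong; cong₂; subst; subst₂; setoid; module ≡-Reasoning)
open import Function using (_∘_; mk⇔)

-- Only balance and one normalised value are given, with no positivity, so a solution might a priori
-- have mixed signs. The lexicographic order replaces Perron-Frobenius: sums of nonnegative
-- polynomials are nonnegative, and multiplication by a variable preserves the order and can be
-- cancelled. The flow argument then runs on formal coefficients, without specialising the
-- variables, where a nonzero polynomial could vanish.
--
-- The decreasing word serves both arguments: it is reached forward by transitions of order 0, which
-- carries signs, and backward by tight transitions, which carries zeros. One sign there decides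
-- everything.
--
-- Rotation invariance cannot be derived for the `c w` themselves. Their equations contain no swap
-- in which i is the smaller letter, so for the smallest i it could not be carried around the ring;
-- the invariance has to be inherited from ψ, where all swaps are present.
--
-- The assumption that `c w` lies at the lowest power of xᵢ is itself the claim to be proved. A high
-- power of xᵢ makes it trivially true, and the exact monomial at the identity state lets this power
-- be removed again.

private variable
  𝒜 ℬ 𝒫 𝒬 : Set
  m n V : ℕ

-- Additive structure of polynomials

≈-refl : {f : Poly V} → f ≈ f
≈-refl e = refl

≈-sym : {f g : Poly V} → f ≈ g → g ≈ f
≈-sym p e = sym (p e)

≈-trans : {f g h : Poly V} → f ≈ g → g ≈ h → f ≈ h
≈-trans p q e = trans (p e) (q e)

infix 8 -P_
-P_ : Poly V → Poly V
(-P f) e = ℤ.- f e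

+P-cong : {f f' g g' : Poly V} → f ≈ f' → g ≈ g' → (f +P g) ≈ (f' +P g')
+P-cong p q e = cong₂ ℤ._+_ (p e) (q e)

-P-cong : {f g : Poly V} → f ≈ g → (-P f) ≈ (-P g)
-P-cong p e = cong ℤ.-_ (p e)

-P-zero : {f : Poly V} → f ≈ 0P → (-P f) ≈ 0P
-P-zero p e = cong ℤ.-_ (p e)

-P-involutive : (f : Poly V) → (-P (-P f)) ≈ f
-P-involutive f e = ℤₚ.neg-involutive (f e)

+P-zero : {f g : Poly V} → f ≈ 0P → g ≈ 0P → (f +P g) ≈ 0P
+P-zero p q e = cong₂ ℤ._+_ (p e) (q e)

+P-identityˡ : {f g : Poly V} → f ≈ 0P → (f +P g) ≈ g
+P-identityˡ {g = g} p e = trans (cong (ℤ._+ g e) (p e)) (ℤₚ.+-identityˡ (g e))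

+P-identityʳ : {f g : Poly V} → g ≈ 0P → (f +P g) ≈ f
+P-identityʳ {f = f} p e = trans (cong (ℤ._+_ (f e)) (p e)) (ℤₚ.+-identityʳ (f e))

∑ : List 𝒜 → (𝒜 → Poly V) → Poly V
∑ L F = sumP (List.map F L)

∑-eval : (L : List 𝒜) (F : 𝒜 → Poly V) (e : Exp V) → ∑ L F e ≡ sumℤ (List.map (λ a → F a e) L)
∑-eval [] F e = refl
∑-eval (a ∷ L) F e = cong (ℤ._+_ (F a e)) (∑-eval L F e)

∑-cong : (L : List 𝒜) {F G : 𝒜 → Poly V} → (∀ a → F a ≈ G a) → ∑ L F ≈ ∑ L G
∑-cong [] p = ≈-refl
∑-cong (a ∷ L) p = +P-cong (p a) (∑-cong L p)

∑-zero : (L : List 𝒜) {F : 𝒜 → Poly V} → (∀ a → F a ≈ 0P) → ∑ L F ≈ 0P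
∑-zero [] p = ≈-refl
∑-zero (a ∷ L) p = +P-zero (p a) (∑-zero L p)

+-interchange : ∀ a b c d → (a ℤ.+ b) ℤ.+ (c ℤ.+ d) ≡ (a ℤ.+ c) ℤ.+ (b ℤ.+ d)
+-interchange a b c d = begin
  (a ℤ.+ b) ℤ.+ (c ℤ.+ d) ≡⟨ ℤₚ.+-assoc a b (c ℤ.+ d) ⟩
  a ℤ.+ (b ℤ.+ (c ℤ.+ d)) ≡⟨ cong (ℤ._+_ a) (sym (ℤₚ.+-assoc b c d)) ⟩
  a ℤ.+ ((b ℤ.+ c) ℤ.+ d) ≡⟨ cong (λ x → a ℤ.+ (x ℤ.+ d)) (ℤₚ.+-comm b c) ⟩
  a ℤ.+ ((c ℤ.+ b) ℤ.+ d) ≡⟨ cong (ℤ._+_ a) (ℤₚ.+-assoc c b d) ⟩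
  a ℤ.+ (c ℤ.+ (b ℤ.+ d)) ≡⟨ sym (ℤₚ.+-assoc a c (b ℤ.+ d)) ⟩
  (a ℤ.+ c) ℤ.+ (b ℤ.+ d) ∎
  where open ≡-Reasoning

∑-+ : (L : List 𝒜) (F G : 𝒜 → Poly V) → ∑ L (λ a → F a +P G a) ≈ (∑ L F +P ∑ L G)
∑-+ [] F G e = refl
∑-+ (a ∷ L) F G e = trans (cong (ℤ._+_ (F a e ℤ.+ G a e)) (∑-+ L F G e))
  (+-interchange (F a e) (G a e) (∑ L F e) (∑ L G e))

∑-neg : (L : List 𝒜) (F : 𝒜 → Poly V) → ∑ L (λ a → -P F a) ≈ (-P ∑ L F)
∑-neg [] F e = refl
∑-neg (a ∷ L) F e = trans (cong (ℤ._+_ (ℤ.- F a e)) (∑-neg L F e))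
  (sym (ℤₚ.neg-distrib-+ (F a e) (∑ L F e)))

∑-comm : (L : List 𝒜) (M : List ℬ) (F : 𝒜 → ℬ → Poly V) →
  ∑ L (λ a → ∑ M (F a)) ≈ ∑ M (λ b → ∑ L (λ a → F a b))
∑-comm [] M F = ≈-sym (∑-zero M (λ b → ≈-refl))
∑-comm (a ∷ L) M F =
  ≈-trans (+P-cong (≈-refl {f = ∑ M (F a)}) (∑-comm L M F)) (≈-sym (∑-+ M (F a) (λ b → ∑ L (λ a → F a b))))

∑-↭ : {L M : List 𝒜} → L ↭ M → (F : 𝒜 → Poly V) → ∑ L F ≈ ∑ M F
∑-↭ {L = L} {M} p F e = trans (∑-eval L F e) (trans
  (Permₛ.foldr-commMonoid (setoid ℤ) ℤₚ.+-0-isCommutativeMonoid (↭⇒↭ₛ (map⁺ (λ a → F a e) p)))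
  (sym (∑-eval M F e)))

∑-map : (h : 𝒜 → ℬ) (L : List 𝒜) (F : ℬ → Poly V) → ∑ (List.map h L) F ≈ ∑ L (F ∘ h)
∑-map h L F e = cong (λ z → sumP z e) (sym (map-∘ L))

-- The lexicographic order of polynomials

-- Either f is zero or its lexicographically first nonzero coefficient is positive.
data NonNeg : Poly V → Set where
  constant : {f : Poly 0} → 0ℤ ℤ.≤ f [] → NonNeg f
  leading  : {f : Poly (suc V)} →
    (∀ k → (∀ j → j < k → (f ∘ (j ∷_)) ≈ 0P) → NonNeg (f ∘ (k ∷_))) → NonNeg f

NonNeg-resp : {f g : Poly V} → f ≈ g → NonNeg f → NonNeg g
NonNeg-resp p (constant nn) = constant (subst (0ℤ ℤ.≤_) (p []) nn)
NonNeg-resp p (leading nn) = leading λ k z →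
  NonNeg-resp (p ∘ (k ∷_)) (nn k (λ j j<k e → trans (p (j ∷ e)) (z j j<k e)))

NonNeg-zero : {f : Poly V} → f ≈ 0P → NonNeg f
NonNeg-zero {zero} p = constant (ℤₚ.≤-reflexive (sym (p [])))
NonNeg-zero {suc V} p = leading λ k _ → NonNeg-zero (p ∘ (k ∷_))

-- Strong induction on the first exponent: `leading` speaks about a slice only once all earlier
-- slices are known to vanish.
NonNeg-antisym : {f : Poly V} → NonNeg f → NonNeg (-P f) → f ≈ 0P
NonNeg-antisym {f = f} (constant p) (constant q) [] =
  ℤₚ.≤-antisym (subst (ℤ._≤ 0ℤ) (ℤₚ.neg-involutive (f [])) (ℤₚ.neg-mono-≤ q)) p
NonNeg-antisym {f = f} (leading p) (leading q) (k ∷ e) = slice k e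
  where
  slice : ∀ k → (f ∘ (k ∷_)) ≈ 0P
  slice = <-rec _ λ k rec → NonNeg-antisym
    (p k (λ j j<k → rec j<k)) (q k (λ j j<k → -P-zero (rec j<k)))

-- A zero sum turns g into the negative of f, and antisymmetry applies. All conclusions drawn from
-- vanishing sums of flows rest on this.
NonNeg-sum-zero : {f g : Poly V} → NonNeg f → NonNeg g → (f +P g) ≈ 0P → f ≈ 0P
NonNeg-sum-zero {f = f} {g} p q s = NonNeg-antisym p (NonNeg-resp lem q)
  where
  lem : g ≈ (-P f)
  lem e = inverseʳ-unique (f e) (g e) (s e)

+P-comm : (f g : Poly V) → (f +P g) ≈ (g +P f)
+P-comm f g e = ℤₚ.+-comm (f e) (g e)

NonNeg-sum-zeroʳ : {f g : Poly V} → NonNeg f → NonNeg g → (f +P g) ≈ 0P → g ≈ 0P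
NonNeg-sum-zeroʳ {f = f} {g} p q s = NonNeg-sum-zero q p (≈-trans (+P-comm g f) s)

-- The hypothesis that earlier slices of the sum vanish must be passed on to both summands. This
-- works because two nonnegative slices with sum zero are both zero.
NonNeg-+ : {f g : Poly V} → NonNeg f → NonNeg g → NonNeg (f +P g)
NonNeg-+ (constant p) (constant q) = constant (ℤₚ.+-mono-≤ p q)
NonNeg-+ {f = f} {g} (leading p) (leading q) = leading λ k z → let both = slices k z in
  NonNeg-+ (p k (λ j j<k → proj₁ (both j j<k))) (q k (λ j j<k → proj₂ (both j j<k)))
  where
  slices : ∀ k → (∀ j → j < k → ((f +P g) ∘ (j ∷_)) ≈ 0P) → ∀ j → j < k → ((f ∘ (j ∷_)) ≈ 0P) × ((g ∘ (j ∷_)) ≈ 0P)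
  slices k z = <-rec _ λ j rec j<k →
    let p' = p j (λ i i<j → proj₁ (rec i<j (ℕₚ.<-trans i<j j<k)))
        q' = q j (λ i i<j → proj₂ (rec i<j (ℕₚ.<-trans i<j j<k)))
    in NonNeg-sum-zero p' q' (z j j<k) , NonNeg-sum-zeroʳ p' q' (z j j<k)

NonNeg-∑ : (L : List 𝒜) {F : 𝒜 → Poly V} → (∀ a → NonNeg (F a)) → NonNeg (∑ L F)
NonNeg-∑ [] p = NonNeg-zero ≈-refl
NonNeg-∑ (a ∷ L) p = NonNeg-+ (p a) (NonNeg-∑ L p)

NonNeg-∑-zero : (L : List 𝒜) {F : 𝒜 → Poly V} → (∀ a → NonNeg (F a)) → ∑ L F ≈ 0P →
  ∀ {a} → a ∈ L → F a ≈ 0P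
NonNeg-∑-zero (a ∷ L) p z (here refl) = NonNeg-sum-zero (p a) (NonNeg-∑ L p) z
NonNeg-∑-zero (a ∷ L) p z (there m) =
  NonNeg-∑-zero L p (NonNeg-sum-zeroʳ (p a) (NonNeg-∑ L p) z) m

data Sign (f : Poly V) : Set where
  nought : f ≈ 0P → Sign f
  plus   : ¬ (f ≈ 0P) → NonNeg f → Sign f
  minus  : ¬ (f ≈ 0P) → NonNeg (-P f) → Sign f

-- For an arbitrary coefficient function the sign is not computable. The degree bound D limits the
-- search for the first nonzero slice to exponents up to D.
sign : (f : Poly V) → IsPoly f → Sign f
sign {zero} f _ with ℤₚ._≟_ (f []) 0ℤ
... | yes p = nought (λ { [] → p })
... | no ¬p with ℤₚ.≤-total 0ℤ (f [])
... | inj₁ q = plus (λ z → ¬p (z [])) (constant q)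
... | inj₂ q = minus (λ z → ¬p (z [])) (constant (ℤₚ.neg-mono-≤ q))
sign {suc V} f (D , bd) = conclude (scan (suc D))
  where
  Slice≈0 : ℕ → Set
  Slice≈0 j = (f ∘ (j ∷_)) ≈ 0P
  scan : ∀ b → (∀ j → j < b → Slice≈0 j) ⊎ Sign f
  scan zero = inj₁ (λ j ())
  scan (suc b) with scan b
  ... | inj₂ s = inj₂ s
  ... | inj₁ z = found (sign (f ∘ (b ∷_)) (D , λ e ne i → bd (b ∷ e) ne (Fin.suc i)))
    where
    first : ∀ k → ¬ Slice≈0 b → (∀ j → j < k → Slice≈0 j) → k ≢ b → Slice≈0 k
    first k ne y k≢b with ℕₚ.<-cmp k b
    ... | tri< k<b _ _ = z k k<b
    ... | tri≈ _ k≡b _ = ⊥-elim (k≢b k≡b)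
    ... | tri> _ _ b<k = ⊥-elim (ne (y b b<k))
    found : Sign (f ∘ (b ∷_)) → (∀ j → j < suc b → Slice≈0 j) ⊎ Sign f
    found (nought y) = inj₁ λ j j<sb → case j (ℕₚ.m≤n⇒m<n∨m≡n (ℕ.s≤s⁻¹ j<sb))
      where
      case : ∀ j → j < b ⊎ j ≡ b → Slice≈0 j
      case j (inj₁ j<b) = z j j<b
      case j (inj₂ refl) = y
    found (plus ne nn) = inj₂ (plus (λ y → ne (y ∘ (b ∷_))) (leading λ k y → at k y (k ℕ.≟ b)))
      where
      at : ∀ k → (∀ j → j < k → Slice≈0 j) → Dec (k ≡ b) → NonNeg (f ∘ (k ∷_))
      at k y (yes refl) = nn
      at k y (no k≢b) = NonNeg-zero (first k ne y k≢b)
    found (minus ne nn) = inj₂ (minus (λ y → ne (y ∘ (b ∷_))) (leading λ k y → at k y (k ℕ.≟ b)))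
      where
      unneg : ∀ {j} → ((-P f) ∘ (j ∷_)) ≈ 0P → Slice≈0 j
      unneg y e = trans (sym (ℤₚ.neg-involutive _)) (cong ℤ.-_ (y e))
      at : ∀ k → (∀ j → j < k → ((-P f) ∘ (j ∷_)) ≈ 0P) → Dec (k ≡ b) → NonNeg ((-P f) ∘ (k ∷_))
      at k y (yes refl) = nn
      at k y (no k≢b) = NonNeg-zero (-P-zero (first k ne (λ j j<k → unneg (y j j<k)) k≢b))
  conclude : (∀ j → j < suc D → Slice≈0 j) ⊎ Sign f → Sign f
  conclude (inj₂ s) = s
  conclude (inj₁ z) = nought λ { (k ∷ e) → at k e }
    where
    at : ∀ k e → f (k ∷ e) ≡ 0ℤ
    at k e with ℤₚ._≟_ (f (k ∷ e)) 0ℤ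
    ... | yes p = p
    ... | no ne = z k (s≤s (bd (k ∷ e) ne Fin.zero)) e

-- Multiplication by a variable and extraction of the coefficient of a power of one variable

caseℕ : ℕ → 𝒜 → (ℕ → 𝒜) → 𝒜
caseℕ zero z s = z
caseℕ (suc m) z s = s m

-- The product with a variable as a shift of the coefficient function. The convolution `*P` is left
-- behind once `var-*` has identified the two.
X : Fin V → Poly V → Poly V
X k f e = caseℕ (lookup e k) 0ℤ (λ m → f (e [ k ]≔ m))

-- The variable xᵢ is kept, with exponent 0, so that coefficients stay in the same ring.
co : Fin V → ℕ → Poly V → Poly V
co i m f e = caseℕ (lookup e i) (f (e [ i ]≔ m)) (λ _ → 0ℤ)

X-cong : (k : Fin V) {f g : Poly V} → f ≈ g → X k f ≈ X k g
X-cong k p e with lookup e k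
... | zero = refl
... | suc m = p (e [ k ]≔ m)

X-zero : (k : Fin V) {f : Poly V} → f ≈ 0P → X k f ≈ 0P
X-zero k p e with lookup e k
... | zero = refl
... | suc m = p (e [ k ]≔ m)

X-neg : (k : Fin V) (f : Poly V) → X k (-P f) ≈ (-P X k f)
X-neg k f e with lookup e k
... | zero = refl
... | suc m = refl

X-+ : (k : Fin V) (f g : Poly V) → X k (f +P g) ≈ (X k f +P X k g)
X-+ k f g e with lookup e k
... | zero = refl
... | suc m = refl

X-∑ : (k : Fin V) (L : List 𝒜) (F : 𝒜 → Poly V) → X k (∑ L F) ≈ ∑ L (X k ∘ F)
X-∑ k [] F = X-zero k ≈-refl
X-∑ k (a ∷ L) F = ≈-trans (X-+ k (F a) (∑ L F)) (+P-cong (≈-refl {f = X k (F a)}) (X-∑ k L F))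

X-comm : (j k : Fin V) (f : Poly V) → X j (X k f) ≈ X k (X j f)
X-comm Fin.zero Fin.zero f e = refl
X-comm Fin.zero (Fin.suc k) f (zero ∷ e) with lookup e k
... | zero = refl
... | suc m = refl
X-comm Fin.zero (Fin.suc k) f (suc a ∷ e) = refl
X-comm (Fin.suc j) Fin.zero f (zero ∷ e) with lookup e j
... | zero = refl
... | suc m = refl
X-comm (Fin.suc j) Fin.zero f (suc a ∷ e) = refl
X-comm (Fin.suc j) (Fin.suc k) f (a ∷ e) = X-comm j k (f ∘ (a ∷_)) e

-- Each coefficient of f reappears in the product with its exponent at k raised by one. Zeros are
-- thus carried from the terms of a balance equation to the states.
X-cancel : (k : Fin V) {f : Poly V} → X k f ≈ 0P → f ≈ 0P
X-cancel Fin.zero p (a ∷ e) = p (suc a ∷ e)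
X-cancel (Fin.suc k) p (a ∷ e) = X-cancel k (λ e' → p (a ∷ e')) e

-- For the first variable the slices are shifted by one; for a later one the product acts within
-- each slice. In both cases the first nonzero slice keeps its sign, so rates count as positive.
NonNeg-X : (k : Fin V) {f : Poly V} → NonNeg f → NonNeg (X k f)
NonNeg-X Fin.zero (leading nn) = leading λ where
  zero z → NonNeg-zero ≈-refl
  (suc a) z → nn a (λ j j<a → z (suc j) (s≤s j<a))
NonNeg-X (Fin.suc k) (leading nn) = leading λ a z → NonNeg-X k (nn a (λ j j<a → X-cancel k (z j j<a)))

IsPoly-neg : {f : Poly V} → IsPoly f → IsPoly (-P f)
IsPoly-neg (D , bd) = D , λ e ne → bd e (λ z → ne (cong ℤ.-_ z))

IsPoly-+ : {f g : Poly V} → IsPoly f → IsPoly g → IsPoly (f +P g)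
IsPoly-+ {f = f} {g} (D , bd) (D' , bd') = D ℕ.⊔ D' , λ e ne i → bound e ne i
  where
  bound : ∀ e → ¬ ((f +P g) e ≡ 0ℤ) → ∀ i → lookup e i ≤ D ℕ.⊔ D'
  bound e ne i with ℤₚ._≟_ (f e) 0ℤ
  ... | no p = ℕₚ.≤-trans (bd e p i) (ℕₚ.m≤m⊔n D D')
  ... | yes p = ℕₚ.≤-trans (bd' e (λ z → ne (cong₂ ℤ._+_ p z)) i) (ℕₚ.m≤n⊔m D D')

lookup-≤-raise : (k i : Fin V) (e : Exp V) {m : ℕ} → lookup e k ≡ suc m →
  lookup e i ≤ suc (lookup (e [ k ]≔ m) i)
lookup-≤-raise Fin.zero Fin.zero (_ ∷ e) refl = ℕₚ.≤-refl
lookup-≤-raise Fin.zero (Fin.suc i) (_ ∷ e) eq = ℕₚ.n≤1+n _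
lookup-≤-raise (Fin.suc k) Fin.zero (_ ∷ e) eq = ℕₚ.n≤1+n _
lookup-≤-raise (Fin.suc k) (Fin.suc i) (_ ∷ e) eq = lookup-≤-raise k i e eq

IsPoly-X : (k : Fin V) {f : Poly V} → IsPoly f → IsPoly (X k f)
IsPoly-X k {f} (D , bd) = suc D , bound
  where
  bound : ∀ e → ¬ (X k f e ≡ 0ℤ) → ∀ i → lookup e i ≤ suc D
  bound e ne i with lookup e k in eq
  ... | zero = ⊥-elim (ne refl)
  ... | suc m = ℕₚ.≤-trans (lookup-≤-raise k i e eq) (s≤s (bd (e [ k ]≔ m) ne i))

lookup-≤-set : (k i : Fin V) (e : Exp V) {m : ℕ} → lookup e k ≡ 0 → lookup e i ≤ lookup (e [ k ]≔ m) i
lookup-≤-set Fin.zero Fin.zero (_ ∷ e) refl = z≤n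
lookup-≤-set Fin.zero (Fin.suc i) (_ ∷ e) eq = ℕₚ.≤-refl
lookup-≤-set (Fin.suc k) Fin.zero (_ ∷ e) eq = ℕₚ.≤-refl
lookup-≤-set (Fin.suc k) (Fin.suc i) (_ ∷ e) eq = lookup-≤-set k i e eq

IsPoly-co : (i : Fin V) (m : ℕ) {f : Poly V} → IsPoly f → IsPoly (co i m f)
IsPoly-co k m {f} (D , bd) = D , bound
  where
  bound : ∀ e → ¬ (co k m f e ≡ 0ℤ) → ∀ i → lookup e i ≤ D
  bound e ne i with lookup e k in eq
  ... | zero = ℕₚ.≤-trans (lookup-≤-set k i e eq) (bd (e [ k ]≔ m) ne i)
  ... | suc _ = ⊥-elim (ne refl)

co-cong : (i : Fin V) (m : ℕ) {f g : Poly V} → f ≈ g → co i m f ≈ co i m g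
co-cong i m p e with lookup e i
... | zero = p (e [ i ]≔ m)
... | suc _ = refl

co-zero : (i : Fin V) (m : ℕ) {f : Poly V} → f ≈ 0P → co i m f ≈ 0P
co-zero i m p e with lookup e i
... | zero = p (e [ i ]≔ m)
... | suc _ = refl

co-+ : (i : Fin V) (m : ℕ) (f g : Poly V) → co i m (f +P g) ≈ (co i m f +P co i m g)
co-+ i m f g e with lookup e i
... | zero = refl
... | suc _ = refl

co-∑ : (i : Fin V) (m : ℕ) (L : List 𝒜) (F : 𝒜 → Poly V) → co i m (∑ L F) ≈ ∑ L (co i m ∘ F)
co-∑ i m [] F = co-zero i m ≈-refl
co-∑ i m (a ∷ L) F = ≈-trans (co-+ i m (F a) (∑ L F)) (+P-cong (≈-refl {f = co i m (F a)}) (co-∑ i m L F))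

co-X-≢ : (i k : Fin V) (m : ℕ) → k ≢ i → (f : Poly V) → co i m (X k f) ≈ X k (co i m f)
co-X-≢ Fin.zero Fin.zero m k≢i f e = ⊥-elim (k≢i refl)
co-X-≢ Fin.zero (Fin.suc k) m k≢i f (zero ∷ e) = refl
co-X-≢ Fin.zero (Fin.suc k) m k≢i f (suc _ ∷ e) with lookup e k
... | zero = refl
... | suc _ = refl
co-X-≢ (Fin.suc i) Fin.zero m k≢i f (zero ∷ e) with lookup e i
... | zero = refl
... | suc _ = refl
co-X-≢ (Fin.suc i) Fin.zero m k≢i f (suc _ ∷ e) = refl
co-X-≢ (Fin.suc i) (Fin.suc k) m k≢i f (a ∷ e) = co-X-≢ i k m (k≢i ∘ cong Fin.suc) (f ∘ (a ∷_)) e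

co-X-suc : (i : Fin V) (m : ℕ) (f : Poly V) → co i (suc m) (X i f) ≈ co i m f
co-X-suc Fin.zero m f (zero ∷ e) = refl
co-X-suc Fin.zero m f (suc _ ∷ e) = refl
co-X-suc (Fin.suc i) m f (a ∷ e) = co-X-suc i m (f ∘ (a ∷_)) e

co-X-zero : (i : Fin V) (f : Poly V) → co i 0 (X i f) ≈ 0P
co-X-zero Fin.zero f (zero ∷ e) = refl
co-X-zero Fin.zero f (suc _ ∷ e) = refl
co-X-zero (Fin.suc i) f (a ∷ e) = co-X-zero i (f ∘ (a ∷_)) e

co-eval : (i : Fin V) (m : ℕ) {f : Poly V} → co i m f ≈ 0P → ∀ e → lookup e i ≡ m → f e ≡ 0ℤ
co-eval Fin.zero m p (_ ∷ e) refl = p (0 ∷ e)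
co-eval (Fin.suc i) m p (a ∷ e) eq = co-eval i m (λ e' → p (a ∷ e')) e eq

co-vanish : (i : Fin V) (m : ℕ) {f : Poly V} → (∀ e → lookup e i ≡ m → f e ≡ 0ℤ) → co i m f ≈ 0P
co-vanish Fin.zero m p (zero ∷ e) = p (m ∷ e) refl
co-vanish Fin.zero m p (suc _ ∷ e) = refl
co-vanish (Fin.suc i) m p (a ∷ e) = co-vanish i m (λ e' → p (a ∷ e')) e

-- Multiplication by monomials

sumℤ-++ : ∀ xs ys → sumℤ (xs List.++ ys) ≡ sumℤ xs ℤ.+ sumℤ ys
sumℤ-++ [] ys = sym (ℤₚ.+-identityˡ _)
sumℤ-++ (x ∷ xs) ys = trans (cong (ℤ._+_ x) (sumℤ-++ xs ys)) (sym (ℤₚ.+-assoc x _ _))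

sumℤ-concatMap : (F : ℬ → ℤ) (g : 𝒜 → List ℬ) (L : List 𝒜) →
  sumℤ (List.map F (concatMap g L)) ≡ sumℤ (List.map (λ a → sumℤ (List.map F (g a))) L)
sumℤ-concatMap F g [] = refl
sumℤ-concatMap F g (a ∷ L) = begin
  sumℤ (List.map F (g a List.++ concatMap g L))
    ≡⟨ cong sumℤ (map-++ F (g a) _) ⟩
  sumℤ (List.map F (g a) List.++ List.map F (concatMap g L))
    ≡⟨ sumℤ-++ (List.map F (g a)) _ ⟩
  sumℤ (List.map F (g a)) ℤ.+ sumℤ (List.map F (concatMap g L))
    ≡⟨ cong (ℤ._+_ (sumℤ (List.map F (g a)))) (sumℤ-concatMap F g L) ⟩
  sumℤ (List.map F (g a)) ℤ.+ sumℤ (List.map (λ a → sumℤ (List.map F (g a))) L) ∎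
  where open ≡-Reasoning

sumℤ-zero : (F : 𝒜 → ℤ) (L : List 𝒜) → (∀ a → F a ≡ 0ℤ) → sumℤ (List.map F L) ≡ 0ℤ
sumℤ-zero F [] p = refl
sumℤ-zero F (a ∷ L) p = cong₂ ℤ._+_ (p a) (sumℤ-zero F L p)

sumℤ-applyUpTo-zero : (G : ℕ → ℤ) (n : ℕ) → (∀ j → j < n → G j ≡ 0ℤ) → sumℤ (applyUpTo G n) ≡ 0ℤ
sumℤ-applyUpTo-zero G zero p = refl
sumℤ-applyUpTo-zero G (suc n) p =
  cong₂ ℤ._+_ (p 0 (s≤s z≤n)) (sumℤ-applyUpTo-zero (G ∘ suc) n (λ j j<n → p (suc j) (s≤s j<n)))

sumℤ-applyUpTo-single : (G : ℕ → ℤ) (a n : ℕ) → a < n → (∀ j → j ≢ a → G j ≡ 0ℤ) →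
  sumℤ (applyUpTo G n) ≡ G a
sumℤ-applyUpTo-single G zero (suc n) a<n p =
  trans (cong (ℤ._+_ (G 0)) (sumℤ-applyUpTo-zero (G ∘ suc) n (λ j _ → p (suc j) (λ ())))) (ℤₚ.+-identityʳ _)
sumℤ-applyUpTo-single G (suc a) (suc n) (s≤s a<n) p = trans
  (cong₂ ℤ._+_ (p 0 (λ ())) (sumℤ-applyUpTo-single (G ∘ suc) a n a<n (λ j j≢a → p (suc j) (j≢a ∘ ℕₚ.suc-injective))))
  (ℤₚ.+-identityˡ _)

sumBelow : (e : Exp V) → (Exp V → ℤ) → ℤ
sumBelow e F = sumℤ (List.map F (below e))

sumBelow-∷ : (k : ℕ) (e : Exp V) (F : Exp (suc V) → ℤ) →
  sumBelow (k ∷ e) F ≡ sumℤ (applyUpTo (λ i → sumBelow e (F ∘ (i ∷_))) (suc k))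
sumBelow-∷ k e F = begin
  sumBelow (k ∷ e) F
    ≡⟨ sumℤ-concatMap F (λ i → List.map (i ∷_) (below e)) (upTo (suc k)) ⟩
  sumℤ (List.map (λ i → sumℤ (List.map F (List.map (i ∷_) (below e)))) (upTo (suc k)))
    ≡⟨ cong sumℤ (map-cong (λ i → cong sumℤ (sym (map-∘ (below e)))) (upTo (suc k))) ⟩
  sumℤ (List.map (λ i → sumBelow e (F ∘ (i ∷_))) (upTo (suc k)))
    ≡⟨ cong sumℤ (map-upTo (λ i → sumBelow e (F ∘ (i ∷_))) (suc k)) ⟩
  sumℤ (applyUpTo (λ i → sumBelow e (F ∘ (i ∷_))) (suc k)) ∎
  where open ≡-Reasoning

_≤ᵉ_ : Exp V → Exp V → Set
a ≤ᵉ e = ∀ i → lookup a i ≤ lookup e i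

sumBelow-single : (e a : Exp V) (F : Exp V → ℤ) → (∀ b → b ≢ a → F b ≡ 0ℤ) → a ≤ᵉ e → sumBelow e F ≡ F a
sumBelow-single [] [] F p le = ℤₚ.+-identityʳ _
sumBelow-single (k ∷ e) (c ∷ a) F p le = trans (sumBelow-∷ k e F) (trans
  (sumℤ-applyUpTo-single _ c (suc k) (s≤s (le Fin.zero))
    (λ j j≢c → sumℤ-zero _ (below e) (λ b → p (j ∷ b) (λ { refl → j≢c refl }))))
  (sumBelow-single e a (F ∘ (c ∷_)) (λ b b≢a → p (c ∷ b) (λ { refl → b≢a refl })) (le ∘ Fin.suc)))

sumBelow-none : (e a : Exp V) (F : Exp V → ℤ) → (∀ b → b ≢ a → F b ≡ 0ℤ) →
  ∀ i → lookup e i < lookup a i → sumBelow e F ≡ 0ℤ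
sumBelow-none (k ∷ e) (c ∷ a) F p Fin.zero k<c = trans (sumBelow-∷ k e F)
  (sumℤ-applyUpTo-zero _ (suc k) (λ j j≤k → sumℤ-zero _ (below e)
    (λ b → p (j ∷ b) (λ { refl → ℕₚ.<-irrefl refl (ℕₚ.<-≤-trans k<c (ℕ.s≤s⁻¹ j≤k)) }))))
sumBelow-none (k ∷ e) (c ∷ a) F p (Fin.suc i) lt = trans (sumBelow-∷ k e F)
  (sumℤ-applyUpTo-zero _ (suc k) slice)
  where
  slice : ∀ j → j < suc k → sumBelow e (F ∘ (j ∷_)) ≡ 0ℤ
  slice j _ = sumBelow-none e a (F ∘ (j ∷_)) (λ b b≢a → p (j ∷ b) (λ { refl → b≢a refl })) i lt

mono-≡ : (a : Exp V) → mono a a ≡ 1ℤ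
mono-≡ a rewrite dec-true (≡-dec ℕ._≟_ a a) refl = refl

mono-≢ : (a e : Exp V) → e ≢ a → mono a e ≡ 0ℤ
mono-≢ a e ne rewrite dec-false (≡-dec ℕ._≟_ e a) ne = refl

-- Only the summand of `a` itself survives in the convolution, and for it the truncated subtraction
-- is exact.
mono-*-≤ : (a : Exp V) (q : Poly V) (e : Exp V) → a ≤ᵉ e → (mono a *P q) e ≡ q (Vec.zipWith _∸_ e a)
mono-*-≤ a q e le = trans
  (sumBelow-single e a _ (λ b b≢a → cong (ℤ._* q (Vec.zipWith _∸_ e b)) (mono-≢ a b b≢a)) le)
  (trans (cong (ℤ._* q (Vec.zipWith _∸_ e a)) (mono-≡ a)) (ℤₚ.*-identityˡ _))

mono-*-≰ : (a : Exp V) (q : Poly V) (e : Exp V) → ∀ i → lookup e i < lookup a i → (mono a *P q) e ≡ 0ℤ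
mono-*-≰ a q e i lt =
  sumBelow-none e a _ (λ b b≢a → cong (ℤ._* q (Vec.zipWith _∸_ e b)) (mono-≢ a b b≢a)) i lt

∣P-support : {a : Exp V} {f : Poly V} → a ∣P f → ∀ e i → lookup e i < lookup a i → f e ≡ 0ℤ
∣P-support {a = a} (q , _ , eq) e i lt = trans (eq e) (mono-*-≰ a q e i lt)

zipWith-+-∸ : (a e : Exp V) → a ≤ᵉ e → Vec.zipWith ℕ._+_ a (Vec.zipWith _∸_ e a) ≡ e
zipWith-+-∸ [] [] le = refl
zipWith-+-∸ (c ∷ a) (k ∷ e) le = cong₂ _∷_ (ℕₚ.m+[n∸m]≡n (le Fin.zero)) (zipWith-+-∸ a e (le ∘ Fin.suc))

-- The quotient is f read at exponents shifted by `a`, which keeps the degree bound. Together with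
-- `∣P-support` this makes divisibility by a monomial a condition on each exponent separately, so
-- the variables can be treated one at a time.
support⇒∣P : {a : Exp V} {f : Poly V} → IsPoly f → (∀ e i → lookup e i < lookup a i → f e ≡ 0ℤ) → a ∣P f
support⇒∣P {a = a} {f} (D , bd) supp = q , (D , bound) , eq
  where
  q : Poly _
  q e = f (Vec.zipWith ℕ._+_ a e)
  bound : ∀ e → ¬ (q e ≡ 0ℤ) → ∀ i → lookup e i ≤ D
  bound e ne i = ℕₚ.≤-trans (ℕₚ.m≤n+m (lookup e i) (lookup a i))
    (subst (_≤ D) (lookup-zipWith ℕ._+_ i a e) (bd (Vec.zipWith ℕ._+_ a e) ne i))
  eq : f ≈ (mono a *P q)
  eq e with Finₚ.any? (λ i → lookup e i ℕ.<? lookup a i)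
  ... | yes (i , lt) = trans (supp e i lt) (sym (mono-*-≰ a q e i lt))
  ... | no none = sym (trans (mono-*-≤ a q e le) (cong f (zipWith-+-∸ a e le)))
    where
    le : a ≤ᵉ e
    le i = ℕₚ.≮⇒≥ (λ lt → none (i , lt))

δ : Fin V → Exp V
δ k = tabulate (λ j → if does (k Fin.≟ j) then 1 else 0)

zipWith-∸-0 : (e : Exp V) → Vec.zipWith _∸_ e (tabulate (λ _ → 0)) ≡ e
zipWith-∸-0 [] = refl
zipWith-∸-0 (k ∷ e) = cong (k ∷_) (zipWith-∸-0 e)

zipWith-∸-δ : (k : Fin V) (e : Exp V) (m : ℕ) → lookup e k ≡ suc m → Vec.zipWith _∸_ e (δ k) ≡ e [ k ]≔ m
zipWith-∸-δ Fin.zero (_ ∷ e) m refl = cong (m ∷_) (zipWith-∸-0 e)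
zipWith-∸-δ (Fin.suc k) (c ∷ e) m eq = cong (c ∷_) (zipWith-∸-δ k e m eq)

0≤ᵉ : (e : Exp V) → tabulate (λ _ → 0) ≤ᵉ e
0≤ᵉ (k ∷ e) Fin.zero = z≤n
0≤ᵉ (k ∷ e) (Fin.suc i) = 0≤ᵉ e i

δ-≤ᵉ : (k : Fin V) (e : Exp V) (m : ℕ) → lookup e k ≡ suc m → δ k ≤ᵉ e
δ-≤ᵉ Fin.zero (_ ∷ e) m refl Fin.zero = s≤s z≤n
δ-≤ᵉ Fin.zero (_ ∷ e) m refl (Fin.suc i) = 0≤ᵉ e i
δ-≤ᵉ (Fin.suc k) (_ ∷ e) m eq Fin.zero = z≤n
δ-≤ᵉ (Fin.suc k) (_ ∷ e) m eq (Fin.suc i) = δ-≤ᵉ k e m eq i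

lookup-δ : (k : Fin V) → lookup (δ k) k ≡ 1
lookup-δ Fin.zero = refl
lookup-δ (Fin.suc k) = lookup-δ k

var-* : (k : Fin V) (f : Poly V) → (var k *P f) ≈ X k f
var-* k f e with lookup e k in eq
... | zero = mono-*-≰ (δ k) f e k (subst₂ _<_ (sym eq) (sym (lookup-δ k)) (s≤s z≤n))
... | suc m = trans (mono-*-≤ (δ k) f e (δ-≤ᵉ k e m eq)) (cong f (zipWith-∸-δ k e m eq))

0P-* : (f : Poly V) → (0P *P f) ≈ 0P
0P-* f e = sumℤ-zero _ (below e) (λ a → refl)

sumℤ-+ : (F G : 𝒜 → ℤ) (L : List 𝒜) →
  sumℤ (List.map (λ a → F a ℤ.+ G a) L) ≡ sumℤ (List.map F L) ℤ.+ sumℤ (List.map G L)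
sumℤ-+ F G [] = refl
sumℤ-+ F G (a ∷ L) = trans (cong (ℤ._+_ (F a ℤ.+ G a)) (sumℤ-+ F G L)) (+-interchange (F a) (G a) _ _)

+P-* : (f g h : Poly V) → ((f +P g) *P h) ≈ ((f *P h) +P (g *P h))
+P-* f g h e = trans
  (cong sumℤ (map-cong (λ a → ℤₚ.*-distribʳ-+ (h (Vec.zipWith _∸_ e a)) (f a) (g a)) (below e)))
  (sumℤ-+ (λ a → f a ℤ.* h (Vec.zipWith _∸_ e a)) (λ a → g a ℤ.* h (Vec.zipWith _∸_ e a)) (below e))

∑-* : (L : List 𝒜) (F : 𝒜 → Poly V) (h : Poly V) → (∑ L F *P h) ≈ ∑ L (λ a → F a *P h)
∑-* [] F h = 0P-* h
∑-* (a ∷ L) F h = ≈-trans (+P-* (F a) (∑ L F) h) (+P-cong (≈-refl {f = F a *P h}) (∑-* L F h))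

-- Rotations and adjacent swaps

lookup-ext : {u v : Vec 𝒜 n} → (∀ q → lookup u q ≡ lookup v q) → u ≡ v
lookup-ext {u = u} {v} p = trans (sym (tabulate∘lookup u)) (trans (tabulate-cong p) (tabulate∘lookup v))

toℕ-next : (q : Fin (suc m)) → suc (toℕ q) < suc m → toℕ (next q) ≡ suc (toℕ q)
toℕ-next {m} q lt with suc (toℕ q) ℕ.<? suc m
... | yes p = Finₚ.toℕ-fromℕ< p
... | no ¬p = ⊥-elim (¬p lt)

next-wrap : (q : Fin (suc m)) → toℕ q ≡ m → next q ≡ Fin.zero
next-wrap {m} q eq with suc (toℕ q) ℕ.<? suc m
... | yes p = ⊥-elim (ℕₚ.<-irrefl (cong suc eq) p)
... | no ¬p = refl

last-or-not : (q : Fin (suc m)) → suc (toℕ q) < suc m ⊎ toℕ q ≡ m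
last-or-not q with ℕₚ.m≤n⇒m<n∨m≡n (Finₚ.toℕ<n q)
... | inj₁ lt = inj₁ lt
... | inj₂ eq = inj₂ (ℕₚ.suc-injective eq)

next-injective : {p q : Fin n} → next p ≡ next q → p ≡ q
next-injective {suc m} {p} {q} eq with last-or-not p | last-or-not q
... | inj₁ a | inj₁ b = Finₚ.toℕ-injective (ℕₚ.suc-injective
        (trans (sym (toℕ-next p a)) (trans (cong toℕ eq) (toℕ-next q b))))
... | inj₁ a | inj₂ b with () ← trans (sym (toℕ-next p a)) (cong toℕ (trans eq (next-wrap q b)))
... | inj₂ a | inj₁ b with () ← trans (sym (toℕ-next q b)) (cong toℕ (trans (sym eq) (next-wrap p a)))
... | inj₂ a | inj₂ b = Finₚ.toℕ-injective (trans a (sym b))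

next-≢ : (p : Fin (suc (suc m))) → next p ≢ p
next-≢ p eq with last-or-not p
... | inj₁ a = ℕₚ.1+n≢n (trans (sym (toℕ-next p a)) (cong toℕ eq))
... | inj₂ a with () ← trans (sym a) (cong toℕ (trans (sym eq) (next-wrap p a)))

nextⁿ : ℕ → Fin n → Fin n
nextⁿ zero q = q
nextⁿ (suc k) q = nextⁿ k (next q)

next-nextⁿ : (k : ℕ) (q : Fin n) → next (nextⁿ k q) ≡ nextⁿ k (next q)
next-nextⁿ zero q = refl
next-nextⁿ (suc k) q = next-nextⁿ k (next q)

toℕ-nextⁿ : (k : ℕ) (q : Fin (suc m)) → toℕ q + k < suc m → toℕ (nextⁿ k q) ≡ toℕ q + k
toℕ-nextⁿ zero q lt = sym (ℕₚ.+-identityʳ _)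
toℕ-nextⁿ {m} (suc k) q lt = trans (toℕ-nextⁿ k (next q) (subst (_< suc m) eq lt)) (sym eq)
  where
  eq : toℕ q + suc k ≡ toℕ (next q) + k
  eq = trans (ℕₚ.+-suc (toℕ q) k) (cong (_+ k) (sym (toℕ-next q
         (ℕₚ.≤-<-trans (subst (suc (toℕ q) ≤_) (sym (ℕₚ.+-suc (toℕ q) k)) (s≤s (ℕₚ.m≤m+n _ k))) lt))))

nextⁿ-toℕ : (p : Fin (suc m)) → nextⁿ (toℕ p) Fin.zero ≡ p
nextⁿ-toℕ p = Finₚ.toℕ-injective (toℕ-nextⁿ (toℕ p) Fin.zero (Finₚ.toℕ<n p))

lookup-∷ʳ-last : (xs : Vec 𝒜 m) (x : 𝒜) (q : Fin (suc m)) → toℕ q ≡ m → lookup (xs ∷ʳ x) q ≡ x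
lookup-∷ʳ-last [] x Fin.zero eq = refl
lookup-∷ʳ-last (y ∷ xs) x (Fin.suc q) eq = lookup-∷ʳ-last xs x q (ℕₚ.suc-injective eq)

lookup-∷ʳ-init : (xs : Vec 𝒜 m) (x : 𝒜) (q : Fin (suc m)) (r : Fin m) → toℕ r ≡ toℕ q →
  lookup (xs ∷ʳ x) q ≡ lookup xs r
lookup-∷ʳ-init (y ∷ xs) x Fin.zero Fin.zero eq = refl
lookup-∷ʳ-init (y ∷ xs) x (Fin.suc q) (Fin.suc r) eq = lookup-∷ʳ-init xs x q r (ℕₚ.suc-injective eq)

lookup-rotate : (w : Vec 𝒜 n) (q : Fin n) → lookup (rotate w) q ≡ lookup w (next q)
lookup-rotate {n = suc m} (x ∷ xs) q with last-or-not q
... | inj₂ eq = trans (lookup-∷ʳ-last xs x q eq) (cong (lookup (x ∷ xs)) (sym (next-wrap q eq)))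
... | inj₁ lt with next q | toℕ-next q lt
... | Fin.suc r | eq = lookup-∷ʳ-init xs x q r (ℕₚ.suc-injective eq)

lookup-rotateⁿ : (k : ℕ) (w : Vec 𝒜 n) (q : Fin n) → lookup (rotateⁿ k w) q ≡ lookup w (nextⁿ k q)
lookup-rotateⁿ zero w q = refl
lookup-rotateⁿ (suc k) w q = trans (lookup-rotate (rotateⁿ k w) q) (lookup-rotateⁿ k w (next q))

swapAt-next : (w : State n) (p : Fin n) → lookup (swapAt w p) (next p) ≡ lookup w p
swapAt-next w p = lookup∘update (next p) (w [ p ]≔ lookup w (next p)) _

swapAt-here : (w : State (suc (suc m))) (p : Fin (suc (suc m))) → lookup (swapAt w p) p ≡ lookup w (next p)
swapAt-here w p = trans (lookup∘update′ (next-≢ p ∘ sym) (w [ p ]≔ lookup w (next p)) _) (lookup∘update p w _)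

swapAt-other : (w : State n) (p q : Fin n) → q ≢ p → q ≢ next p → lookup (swapAt w p) q ≡ lookup w q
swapAt-other w p q a b = trans (lookup∘update′ b (w [ p ]≔ lookup w (next p)) _) (lookup∘update′ a w _)

-- Identities between swapped states are checked at the two sites of the swap and at the others; no
-- computation with nested updates is needed across the seam.
swapAt-unique : (u : State (suc (suc m))) (p : Fin (suc (suc m))) (v : State (suc (suc m))) →
  lookup v p ≡ lookup u (next p) → lookup v (next p) ≡ lookup u p →
  (∀ q → q ≢ p → q ≢ next p → lookup v q ≡ lookup u q) → swapAt u p ≡ v
swapAt-unique u p v h h' o = lookup-ext at
  where
  at : ∀ q → lookup (swapAt u p) q ≡ lookup v q
  at q with q Fin.≟ p
  ... | yes refl = trans (swapAt-here u p) (sym h)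
  ... | no a with q Fin.≟ next p
  ... | yes refl = trans (swapAt-next u p) (sym h')
  ... | no b = trans (swapAt-other u p q a b) (sym (o q a b))

swapAt-involutive : (w : State (suc (suc m))) (p : Fin (suc (suc m))) → swapAt (swapAt w p) p ≡ w
swapAt-involutive w p = swapAt-unique (swapAt w p) p w (sym (swapAt-next w p)) (sym (swapAt-here w p))
  (λ q a b → sym (swapAt-other w p q a b))

swapAt-rotate : (u : State (suc (suc m))) (p : Fin (suc (suc m))) →
  swapAt (rotate u) p ≡ rotate (swapAt u (next p))
swapAt-rotate u p = swapAt-unique (rotate u) p (rotate (swapAt u (next p)))
  (trans (lookup-rotate (swapAt u (next p)) p) (trans (swapAt-here u (next p)) (sym (lookup-rotate u (next p)))))
  (trans (lookup-rotate (swapAt u (next p)) (next p)) (trans (swapAt-next u (next p)) (sym (lookup-rotate u p))))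
  (λ q a b → trans (lookup-rotate (swapAt u (next p)) q) (trans
    (swapAt-other u (next p) (next q) (a ∘ next-injective) (b ∘ next-injective)) (sym (lookup-rotate u q))))

swapAt-rotateⁿ : (k : ℕ) (u : State (suc (suc m))) (p : Fin (suc (suc m))) →
  swapAt (rotateⁿ k u) p ≡ rotateⁿ k (swapAt u (nextⁿ k p))
swapAt-rotateⁿ zero u p = refl
swapAt-rotateⁿ (suc k) u p = trans (swapAt-rotate (rotateⁿ k u) p) (cong rotate (swapAt-rotateⁿ k u (next p)))

-- States as words of natural numbers

toList-injective : {u v : Vec 𝒜 n} → toList u ≡ toList v → u ≡ v
toList-injective {u = []} {[]} eq = refl
toList-injective {u = x ∷ u} {y ∷ v} eq with refl ← cong List.head eq | eq' ← cong (List.drop 1) eq =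
  cong (x ∷_) (toList-injective eq')

word : State n → List ℕ
word w = List.map toℕ (toList w)

map-toℕ-injective : {xs ys : List (Fin n)} → List.map toℕ xs ≡ List.map toℕ ys → xs ≡ ys
map-toℕ-injective {xs = []} {[]} eq = refl
map-toℕ-injective {xs = x ∷ xs} {y ∷ ys} eq
  with h ← ∷-injectiveˡ eq | t ← ∷-injectiveʳ eq =
  cong₂ List._∷_ (Finₚ.toℕ-injective h) (map-toℕ-injective t)

word-injective : {u v : State n} → word u ≡ word v → u ≡ v
word-injective eq = toList-injective (map-toℕ-injective eq)

length-word : (w : State n) → List.length (word w) ≡ n
length-word w = trans (length-map toℕ (toList w)) (length-toList w)

rotateL : List 𝒜 → List 𝒜
rotateL [] = []
rotateL (x ∷ xs) = xs List.++ [ x ]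

word-rotate : (w : State n) → word (rotate w) ≡ rotateL (word w)
word-rotate {zero} [] = refl
word-rotate {suc m} (x ∷ xs) =
  trans (cong (List.map toℕ) (toList-∷ʳ x xs)) (map-++ toℕ (toList xs) [ x ])

rotateⁿ-comm : (k : ℕ) (w : Vec 𝒜 n) → rotateⁿ k (rotate w) ≡ rotate (rotateⁿ k w)
rotateⁿ-comm zero w = refl
rotateⁿ-comm (suc k) w = cong rotate (rotateⁿ-comm k w)

rotateⁿ-+ : (j k : ℕ) (w : Vec 𝒜 n) → rotateⁿ (j + k) w ≡ rotateⁿ j (rotateⁿ k w)
rotateⁿ-+ zero k w = refl
rotateⁿ-+ (suc j) k w = cong rotate (rotateⁿ-+ j k w)

word-rotateⁿ : (as bs : List ℕ) (w : State n) → word w ≡ as ++ bs →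
  word (rotateⁿ (List.length as) w) ≡ bs ++ as
word-rotateⁿ [] bs w eq = trans eq (sym (++-identityʳ bs))
word-rotateⁿ (a ∷ as) bs w eq = trans (cong word (sym (rotateⁿ-comm (List.length as) w))) (trans
  (word-rotateⁿ as (bs ++ [ a ]) (rotate w)
    (trans (word-rotate w) (trans (cong rotateL eq) (++-assoc as bs [ a ]))))
  (++-assoc bs [ a ] as))

rotateⁿ-full : (w : State n) → rotateⁿ n w ≡ w
rotateⁿ-full {n} w = word-injective (subst (λ k → word (rotateⁿ k w) ≡ word w) (length-word w)
  (word-rotateⁿ (word w) [] w (sym (++-identityʳ (word w)))))

rotate-injective : {u v : State n} → rotate u ≡ rotate v → u ≡ v
rotate-injective {zero} {[]} {[]} eq = refl
rotate-injective {suc m} {u} {v} eq = begin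
  u ≡⟨ sym (rotateⁿ-full u) ⟩
  rotateⁿ (suc m) u ≡⟨ sym (rotateⁿ-comm m u) ⟩
  rotateⁿ m (rotate u) ≡⟨ cong (rotateⁿ m) eq ⟩
  rotateⁿ m (rotate v) ≡⟨ rotateⁿ-comm m v ⟩
  rotateⁿ (suc m) v ≡⟨ rotateⁿ-full v ⟩
  v ∎
  where open ≡-Reasoning

rotateⁿ-injective : (k : ℕ) {u v : State n} → rotateⁿ k u ≡ rotateⁿ k v → u ≡ v
rotateⁿ-injective zero eq = eq
rotateⁿ-injective (suc k) eq = rotateⁿ-injective k (rotate-injective eq)

-- Permutations

Unique-resp-↭ : {xs ys : List 𝒜} → xs ↭ ys → Unique xs → Unique ys
Unique-resp-↭ p = Permₛ.Unique-resp-↭ (setoid _) (↭⇒↭ₛ p)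

toList-rotate-↭ : (w : Vec 𝒜 n) → toList w ↭ toList (rotate w)
toList-rotate-↭ [] = ↭-refl
toList-rotate-↭ (x ∷ xs) = subst (x ∷ toList xs ↭_) (sym (toList-∷ʳ x xs)) (++-comm [ x ] (toList xs))

IsPerm-rotate : {w : State n} → IsPerm w → IsPerm (rotate w)
IsPerm-rotate {w = w} = Unique-resp-↭ (toList-rotate-↭ w)

IsPerm-rotate⁻ : {w : State n} → IsPerm (rotate w) → IsPerm w
IsPerm-rotate⁻ {w = w} = Unique-resp-↭ (↭-sym (toList-rotate-↭ w))

IsPerm-rotateⁿ : (k : ℕ) {w : State n} → IsPerm w → IsPerm (rotateⁿ k w)
IsPerm-rotateⁿ zero p = p
IsPerm-rotateⁿ (suc k) {w} p = IsPerm-rotate {w = rotateⁿ k w} (IsPerm-rotateⁿ k {w} p)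

IsPerm-rotateⁿ⁻ : (k : ℕ) {w : State n} → IsPerm (rotateⁿ k w) → IsPerm w
IsPerm-rotateⁿ⁻ zero p = p
IsPerm-rotateⁿ⁻ (suc k) {w} p = IsPerm-rotateⁿ⁻ k {w} (IsPerm-rotate⁻ {w = rotateⁿ k w} p)

swapHead : Vec 𝒜 (suc (suc m)) → Vec 𝒜 (suc (suc m))
swapHead (a ∷ b ∷ v) = b ∷ a ∷ v

swapAt-zero : (w : State (suc (suc m))) → swapAt w Fin.zero ≡ swapHead w
swapAt-zero (a ∷ b ∷ v) = refl

rotate-swapAt-head : (k : ℕ) (w : State (suc (suc m))) →
  rotateⁿ k (swapAt w (nextⁿ k Fin.zero)) ≡ swapHead (rotateⁿ k w)
rotate-swapAt-head k w = trans (sym (swapAt-rotateⁿ k w Fin.zero)) (swapAt-zero (rotateⁿ k w))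

IsPerm-swapHead : {w : State (suc (suc m))} → IsPerm w → IsPerm (swapHead w)
IsPerm-swapHead {w = a ∷ b ∷ v} = Unique-resp-↭ (Perm.swap a b Perm.refl)

-- Rotating site p to the front makes the swap a transposition of the first two letters, also when
-- the pair lies across the seam.
IsPerm-swapAt : {w : State (suc (suc m))} (p : Fin (suc (suc m))) → IsPerm w → IsPerm (swapAt w p)
IsPerm-swapAt {w = w} p perm = IsPerm-rotateⁿ⁻ (toℕ p) (subst IsPerm
  (sym (trans (cong (λ z → rotateⁿ (toℕ p) (swapAt w z)) (sym (nextⁿ-toℕ p))) (rotate-swapAt-head (toℕ p) w)))
  (IsPerm-swapHead {w = rotateⁿ (toℕ p) w} (IsPerm-rotateⁿ (toℕ p) {w} perm)))

lookup-∈ : (w : Vec 𝒜 n) (p : Fin n) → lookup w p ∈ toList w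
lookup-∈ (x ∷ w) Fin.zero = here refl
lookup-∈ (x ∷ w) (Fin.suc p) = there (lookup-∈ w p)

lookup-injective : (w : Vec 𝒜 n) → Unique (toList w) → ∀ {p q} → lookup w p ≡ lookup w q → p ≡ q
lookup-injective (x ∷ w) u {Fin.zero} {Fin.zero} eq = refl
lookup-injective (x ∷ w) u {Fin.zero} {Fin.suc q} eq =
  ⊥-elim (Unique[x∷xs]⇒x∉xs u (subst (_∈ toList w) (sym eq) (lookup-∈ w q)))
lookup-injective (x ∷ w) u {Fin.suc p} {Fin.zero} eq =
  ⊥-elim (Unique[x∷xs]⇒x∉xs u (subst (_∈ toList w) eq (lookup-∈ w p)))
lookup-injective (x ∷ w) (_ ∷ u) {Fin.suc p} {Fin.suc q} eq = cong Fin.suc (lookup-injective w u eq)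

-- Pigeonhole: punching out a missing value would make `lookup w` an injection into a smaller set.
IsPerm⇒∈ : {w : State n} → IsPerm w → ∀ x → x ∈ toList w
IsPerm⇒∈ {suc n} {w} perm x with Finₚ.any? (λ p → lookup w p Fin.≟ x)
... | yes (p , refl) = lookup-∈ w p
... | no none = ⊥-elim (ℕₚ.1+n≰n (Finₚ.injective⇒≤ {f = λ p → Fin.punchOut (x≢ p)}
        (λ {p} {q} eq → lookup-injective w perm (Finₚ.punchOut-injective (x≢ p) (x≢ q) eq))))
  where
  x≢ : ∀ p → x ≢ lookup w p
  x≢ p eq = none (p , sym eq)

word-unique : {w : State n} → IsPerm w → Unique (word w)
word-unique perm = Uniqueₚ.map⁺ Finₚ.toℕ-injective perm

word-∈ : {w : State n} → IsPerm w → ∀ {x} → x < n → x ∈ word w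
word-∈ {w = w} perm x<n = subst (_∈ word w) (Finₚ.toℕ-fromℕ< x<n) (∈-map⁺ toℕ (IsPerm⇒∈ {w = w} perm (fromℕ< x<n)))

word-< : (w : State n) → ∀ {x} → x ∈ word w → x < n
word-< w mem with y , _ , refl ← ∈-map⁻ toℕ mem = Finₚ.toℕ<n y

-- Enumeration of the states

-- All vectors are listed, not only the permutations: a swap at a fixed site is an involution of
-- this list, and the states that matter are selected by `when`.
allVecs : (n m : ℕ) → List (Vec (Fin n) m)
allVecs n zero = [ [] ]
allVecs n (suc m) = cartesianProductWith _∷_ (List.allFin n) (allVecs n m)

∈-allVecs : (w : Vec (Fin n) m) → w ∈ allVecs n m
∈-allVecs [] = here refl
∈-allVecs (x ∷ w) = ∈-cartesianProductWith⁺ _∷_ (∈-allFin x) (∈-allVecs w)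

allVecs-unique : (n m : ℕ) → Unique (allVecs n m)
allVecs-unique n zero = [] ∷ []
allVecs-unique n (suc m) =
  cartesianProductWith⁺ _∷_ (λ { refl → refl , refl }) (allFin⁺ n) (allVecs-unique n m)

map-bijection-↭ : {L : List 𝒜} (f g : 𝒜 → 𝒜) → Unique L → (∀ a → a ∈ L) →
  (∀ {a b} → f a ≡ f b → a ≡ b) → (∀ a → f (g a) ≡ a) → List.map f L ↭ L
map-bijection-↭ {L = L} f g u complete inj inv =
  ∼bag⇒↭ (unique∧set⇒bag (Uniqueₚ.map⁺ inj u) u (λ {a} → mk⇔ (λ _ → complete a)
    (λ _ → subst (_∈ List.map f L) (inv a) (∈-map⁺ f (complete (g a))))))

-- Balance equations as identities between shifted polynomials

-- The condition is a decision, so that its proof is available, while `does` of `asc?` and `desc?`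
-- computes to the Boolean tests in `Balance`.
when : Dec 𝒫 → Poly V → Poly V
when P? f = if does P? then f else 0P

when-yes : (P? : Dec 𝒫) {f : Poly V} → 𝒫 → when P? f ≈ f
when-yes (yes _) p = ≈-refl
when-yes (no ¬p) p = ⊥-elim (¬p p)

when-no : (P? : Dec 𝒫) {f : Poly V} → ¬ 𝒫 → when P? f ≈ 0P
when-no (yes p) ¬p = ⊥-elim (¬p p)
when-no (no _) ¬p = ≈-refl

when-cong : (P? : Dec 𝒫) {f g : Poly V} → (𝒫 → f ≈ g) → when P? f ≈ when P? g
when-cong (yes p) h = h p
when-cong (no _) h = ≈-refl

when-⇔ : (P? : Dec 𝒫) (Q? : Dec 𝒬) {f g : Poly V} → (𝒫 → 𝒬) → (𝒬 → 𝒫) → (𝒫 → f ≈ g) → when P? f ≈ when Q? g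
when-⇔ (yes p) Q? to from h = ≈-trans (h p) (≈-sym (when-yes Q? (to p)))
when-⇔ (no ¬p) Q? to from h = ≈-sym (when-no Q? (¬p ∘ from))

when-zero : (P? : Dec 𝒫) {f : Poly V} → f ≈ 0P → when P? f ≈ 0P
when-zero (yes _) z = z
when-zero (no _) z = ≈-refl

when-neg : (P? : Dec 𝒫) (f : Poly V) → when P? (-P f) ≈ (-P when P? f)
when-neg (yes _) f = ≈-refl
when-neg (no _) f = ≈-refl

NonNeg-when : (P? : Dec 𝒫) {f : Poly V} → (𝒫 → NonNeg f) → NonNeg (when P? f)
NonNeg-when (yes p) h = h p
NonNeg-when (no _) h = NonNeg-zero ≈-refl

Asc : State n → Fin n → Set
Asc w p = toℕ (lookup w p) < toℕ (lookup w (next p))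

Desc : State n → Fin n → Set
Desc w p = toℕ (lookup w (next p)) < toℕ (lookup w p)

asc? : (w : State n) (p : Fin n) → Dec (Asc w p)
asc? w p = toℕ (lookup w p) ℕ.<? toℕ (lookup w (next p))

desc? : (w : State n) (p : Fin n) → Dec (Desc w p)
desc? w p = toℕ (lookup w (next p)) ℕ.<? toℕ (lookup w p)

Stationary : (State n → Poly n) → State n → Set
Stationary {n} φ w =
  ∑ (List.allFin n) (λ p → when (asc? w p) (X (lookup w p) (φ w)))
  ≈ ∑ (List.allFin n) (λ p → when (desc? w p) (X (lookup w (next p)) (φ (swapAt w p))))

Balance⇒Stationary : (ψ : State n → Poly n) (w : State n) → Balance ψ w → Stationary ψ w
Balance⇒Stationary {n} ψ w bal = ≈-trans (≈-sym lhs) (≈-trans bal rhs)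
  where
  factor : ∀ {𝒫 : Set} (P? : Dec 𝒫) k → (when P? (var k) *P ψ w) ≈ when P? (X k (ψ w))
  factor (yes _) k = var-* k (ψ w)
  factor (no _) k = 0P-* (ψ w)
  lhs : (∑ (List.allFin n) (λ p → when (asc? w p) (var (lookup w p))) *P ψ w)
    ≈ ∑ (List.allFin n) (λ p → when (asc? w p) (X (lookup w p) (ψ w)))
  lhs = ≈-trans (∑-* (List.allFin n) (λ p → when (asc? w p) (var (lookup w p))) (ψ w))
    (∑-cong (List.allFin n) (λ p → factor (asc? w p) (lookup w p)))
  rhs : ∑ (List.allFin n) (λ p → when (desc? w p) (var (lookup w (next p)) *P ψ (swapAt w p)))
    ≈ ∑ (List.allFin n) (λ p → when (desc? w p) (X (lookup w (next p)) (ψ (swapAt w p))))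
  rhs = ∑-cong (List.allFin n) (λ p → when-cong (desc? w p) (λ _ → var-* (lookup w (next p)) (ψ (swapAt w p))))

asc-swap : (w : State (suc (suc m))) (p : Fin (suc (suc m))) → Desc w p → Asc (swapAt w p) p
asc-swap w p = subst₂ (λ a b → toℕ a < toℕ b) (sym (swapAt-here w p)) (sym (swapAt-next w p))

desc-swap : (w : State (suc (suc m))) (p : Fin (suc (suc m))) → Asc (swapAt w p) p → Desc w p
desc-swap w p = subst₂ (λ a b → toℕ a < toℕ b) (swapAt-here w p) (swapAt-next w p)

-- Summing the balance equations over N, the flow between states of N cancels,
-- so the flow leaving N and the flow entering it cannot both be nonnegative unless they vanish.
no-leak : (c : State (suc (suc m)) → Poly (suc (suc m)))
  (N : State (suc (suc m)) → Set) (N? : ∀ w → Dec (N w))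
  (act : Fin (suc (suc m)) → Set) (act? : ∀ k → Dec (act k))
  (B : State (suc (suc m)) → Fin (suc (suc m)) → Poly (suc (suc m))) →
  (∀ w → N w → NonNeg (-P c w)) →
  (∀ w → N w → ∑ (List.allFin _) (λ p → when (asc? w p ×-dec act? (lookup w p)) (X (lookup w p) (c w)))
    ≈ ∑ (List.allFin _) (B w)) →
  (∀ w → N w → ∀ p → NonNeg (B w p +P
    when ((desc? w p ×-dec act? (lookup w (next p))) ×-dec N? (swapAt w p))
      (X (lookup w (next p)) (-P c (swapAt w p))))) →
  ∀ w p → N w → Asc w p → act (lookup w p) → ¬ N (swapAt w p) → c w ≈ 0P
no-leak {m} c N N? act act? B c≤0 bal B-ok w p Nw ascp actp leaves =
  ≈-trans (≈-sym (-P-involutive (c w))) (-P-zero (X-cancel (lookup w p)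
    (≈-trans (≈-sym (≈-trans (when-yes (¬? (N? (swapAt w p))) leaves) (when-yes (out? w p) (Nw , ascp , actp)))) H≈0)))
  where
  ν = suc (suc m)
  states = allVecs ν ν
  sites = List.allFin ν
  Out : State ν → Fin ν → Set
  Out w p = N w × Asc w p × act (lookup w p)
  out? : ∀ w p → Dec (Out w p)
  out? w p = N? w ×-dec (asc? w p ×-dec act? (lookup w p))
  -- All flows carry the sign of minus c. `F` is the active flow out of a state of N, split into the
  -- part `G` that stays in N and the part `H` that leaves it. In `rest` the second term cancels the
  -- inflow from N, so `R` is the flow entering from elsewhere.
  F G H : State ν → Fin ν → Poly ν
  F w p = when (out? w p) (X (lookup w p) (-P c w))
  G w p = when (N? (swapAt w p)) (F w p)
  H w p = when (¬? (N? (swapAt w p))) (F w p)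
  rest : State ν → Fin ν → Poly ν
  rest w p = B w p +P when ((desc? w p ×-dec act? (lookup w (next p))) ×-dec N? (swapAt w p))
      (X (lookup w (next p)) (-P c (swapAt w p)))
  R : State ν → Fin ν → Poly ν
  R w p = when (N? w) (rest w p)

  F-split : ∀ w p → F w p ≈ (G w p +P H w p)
  F-split w p with N? (swapAt w p)
  ... | yes _ = ≈-sym (+P-identityʳ ≈-refl)
  ... | no _ = ≈-sym (+P-identityˡ ≈-refl)

  F≥0 : ∀ w p → NonNeg (F w p)
  F≥0 w p = NonNeg-when (out? w p) (λ o → NonNeg-X (lookup w p) (c≤0 w (proj₁ o)))
  H≥0 : ∀ w p → NonNeg (H w p)
  H≥0 w p = NonNeg-when (¬? (N? (swapAt w p))) (λ _ → F≥0 w p)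
  R≥0 : ∀ w p → NonNeg (R w p)
  R≥0 w p = NonNeg-when (N? w) (λ Nw → B-ok w Nw p)

  G-swap : ∀ w → N w → ∀ p → G (swapAt w p) p ≈
    when ((desc? w p ×-dec act? (lookup w (next p))) ×-dec N? (swapAt w p))
      (X (lookup w (next p)) (-P c (swapAt w p)))
  G-swap w Nw p = ≈-trans
    (when-yes (N? (swapAt (swapAt w p) p)) (subst N (sym (swapAt-involutive w p)) Nw))
    (when-⇔ (out? (swapAt w p) p) ((desc? w p ×-dec act? (lookup w (next p))) ×-dec N? (swapAt w p))
      (λ (a , b , d) → (desc-swap w p b , subst act (swapAt-here w p) d) , a)
      (λ ((b , d) , a) → a , asc-swap w p b , subst act (sym (swapAt-here w p)) d)
      (λ _ e → cong (λ k → X k (-P c (swapAt w p)) e) (swapAt-here w p)))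

  -- By balance, `F` contributes minus the sum of `B`, and `R` gives that sum back; what remains is
  -- the flow that arrives from N. Outside N every term is zero.
  local : ∀ w → (∑ sites (F w) +P ∑ sites (R w)) ≈ ∑ sites (λ p → G (swapAt w p) p)
  local w = go (N? w)
    where
    go : Dec (N w) → (∑ sites (F w) +P ∑ sites (R w)) ≈ ∑ sites (λ p → G (swapAt w p) p)
    go (no ¬Nw) = ≈-trans (+P-zero
        (∑-zero sites (λ p → when-no (out? w p) (¬Nw ∘ proj₁)))
        (∑-zero sites (λ p → when-no (N? w) ¬Nw)))
      (≈-sym (∑-zero sites (λ p → when-no (N? (swapAt (swapAt w p) p)) (¬Nw ∘ subst N (swapAt-involutive w p)))))
    go (yes Nw) e = begin
      ∑ sites (F w) e ℤ.+ ∑ sites (R w) e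
        ≡⟨ cong₂ ℤ._+_ (FX e) (RX e) ⟩
      ℤ.- ∑ sites (B w) e ℤ.+ (∑ sites (B w) e ℤ.+ Z)
        ≡⟨ sym (ℤₚ.+-assoc (ℤ.- ∑ sites (B w) e) _ Z) ⟩
      (ℤ.- ∑ sites (B w) e ℤ.+ ∑ sites (B w) e) ℤ.+ Z
        ≡⟨ cong (ℤ._+ Z) (ℤₚ.+-inverseˡ (∑ sites (B w) e)) ⟩
      0ℤ ℤ.+ Z
        ≡⟨ ℤₚ.+-identityˡ Z ⟩
      Z ∎
      where
      open ≡-Reasoning
      Z = ∑ sites (λ p → G (swapAt w p) p) e
      neg-when : ∀ p → F w p ≈ (-P when (asc? w p ×-dec act? (lookup w p)) (X (lookup w p) (c w)))
      neg-when p = ≈-trans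
        (when-⇔ (out? w p) (asc? w p ×-dec act? (lookup w p)) proj₂ (Nw ,_) (λ _ → X-neg (lookup w p) (c w)))
        (when-neg (asc? w p ×-dec act? (lookup w p)) (X (lookup w p) (c w)))
      FX : ∑ sites (F w) ≈ (-P ∑ sites (B w))
      FX = ≈-trans (∑-cong sites neg-when) (≈-trans
        (∑-neg sites (λ p → when (asc? w p ×-dec act? (lookup w p)) (X (lookup w p) (c w)))) (-P-cong (bal w Nw)))
      RX : ∑ sites (R w) ≈ (∑ sites (B w) +P ∑ sites (λ p → G (swapAt w p) p))
      RX = ≈-trans (∑-cong sites (λ p → ≈-trans (when-yes (N? w) Nw)
          (+P-cong (≈-refl {f = B w p}) (≈-sym (G-swap w Nw p)))))
        (∑-+ sites (B w) (λ p → G (swapAt w p) p))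

  -- For fixed p the swap is an involution of the states, so the internal flow summed over its
  -- targets equals the same flow summed over its sources.
  reindex : ∑ states (λ w → ∑ sites (λ p → G (swapAt w p) p)) ≈ ∑ states (λ w → ∑ sites (G w))
  reindex = ≈-trans (∑-comm states sites (λ w p → G (swapAt w p) p))
    (≈-trans (∑-cong sites permute) (≈-sym (∑-comm states sites G)))
    where
    permute : ∀ p → ∑ states (λ w → G (swapAt w p) p) ≈ ∑ states (λ w → G w p)
    permute p = ≈-trans (≈-sym (∑-map (λ w → swapAt w p) states (λ w → G w p))) (∑-↭
      (map-bijection-↭ (λ w → swapAt w p) (λ w → swapAt w p) (allVecs-unique ν ν) ∈-allVecs
        (λ {a} {b} eq → trans (sym (swapAt-involutive a p)) (trans (cong (λ z → swapAt z p) eq) (swapAt-involutive b p)))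
        (λ a → swapAt-involutive a p))
      (λ w → G w p))

  total : (∑ states (λ w → ∑ sites (H w)) +P ∑ states (λ w → ∑ sites (R w))) ≈ 0P
  total e = +-cancel (begin
    g ℤ.+ (h ℤ.+ r)    ≡⟨ sym (ℤₚ.+-assoc g h r) ⟩
    (g ℤ.+ h) ℤ.+ r    ≡⟨ cong (ℤ._+ r) (sym (≈-trans (∑-cong states (λ w → ≈-trans (∑-cong sites (F-split w)) (∑-+ sites (G w) (H w))))
                             (∑-+ states (λ w → ∑ sites (G w)) (λ w → ∑ sites (H w))) e)) ⟩
    ∑ states (λ w → ∑ sites (F w)) e ℤ.+ r ≡⟨ sym (∑-+ states (λ w → ∑ sites (F w)) (λ w → ∑ sites (R w)) e) ⟩
    ∑ states (λ w → ∑ sites (F w) +P ∑ sites (R w)) e ≡⟨ ∑-cong states local e ⟩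
    ∑ states (λ w → ∑ sites (λ p → G (swapAt w p) p)) e ≡⟨ reindex e ⟩
    g ∎)
    where
    open ≡-Reasoning
    g = ∑ states (λ w → ∑ sites (G w)) e
    h = ∑ states (λ w → ∑ sites (H w)) e
    r = ∑ states (λ w → ∑ sites (R w)) e
    +-cancel : g ℤ.+ (h ℤ.+ r) ≡ g → h ℤ.+ r ≡ 0ℤ
    +-cancel eq = identityʳ-unique g (h ℤ.+ r) eq

  H≈0 : H w p ≈ 0P
  H≈0 = NonNeg-∑-zero sites (H≥0 w) (NonNeg-∑-zero states (λ w → NonNeg-∑ sites (H≥0 w))
    (NonNeg-sum-zero (NonNeg-∑ states (λ w → NonNeg-∑ sites (H≥0 w))) (NonNeg-∑ states (λ w → NonNeg-∑ sites (R≥0 w))) total)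
    (∈-allVecs w)) (∈-allFin p)

IsPerm? : (w : State n) → Dec (IsPerm w)
IsPerm? w = unique? Fin._≟_ (toList w)

-- Rotation invariance

prev : Fin (suc m) → Fin (suc m)
prev {m} Fin.zero = Fin.fromℕ m
prev (Fin.suc r) = Fin.inject₁ r

next-prev : (p : Fin (suc m)) → next (prev p) ≡ p
next-prev {m} Fin.zero = next-wrap (Fin.fromℕ m) (Finₚ.toℕ-fromℕ m)
next-prev {suc m} (Fin.suc r) = Finₚ.toℕ-injective (trans
  (toℕ-next (Fin.inject₁ r) (s≤s (subst (_< suc m) (sym (Finₚ.toℕ-inject₁ r)) (Finₚ.toℕ<n r))))
  (cong suc (Finₚ.toℕ-inject₁ r)))

∑-next : (F : Fin (suc m) → Poly V) → ∑ (List.allFin (suc m)) (F ∘ next) ≈ ∑ (List.allFin (suc m)) F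
∑-next {m} F = ≈-trans (≈-sym (∑-map next (List.allFin (suc m)) F))
  (∑-↭ (map-bijection-↭ next prev (allFin⁺ (suc m)) ∈-allFin next-injective next-prev) F)

Stationary-rotate : (ψ : State (suc (suc m)) → Poly (suc (suc m))) (w : State (suc (suc m))) →
  Stationary ψ (rotate w) → Stationary (ψ ∘ rotate) w
Stationary-rotate {m} ψ w st = ≈-trans (≈-sym lhs) (≈-trans st rhs)
  where
  out inn : Fin (suc (suc m)) → Poly (suc (suc m))
  out p = when (asc? w p) (X (lookup w p) (ψ (rotate w)))
  inn p = when (desc? w p) (X (lookup w (next p)) (ψ (rotate (swapAt w p))))
  here≡ : ∀ p → lookup (rotate w) p ≡ lookup w (next p)
  here≡ = lookup-rotate w
  lhs : ∑ (List.allFin _) (λ p → when (asc? (rotate w) p) (X (lookup (rotate w) p) (ψ (rotate w)))) ≈ ∑ (List.allFin _) out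
  lhs = ≈-trans (∑-cong (List.allFin _) (λ p → when-⇔ (asc? (rotate w) p) (asc? w (next p))
      (subst₂ (λ a b → toℕ a < toℕ b) (here≡ p) (here≡ (next p)))
      (subst₂ (λ a b → toℕ a < toℕ b) (sym (here≡ p)) (sym (here≡ (next p))))
      (λ _ e → cong (λ k → X k (ψ (rotate w)) e) (here≡ p))))
    (∑-next out)
  rhs : ∑ (List.allFin _) (λ p → when (desc? (rotate w) p) (X (lookup (rotate w) (next p)) (ψ (swapAt (rotate w) p))))
    ≈ ∑ (List.allFin _) inn
  rhs = ≈-trans (∑-cong (List.allFin _) (λ p → when-⇔ (desc? (rotate w) p) (desc? w (next p))
      (subst₂ (λ a b → toℕ a < toℕ b) (here≡ (next p)) (here≡ p))
      (subst₂ (λ a b → toℕ a < toℕ b) (sym (here≡ (next p))) (sym (here≡ p)))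
      (λ _ e → cong₂ (λ k u → X k (ψ u) e) (here≡ (next p)) (swapAt-rotate w p))))
    (∑-next inn)

Stationary-+ : (φ χ : State n → Poly n) (w : State n) →
  Stationary φ w → Stationary χ w → Stationary (λ u → φ u +P χ u) w
Stationary-+ {n} φ χ w st st' = ≈-trans (split (asc? w) (lookup w) (λ _ → w))
  (≈-trans (+P-cong st st') (≈-sym (split (desc? w) (λ p → lookup w (next p)) (swapAt w))))
  where
  split : {T : Fin n → Set} (T? : ∀ p → Dec (T p)) (k : Fin n → Fin n) (u : Fin n → State n) →
    ∑ (List.allFin n) (λ p → when (T? p) (X (k p) (φ (u p) +P χ (u p))))
    ≈ (∑ (List.allFin n) (λ p → when (T? p) (X (k p) (φ (u p)))) +P ∑ (List.allFin n) (λ p → when (T? p) (X (k p) (χ (u p)))))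
  split T? k u = ≈-trans (∑-cong (List.allFin n) (λ p → term (T? p) (k p) (φ (u p)) (χ (u p))))
    (∑-+ (List.allFin n) (λ p → when (T? p) (X (k p) (φ (u p)))) (λ p → when (T? p) (X (k p) (χ (u p)))))
    where
    term : {T : Set} (T? : Dec T) (k : Fin n) (f g : Poly n) →
      when T? (X k (f +P g)) ≈ (when T? (X k f) +P when T? (X k g))
    term (yes _) k f g = X-+ k f g
    term (no _) k f g = ≈-refl

Stationary-neg : (φ : State n → Poly n) (w : State n) → Stationary φ w → Stationary (λ u → -P φ u) w
Stationary-neg {n} φ w st = ≈-trans (pull (asc? w) (lookup w) (λ _ → w))
  (≈-trans (-P-cong st) (≈-sym (pull (desc? w) (λ p → lookup w (next p)) (swapAt w))))
  where
  pull : {T : Fin n → Set} (T? : ∀ p → Dec (T p)) (k : Fin n → Fin n) (u : Fin n → State n) →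
    ∑ (List.allFin n) (λ p → when (T? p) (X (k p) (-P φ (u p))))
    ≈ (-P ∑ (List.allFin n) (λ p → when (T? p) (X (k p) (φ (u p)))))
  pull T? k u = ≈-trans (∑-cong (List.allFin n) (λ p → ≈-trans (when-cong (T? p) (λ _ → X-neg (k p) (φ (u p))))
      (when-neg (T? p) (X (k p) (φ (u p))))))
    (∑-neg (List.allFin n) (λ p → when (T? p) (X (k p) (φ (u p)))))

-- Carrying the smallest particle around the ring

word-headSwap : (w : State (suc (suc m))) {a b : ℕ} {l : List ℕ} → word w ≡ a ∷ b ∷ l →
  word (swapHead w) ≡ b ∷ a ∷ l
word-headSwap (x ∷ y ∷ v) refl = refl

word-lookup₀ : (w : State (suc (suc m))) {a b : ℕ} {l : List ℕ} → word w ≡ a ∷ b ∷ l →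
  toℕ (lookup w Fin.zero) ≡ a
word-lookup₀ (x ∷ y ∷ v) refl = refl

word-lookup₁ : (w : State (suc (suc m))) {a b : ℕ} {l : List ℕ} → word w ≡ a ∷ b ∷ l →
  toℕ (lookup w (Fin.suc Fin.zero)) ≡ b
word-lookup₁ (x ∷ y ∷ v) refl = refl

-- After rotating site p to the front, the swap at p (also the one across the seam) exchanges the first two letters.
record AtHead (w : State (suc (suc m))) (p : Fin (suc (suc m))) (k : ℕ) (a b : ℕ) : Set where
  constructor atHead
  field
    lookup-a : toℕ (lookup w p) ≡ a
    lookup-b : toℕ (lookup w (next p)) ≡ b
    swapped  : rotateⁿ k (swapAt w p) ≡ swapHead (rotateⁿ k w)

at-head : (k : ℕ) (w : State (suc (suc m))) {a b : ℕ} {l : List ℕ} → word (rotateⁿ k w) ≡ a ∷ b ∷ l →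
  AtHead w (nextⁿ k Fin.zero) k a b
at-head k w eq = atHead
  (trans (cong toℕ (sym (lookup-rotateⁿ k w Fin.zero))) (word-lookup₀ (rotateⁿ k w) eq))
  (trans (cong (λ q → toℕ (lookup w q)) (next-nextⁿ k Fin.zero))
    (trans (cong toℕ (sym (lookup-rotateⁿ k w (next Fin.zero)))) (word-lookup₁ (rotateⁿ k w) eq)))
  (rotate-swapAt-head k w)

module _ (N : State (suc (suc m)) → Set) (closed : ∀ w p → N w → Asc w p → N (swapAt w p)) where

  -- Each swap moves particle 0 one site to the right, so one further rotation brings it to the
  -- front again, and the letters it has passed collect at the back.
  carry : (as bs : List ℕ) (k : ℕ) (w : State (suc (suc m))) → N w → 0 ∉ as →
    word (rotateⁿ k w) ≡ 0 ∷ as ++ bs →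
    ∃ λ w' → N w' × word (rotateⁿ (List.length as + k) w') ≡ 0 ∷ bs ++ as
  carry [] bs k w Nw 0∉ eq = w , Nw , trans eq (cong (0 ∷_) (sym (++-identityʳ bs)))
  carry (a ∷ as) bs k w Nw 0∉ eq =
    let w'' , Nw'' , eq'' = carry as (bs ++ [ a ]) (suc k) w' Nw' (0∉ ∘ there) eq'
    in w'' , Nw'' , trans (cong (λ j → word (rotateⁿ j w'')) (sym (ℕₚ.+-suc (List.length as) k)))
         (trans eq'' (cong (0 ∷_) (++-assoc bs [ a ] as)))
    where
    p = nextⁿ k Fin.zero
    h = at-head k w eq
    w' = swapAt w p
    0<a : 0 < a
    0<a = ℕₚ.n≢0⇒n>0 (λ z → 0∉ (here (sym z)))
    Nw' : N w'
    Nw' = closed w p Nw (subst₂ _<_ (sym (AtHead.lookup-a h)) (sym (AtHead.lookup-b h)) 0<a)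
    eq' : word (rotateⁿ (suc k) w') ≡ 0 ∷ as ++ (bs ++ [ a ])
    eq' = trans (word-rotate (rotateⁿ k w')) (trans
      (cong rotateL (trans (cong word (AtHead.swapped h)) (word-headSwap (rotateⁿ k w) eq)))
      (cong (0 ∷_) (++-assoc as bs [ a ])))

  -- Particle 0 overtakes every other particle, so carrying it once around the ring rotates the state.
  closed-rotate : (w : State (suc (suc m))) → IsPerm w → N w → N (rotate w)
  closed-rotate w perm Nw
    with as , bs , eq ← ∈-∃++ (word-∈ {w = w} perm {0} (s≤s z≤n)) = subst N w'≡ Nw'
    where
    k = List.length as
    as' = bs ++ as
    start : word (rotateⁿ k w) ≡ 0 ∷ as' ++ []
    start = trans (word-rotateⁿ as (0 ∷ bs) w eq) (cong (0 ∷_) (sym (++-identityʳ as')))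
    0∉ : 0 ∉ as'
    0∉ = Unique[x∷xs]⇒x∉xs (subst Unique (trans start (cong (0 ∷_) (++-identityʳ as')))
           (word-unique {w = rotateⁿ k w} (IsPerm-rotateⁿ k {w} perm)))
    result = carry as' [] k w Nw 0∉ start
    w' = proj₁ result
    Nw' = proj₁ (proj₂ result)
    l = List.length as'
    same : rotateⁿ (l + k) w' ≡ rotateⁿ k w
    same = word-injective (trans (proj₂ (proj₂ result)) (sym (trans start (cong (0 ∷_) (++-identityʳ as')))))
    full : suc l ≡ suc (suc m)
    full = trans (cong List.length (sym (trans start (cong (0 ∷_) (++-identityʳ as'))))) (length-word (rotateⁿ k w))
    w'≡ : w' ≡ rotate w
    w'≡ = rotateⁿ-injective k (begin
      rotateⁿ k w' ≡⟨ sym (rotateⁿ-full (rotateⁿ k w')) ⟩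
      rotateⁿ (suc (suc m)) (rotateⁿ k w') ≡⟨ cong (λ j → rotateⁿ j (rotateⁿ k w')) (sym full) ⟩
      rotateⁿ (suc l) (rotateⁿ k w') ≡⟨ sym (rotateⁿ-+ (suc l) k w') ⟩
      rotate (rotateⁿ (l + k) w') ≡⟨ cong rotate same ⟩
      rotate (rotateⁿ k w) ≡⟨ sym (rotateⁿ-comm k w) ⟩
      rotateⁿ k (rotate w) ∎)
      where open ≡-Reasoning

-- Solutions with vanishing orbit sums

Negative : Poly V → Set
Negative f = ¬ (f ≈ 0P) × NonNeg (-P f)

negative? : (f : Poly V) → IsPoly f → Dec (Negative f)
negative? f b with sign f b
... | nought z = no (λ (ne , _) → ne z)
... | plus ne nn = no (λ (_ , nn') → ne (NonNeg-antisym nn nn'))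
... | minus ne nn = yes (ne , nn)

¬Negative⇒NonNeg : {f : Poly V} → IsPoly f → ¬ Negative f → NonNeg f
¬Negative⇒NonNeg {f = f} b ¬neg with sign f b
... | nought z = NonNeg-zero z
... | plus ne nn = nn
... | minus ne nn = ⊥-elim (¬neg (ne , nn))

permNegative? : (c : State n → Poly V) → (∀ w → IsPerm w → IsPoly (c w)) →
  ∀ w → Dec (IsPerm w × Negative (c w))
permNegative? c poly w with IsPerm? w
... | no ¬perm = no (¬perm ∘ proj₁)
... | yes perm with negative? (c w) (poly w perm)
... | yes neg = yes (perm , neg)
... | no ¬neg = no (¬neg ∘ proj₂)

-- No flow can leave the set of negative states, so it is closed under all swaps and, through
-- `closed-rotate`, under rotation. A negative value would make the whole orbit negative, and an
-- orbit sum of zero would force each of these values to vanish.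
orbit-zero⇒NonNeg : (D : State (suc (suc m)) → Poly (suc (suc m))) →
  (∀ w → IsPerm w → IsPoly (D w)) → (∀ w → IsPerm w → Stationary D w) →
  (∀ w → ∑ (downFrom (suc (suc m))) (λ j → D (rotateⁿ j w)) ≈ 0P) →
  ∀ w → IsPerm w → NonNeg (D w)
orbit-zero⇒NonNeg {m} D poly stat orbit w perm = ¬Negative⇒NonNeg (poly w perm) (λ neg → notN (perm , neg))
  where
  N : State (suc (suc m)) → Set
  N w = IsPerm w × Negative (D w)
  N? : ∀ w → Dec (N w)
  N? = permNegative? D poly
  act? : Fin (suc (suc m)) → Dec ⊤
  act? _ = yes tt
  In : State (suc (suc m)) → Fin (suc (suc m)) → Poly (suc (suc m))
  In w p = when (desc? w p) (X (lookup w (next p)) (D (swapAt w p)))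
  In-ok : ∀ w → N w → ∀ p → NonNeg (In w p +P
    when ((desc? w p ×-dec act? (lookup w (next p))) ×-dec N? (swapAt w p))
      (X (lookup w (next p)) (-P D (swapAt w p))))
  In-ok w (perm , _) p = go (N? (swapAt w p)) (desc? w p)
    where
    k = lookup w (next p)
    w' = swapAt w p
    go : (N?w' : Dec (N w')) (d? : Dec (Desc w p)) →
      NonNeg (when d? (X k (D w')) +P when ((d? ×-dec act? k) ×-dec N?w') (X k (-P D w')))
    go N?w' (no ¬d) = NonNeg-zero (+P-zero ≈-refl ≈-refl)
    go (no ¬N) (yes d) = NonNeg-resp {f = X k (D w')} (≈-sym (+P-identityʳ ≈-refl))
      (NonNeg-X k {D w'} (¬Negative⇒NonNeg (poly w' perm') (λ neg → ¬N (perm' , neg))))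
      where perm' = IsPerm-swapAt {w = w} p perm
    go (yes _) (yes d) = NonNeg-zero (λ e → trans (cong (ℤ._+_ (X k (D w') e)) (X-neg k (D w') e))
      (ℤₚ.+-inverseʳ (X k (D w') e)))
  stat' : ∀ w → N w → ∑ (List.allFin _) (λ p → when (asc? w p ×-dec act? (lookup w p)) (X (lookup w p) (D w)))
    ≈ ∑ (List.allFin _) (In w)
  stat' w (perm , _) = ≈-trans (∑-cong (List.allFin _) (λ p →
    when-⇔ (asc? w p ×-dec act? (lookup w p)) (asc? w p) proj₁ (_, tt) (λ _ → ≈-refl))) (stat w perm)
  closed : ∀ w p → N w → Asc w p → N (swapAt w p)
  closed w p Nw@(perm , ne , nn) asc with N? (swapAt w p)
  ... | yes N' = N'
  ... | no ¬N = ⊥-elim (ne (no-leak D N N? (λ _ → ⊤) act? In (λ w Nw → proj₂ (proj₂ Nw)) stat' In-ok w p Nw asc tt ¬N))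
  orbitN : ∀ w → N w → ∀ j → N (rotateⁿ j w)
  orbitN w Nw zero = Nw
  orbitN w Nw (suc j) = closed-rotate N closed (rotateⁿ j w) (IsPerm-rotateⁿ j {w} (proj₁ Nw)) (orbitN w Nw j)
  notN : ¬ N w
  notN Nw = proj₁ (proj₂ Nw) (≈-trans (≈-sym (-P-involutive (D w))) (-P-zero
    (NonNeg-∑-zero (downFrom (suc (suc m))) {F = λ j → -P D (rotateⁿ j w)} (λ j → proj₂ (proj₂ (orbitN w Nw j)))
      (≈-trans (∑-neg (downFrom (suc (suc m))) (λ j → D (rotateⁿ j w))) (-P-zero (orbit w)))
      (∈-downFrom⁺ (s≤s z≤n)))))

-- Rotation only renames the sites, so the difference of ψ and its rotation solves the same
-- equations. Over a full orbit this difference telescopes to zero, and both it and its negative are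
-- therefore nonnegative.
rotation-invariant : (ψ : State (suc (suc m)) → Poly (suc (suc m))) →
  (∀ w → IsPerm w → IsPoly (ψ w)) → (∀ w → IsPerm w → Stationary ψ w) →
  ∀ w → IsPerm w → ψ (rotate w) ≈ ψ w
rotation-invariant {m} ψ poly stat w perm e = ℤₚ.neg-injective (inverseʳ-unique (ψ w e) (ℤ.- ψ (rotate w) e) (D≈0 e))
  where
  D : State (suc (suc m)) → Poly (suc (suc m))
  D w = ψ w +P (-P ψ (rotate w))
  polyD : ∀ w → IsPerm w → IsPoly (D w)
  polyD w perm = IsPoly-+ (poly w perm) (IsPoly-neg (poly (rotate w) (IsPerm-rotate {w = w} perm)))
  statD : ∀ w → IsPerm w → Stationary D w
  statD w perm = Stationary-+ ψ (λ u → -P ψ (rotate u)) w (stat w perm)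
    (Stationary-neg (ψ ∘ rotate) w (Stationary-rotate ψ w (stat (rotate w) (IsPerm-rotate {w = w} perm))))
  telescope : ∀ w k → ∑ (downFrom k) (λ j → D (rotateⁿ j w)) ≈ (ψ w +P (-P ψ (rotateⁿ k w)))
  telescope w zero e = sym (ℤₚ.+-inverseʳ (ψ w e))
  telescope w (suc k) e = begin
    (b ℤ.+ ℤ.- c) ℤ.+ ∑ (downFrom k) (λ j → D (rotateⁿ j w)) e ≡⟨ cong (ℤ._+_ (b ℤ.+ ℤ.- c)) (telescope w k e) ⟩
    (b ℤ.+ ℤ.- c) ℤ.+ (a ℤ.+ ℤ.- b) ≡⟨ ℤₚ.+-comm (b ℤ.+ ℤ.- c) (a ℤ.+ ℤ.- b) ⟩
    (a ℤ.+ ℤ.- b) ℤ.+ (b ℤ.+ ℤ.- c) ≡⟨ +-interchange a (ℤ.- b) b (ℤ.- c) ⟩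
    (a ℤ.+ b) ℤ.+ (ℤ.- b ℤ.+ ℤ.- c) ≡⟨ cong (ℤ._+ (ℤ.- b ℤ.+ ℤ.- c)) (ℤₚ.+-comm a b) ⟩
    (b ℤ.+ a) ℤ.+ (ℤ.- b ℤ.+ ℤ.- c) ≡⟨ +-interchange b a (ℤ.- b) (ℤ.- c) ⟩
    (b ℤ.+ ℤ.- b) ℤ.+ (a ℤ.+ ℤ.- c) ≡⟨ cong (ℤ._+ (a ℤ.+ ℤ.- c)) (ℤₚ.+-inverseʳ b) ⟩
    0ℤ ℤ.+ (a ℤ.+ ℤ.- c) ≡⟨ ℤₚ.+-identityˡ _ ⟩
    a ℤ.+ ℤ.- c ∎
    where
    open ≡-Reasoning
    a = ψ w e
    b = ψ (rotateⁿ k w) e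
    c = ψ (rotateⁿ (suc k) w) e
  orbitD : ∀ w → ∑ (downFrom (suc (suc m))) (λ j → D (rotateⁿ j w)) ≈ 0P
  orbitD w = ≈-trans (telescope w (suc (suc m)))
    (λ e → trans (cong (λ u → ψ w e ℤ.+ ℤ.- ψ u e) (rotateⁿ-full w)) (ℤₚ.+-inverseʳ (ψ w e)))
  D≈0 : D w ≈ 0P
  D≈0 = NonNeg-antisym
    (orbit-zero⇒NonNeg D polyD statD orbitD w perm)
    (orbit-zero⇒NonNeg (λ u → -P D u) (λ u p → IsPoly-neg (polyD u p)) (λ u p → Stationary-neg D u (statD u p))
      (λ u → ≈-trans (∑-neg (downFrom (suc (suc m))) (λ j → D (rotateⁿ j u))) (-P-zero (orbitD u))) w perm)

-- The statistic α on words

before after : ℕ → List ℕ → List ℕ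
before r [] = []
before r (x ∷ xs) with x ℕ.≟ r
... | yes _ = []
... | no _ = x ∷ before r xs
after r [] = []
after r (x ∷ xs) with x ℕ.≟ r
... | yes _ = xs
... | no _ = after r xs

count> : ℕ → List ℕ → ℕ
count> v [] = 0
count> v (x ∷ xs) = (if v <ᵇ x then 1 else 0) + count> v xs

-- The other letters in cyclic order, starting behind the letter r.
arc : ℕ → List ℕ → List ℕ
arc r l = after r l ++ before r l

-- The end points b+1 and b, which `alpha` reads as well, do not exceed b+1 and are left out.
-- Expressed through `arc`, the count no longer involves positions.
αL : ℕ → List ℕ → ℕ
αL b l = count> (suc b) (before b (arc (suc b) l))

before-here : ∀ r xs → before r (r ∷ xs) ≡ []
before-here r xs with r ℕ.≟ r
... | yes _ = refl
... | no ne = ⊥-elim (ne refl)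

before-there : ∀ {r x} xs → x ≢ r → before r (x ∷ xs) ≡ x ∷ before r xs
before-there {r} {x} xs ne with x ℕ.≟ r
... | yes eq = ⊥-elim (ne eq)
... | no _ = refl

after-here : ∀ r xs → after r (r ∷ xs) ≡ xs
after-here r xs with r ℕ.≟ r
... | yes _ = refl
... | no ne = ⊥-elim (ne refl)

after-there : ∀ {r x} xs → x ≢ r → after r (x ∷ xs) ≡ after r xs
after-there {r} {x} xs ne with x ℕ.≟ r
... | yes eq = ⊥-elim (ne eq)
... | no _ = refl

before-++-∈ : ∀ {r} xs ys → r ∈ xs → before r (xs ++ ys) ≡ before r xs
before-++-∈ {r} (x ∷ xs) ys mem with x ℕ.≟ r
... | yes _ = refl
before-++-∈ (x ∷ xs) ys (here refl) | no ne = ⊥-elim (ne refl)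
before-++-∈ (x ∷ xs) ys (there mem) | no ne = cong (x ∷_) (before-++-∈ xs ys mem)

before-++-∉ : ∀ {r} xs ys → r ∉ xs → before r (xs ++ ys) ≡ xs ++ before r ys
before-++-∉ [] ys nm = refl
before-++-∉ (x ∷ xs) ys nm = trans (before-there (xs ++ ys) (λ eq → nm (here (sym eq))))
  (cong (x ∷_) (before-++-∉ xs ys (nm ∘ there)))

after-++-∈ : ∀ {r} xs ys → r ∈ xs → after r (xs ++ ys) ≡ after r xs ++ ys
after-++-∈ {r} (x ∷ xs) ys mem with x ℕ.≟ r
... | yes _ = refl
after-++-∈ (x ∷ xs) ys (here refl) | no ne = ⊥-elim (ne refl)
after-++-∈ (x ∷ xs) ys (there mem) | no ne = after-++-∈ xs ys mem

after-++-∉ : ∀ {r} xs ys → r ∉ xs → after r (xs ++ ys) ≡ after r ys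
after-++-∉ [] ys nm = refl
after-++-∉ (x ∷ xs) ys nm = trans (after-there (xs ++ ys) (λ eq → nm (here (sym eq))))
  (after-++-∉ xs ys (nm ∘ there))

split-at : ∀ {r} xs → r ∈ xs → xs ≡ before r xs ++ r ∷ after r xs
split-at {r} (x ∷ xs) mem with x ℕ.≟ r
... | yes refl = refl
split-at (x ∷ xs) (here refl) | no ne = ⊥-elim (ne refl)
split-at (x ∷ xs) (there mem) | no ne = cong (x ∷_) (split-at xs mem)

∉-before : ∀ r xs → r ∉ before r xs
∉-before r (x ∷ xs) mem with x ℕ.≟ r
∉-before r (x ∷ xs) (here eq) | no ne = ne (sym eq)
∉-before r (x ∷ xs) (there mem) | no ne = ∉-before r xs mem

∈-arc : ∀ {r b} l → r ∈ l → b ∈ l → b ≢ r → b ∈ arc r l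
∈-arc {r} {b} l rm bm ne with ∈-++⁻ (before r l) (subst (b ∈_) (split-at l rm) bm)
... | inj₁ m = ∈-++⁺ʳ (after r l) m
... | inj₂ (here eq) = ⊥-elim (ne eq)
... | inj₂ (there m) = ∈-++⁺ˡ m

arc-rotate : ∀ {r} l → Unique l → r ∈ l → arc r (rotateL l) ≡ arc r l
arc-rotate {r} (x ∷ xs) u mem with x ℕ.≟ r
... | yes refl = trans (cong₂ _++_
          (trans (after-++-∉ xs _ (Unique[x∷xs]⇒x∉xs u)) (after-here x []))
          (trans (before-++-∉ xs _ (Unique[x∷xs]⇒x∉xs u)) (cong (xs ++_) (before-here x []))))
        refl
arc-rotate (x ∷ xs) u (here refl) | no ne = ⊥-elim (ne refl)
arc-rotate {r} (x ∷ xs) u (there mem) | no ne = trans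
  (cong₂ _++_ (after-++-∈ xs _ mem) (before-++-∈ xs _ mem)) (++-assoc (after r xs) [ x ] (before r xs))

αL-rotate : ∀ b l → Unique l → suc b ∈ l → αL b (rotateL l) ≡ αL b l
αL-rotate b l u mem = cong (count> (suc b) ∘ before b) (arc-rotate l u mem)

count>-++ : ∀ v xs ys → count> v (xs ++ ys) ≡ count> v xs + count> v ys
count>-++ v [] ys = refl
count>-++ v (x ∷ xs) ys = trans (cong ((if v <ᵇ x then 1 else 0) +_) (count>-++ v xs ys))
  (sym (ℕₚ.+-assoc (if v <ᵇ x then 1 else 0) (count> v xs) (count> v ys)))

<ᵇ-true : ∀ {a b} → a < b → (a <ᵇ b) ≡ true
<ᵇ-true {a} {b} lt with a <ᵇ b | ℕₚ.<⇒<ᵇ lt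
... | true | _ = refl

<ᵇ-false : ∀ {a b} → ¬ a < b → (a <ᵇ b) ≡ false
<ᵇ-false {a} {b} ¬lt with a <ᵇ b in eq
... | true = ⊥-elim (¬lt (ℕₚ.<ᵇ⇒< a b (subst T (sym eq) _)))
... | false = refl

count>-small : ∀ {v x} xs → ¬ v < x → count> v (x ∷ xs) ≡ count> v xs
count>-small xs ¬lt rewrite <ᵇ-false ¬lt = refl

count>-large : ∀ {v x} xs → v < x → count> v (x ∷ xs) ≡ suc (count> v xs)
count>-large xs lt rewrite <ᵇ-true lt = refl

-- The effect of a swap on α

module _ {k j : ℕ} (k<j : k < j) (xs : List ℕ) (k∉ : k ∉ xs) where

  private
    k≢j : k ≢ j
    k≢j eq = ℕₚ.<-irrefl eq k<j
    lo hi : List ℕ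
    lo = k ∷ j ∷ xs
    hi = j ∷ k ∷ xs

  -- Read from k, the letter j comes first before the swap and last after it, hence beyond k-1.
  αL-pred : ∀ b → suc b ≡ k → b ∈ xs → αL b lo ≡ suc (αL b hi)
  αL-pred b refl mem = begin
    count> k (before b (arc k lo))
      ≡⟨ cong (count> k ∘ before b)
           (trans (cong₂ _++_ (after-here k (j ∷ xs)) (before-here k (j ∷ xs))) (++-identityʳ (j ∷ xs))) ⟩
    count> k (before b (j ∷ xs))
      ≡⟨ cong (count> k) (before-there xs (λ eq → ℕₚ.<-asym k<j (s≤s (ℕₚ.≤-reflexive eq)))) ⟩
    count> k (j ∷ before b xs)
      ≡⟨ count>-large (before b xs) k<j ⟩
    suc (count> k (before b xs))
      ≡⟨ cong (suc ∘ count> k) (sym (before-++-∈ xs [ j ] mem)) ⟩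
    suc (count> k (before b (xs ++ [ j ])))
      ≡⟨ cong (λ z → suc (count> k (before b z))) (sym (cong₂ _++_
           (trans (after-there (k ∷ xs) (k≢j ∘ sym)) (after-here k xs))
           (trans (before-there (k ∷ xs) (k≢j ∘ sym)) (cong (j ∷_) (before-here k xs))))) ⟩
    suc (count> k (before b (arc k hi))) ∎
    where open ≡-Reasoning

  -- After the swap k directly follows k+1, so nothing lies between them. The size of the drop
  -- depends on the word, which is why these transitions need not be tight.
  αL-adjacent : ∀ b → b ≡ k → suc b ≡ j → αL b hi ≡ 0
  αL-adjacent b refl refl = cong (count> j) (trans
    (cong (before k) (cong₂ _++_ (after-here j (k ∷ xs)) (before-here j (k ∷ xs))))
    (before-here k (xs ++ [])))

  private
    arc-lo : ∀ {r} → r ≢ k → r ≢ j → arc r lo ≡ after r xs ++ k ∷ j ∷ before r xs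
    arc-lo r≢k r≢j = cong₂ _++_
      (trans (after-there (j ∷ xs) (r≢k ∘ sym)) (after-there xs (r≢j ∘ sym)))
      (trans (before-there (j ∷ xs) (r≢k ∘ sym)) (cong (k ∷_) (before-there xs (r≢j ∘ sym))))
    arc-hi : ∀ {r} → r ≢ k → r ≢ j → arc r hi ≡ after r xs ++ j ∷ k ∷ before r xs
    arc-hi r≢k r≢j = cong₂ _++_
      (trans (after-there (k ∷ xs) (r≢j ∘ sym)) (after-there xs (r≢k ∘ sym)))
      (trans (before-there (k ∷ xs) (r≢j ∘ sym)) (cong (j ∷_) (before-there xs (r≢k ∘ sym))))
    ∉-after : ∀ {x r} ys → x ∉ ys → x ∉ after r ys
    ∉-after {x} {r} (y ∷ ys) nm with y ℕ.≟ r
    ... | yes _ = nm ∘ there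
    ... | no _ = ∉-after ys (nm ∘ there)

  -- The letter j moves from behind k into the stretch that leads from k+1 to k, and it is counted
  -- because it is at least k+2.
  αL-self : ∀ b → b ≡ k → suc b ≢ j → αL b hi ≡ suc (αL b lo)
  αL-self b refl sb≢j = begin
    count> (suc k) (before k (arc (suc k) hi))
      ≡⟨ cong (count> (suc k) ∘ before k) (arc-hi ℕₚ.1+n≢n sb≢j) ⟩
    count> (suc k) (before k (R ++ j ∷ k ∷ A))
      ≡⟨ cong (count> (suc k)) (before-++-∉ R _ (∉-after xs k∉)) ⟩
    count> (suc k) (R ++ before k (j ∷ k ∷ A))
      ≡⟨ cong (λ z → count> (suc k) (R ++ z)) (trans (before-there (k ∷ A) (k≢j ∘ sym)) (cong (j ∷_) (before-here k A))) ⟩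
    count> (suc k) (R ++ [ j ])
      ≡⟨ count>-++ (suc k) R [ j ] ⟩
    count> (suc k) R + count> (suc k) [ j ]
      ≡⟨ cong (count> (suc k) R +_) (count>-large [] (ℕₚ.≤∧≢⇒< k<j sb≢j)) ⟩
    count> (suc k) R + 1
      ≡⟨ ℕₚ.+-comm (count> (suc k) R) 1 ⟩
    suc (count> (suc k) R)
      ≡⟨ cong (suc ∘ count> (suc k)) (sym (++-identityʳ R)) ⟩
    suc (count> (suc k) (R ++ []))
      ≡⟨ cong (λ z → suc (count> (suc k) (R ++ z))) (sym (before-here k (j ∷ A))) ⟩
    suc (count> (suc k) (R ++ before k (k ∷ j ∷ A)))
      ≡⟨ cong (suc ∘ count> (suc k)) (sym (before-++-∉ R _ (∉-after xs k∉))) ⟩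
    suc (count> (suc k) (before k (R ++ k ∷ j ∷ A)))
      ≡⟨ cong (λ z → suc (count> (suc k) (before k z))) (sym (arc-lo ℕₚ.1+n≢n sb≢j)) ⟩
    suc (count> (suc k) (before k (arc (suc k) lo))) ∎
    where
    open ≡-Reasoning
    R = after (suc k) xs
    A = before (suc k) xs

  private
    ∈-rest : ∀ {x} {l : List ℕ} {a b : ℕ} → x ∈ a ∷ b ∷ l → x ≢ a → x ≢ b → x ∈ l
    ∈-rest (here eq) ne _ = ⊥-elim (ne eq)
    ∈-rest (there (here eq)) _ ne = ⊥-elim (ne eq)
    ∈-rest (there (there m)) _ _ = m

    count>-swap : ∀ v a b ys → count> v (a ∷ b ∷ ys) ≡ count> v (b ∷ a ∷ ys)
    count>-swap v a b ys = begin
      x + (y + z) ≡⟨ sym (ℕₚ.+-assoc x y z) ⟩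
      (x + y) + z ≡⟨ cong (_+ z) (ℕₚ.+-comm x y) ⟩
      (y + x) + z ≡⟨ ℕₚ.+-assoc y x z ⟩
      y + (x + z) ∎
      where
      open ≡-Reasoning
      x = if v <ᵇ a then 1 else 0
      y = if v <ᵇ b then 1 else 0
      z = count> v ys

  -- If j is an end of the stretch, the swap moves only k across that end, and k is too small to
  -- count. Otherwise neither letter is an end, and the swap merely reorders two neighbours inside
  -- or outside the stretch.
  αL-other : ∀ b → b ≢ k → suc b ≢ k → b ∈ lo → suc b ∈ lo → αL b hi ≡ αL b lo
  αL-other b b≢k sb≢k b∈ sb∈ with suc b ℕ.≟ j
  ... | yes refl = begin
    count> (suc b) (before b (arc (suc b) hi))
      ≡⟨ cong (count> (suc b) ∘ before b)
           (trans (cong₂ _++_ (after-here j (k ∷ xs)) (before-here j (k ∷ xs))) (++-identityʳ (k ∷ xs))) ⟩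
    count> (suc b) (before b (k ∷ xs))
      ≡⟨ cong (count> (suc b)) (before-there xs (b≢k ∘ sym)) ⟩
    count> (suc b) (k ∷ before b xs)
      ≡⟨ count>-small (before b xs) (ℕₚ.<⇒≯ k<j) ⟩
    count> (suc b) (before b xs)
      ≡⟨ cong (count> (suc b)) (sym (before-++-∈ xs [ k ] (∈-rest b∈ b≢k (ℕₚ.1+n≢n ∘ sym)))) ⟩
    count> (suc b) (before b (xs ++ [ k ]))
      ≡⟨ cong (count> (suc b) ∘ before b) (sym (cong₂ _++_
           (trans (after-there (j ∷ xs) k≢j) (after-here j xs))
           (trans (before-there (j ∷ xs) k≢j) (cong (k ∷_) (before-here j xs))))) ⟩
    count> (suc b) (before b (arc (suc b) lo)) ∎
    where open ≡-Reasoning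
  ... | no sb≢j = trans (cong (count> (suc b) ∘ before b) (arc-hi sb≢k sb≢j))
      (trans core (sym (cong (count> (suc b) ∘ before b) (arc-lo sb≢k sb≢j))))
    where
    R = after (suc b) xs
    A = before (suc b) xs
    tails : count> (suc b) (before b (j ∷ k ∷ A)) ≡ count> (suc b) (before b (k ∷ j ∷ A))
    tails with j ℕ.≟ b
    ... | yes refl = sym (trans (cong (count> (suc j)) (trans (before-there (j ∷ A) k≢j) (cong (k ∷_) (before-here j A))))
            (count>-small [] (ℕₚ.<⇒≯ (ℕₚ.m<n⇒m<1+n k<j))))
    ... | no j≢b = trans (cong (λ z → count> (suc b) (j ∷ z)) (before-there A (b≢k ∘ sym)))
            (trans (count>-swap (suc b) j k (before b A))
              (cong (count> (suc b)) (sym (trans (before-there (j ∷ A) (b≢k ∘ sym)) (cong (k ∷_) (before-there A j≢b))))))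
    core : count> (suc b) (before b (R ++ j ∷ k ∷ A)) ≡ count> (suc b) (before b (R ++ k ∷ j ∷ A))
    core with b ∈? R
    ... | yes m = cong (count> (suc b)) (trans (before-++-∈ R _ m) (sym (before-++-∈ R _ m)))
    ... | no nm = begin
      count> (suc b) (before b (R ++ j ∷ k ∷ A))
        ≡⟨ cong (count> (suc b)) (before-++-∉ R _ nm) ⟩
      count> (suc b) (R ++ before b (j ∷ k ∷ A))
        ≡⟨ count>-++ (suc b) R _ ⟩
      count> (suc b) R + count> (suc b) (before b (j ∷ k ∷ A))
        ≡⟨ cong (count> (suc b) R +_) tails ⟩
      count> (suc b) R + count> (suc b) (before b (k ∷ j ∷ A))
        ≡⟨ sym (count>-++ (suc b) R _) ⟩
      count> (suc b) (R ++ before b (k ∷ j ∷ A))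
        ≡⟨ cong (count> (suc b)) (sym (before-++-∉ R _ nm)) ⟩
      count> (suc b) (before b (R ++ k ∷ j ∷ A)) ∎
      where open ≡-Reasoning

-- Comparison of alpha with the statistic on words

nthL : List ℕ → ℕ → ℕ
nthL [] _ = 0
nthL (x ∷ xs) zero = x
nthL (x ∷ xs) (suc k) = nthL xs k

nth-toList : (v : Vec ℕ m) (k : ℕ) → nth v k ≡ nthL (toList v) k
nth-toList [] k = refl
nth-toList (x ∷ v) zero = refl
nth-toList (x ∷ v) (suc k) = nth-toList v k

posℕ-before : (v : Vec ℕ m) (r : ℕ) → posℕ v r ≡ length (before r (toList v))
posℕ-before [] r = refl
posℕ-before (x ∷ v) r with x ℕ.≟ r in eq
... | yes p = cong (λ d → if does d then 0 else suc (posℕ v r)) eq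
... | no ¬p = trans (cong (λ d → if does d then 0 else suc (posℕ v r)) eq) (cong suc (posℕ-before v r))

nthL-++ˡ : ∀ xs ys {k} → k < length xs → nthL (xs ++ ys) k ≡ nthL xs k
nthL-++ˡ (x ∷ xs) ys {zero} lt = refl
nthL-++ˡ (x ∷ xs) ys {suc k} (s≤s lt) = nthL-++ˡ xs ys lt

nthL-++ʳ : ∀ xs ys k → nthL (xs ++ ys) (length xs + k) ≡ nthL ys k
nthL-++ʳ [] ys k = refl
nthL-++ʳ (x ∷ xs) ys k = nthL-++ʳ xs ys k

nextℕ-suc : ∀ {n k} → suc k < n → nextℕ n k ≡ suc k
nextℕ-suc lt rewrite <ᵇ-true lt = refl

nextℕ-wrap : ∀ {n k} → n ≡ suc k → nextℕ n k ≡ 0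
nextℕ-wrap {n} {k} refl rewrite <ᵇ-false (ℕₚ.<-irrefl {suc k} refl) = refl

iter-+ : ∀ {n a} k → a + k < n → iter k (nextℕ n) a ≡ a + k
iter-+ {a = a} zero lt = sym (ℕₚ.+-identityʳ a)
iter-+ {n} {a} (suc k) lt = trans (cong (nextℕ n) (iter-+ k (ℕₚ.<-trans (ℕₚ.n<1+n _) lt')))
    (trans (nextℕ-suc lt') (sym (ℕₚ.+-suc a k)))
  where
  lt' : suc (a + k) < n
  lt' = subst (_< n) (ℕₚ.+-suc a k) lt

iter-wrap : ∀ {n a} d j → n ≡ a + suc d → j < n → iter (j + suc d) (nextℕ n) a ≡ j
iter-wrap {n} {a} d zero eq lt = trans (cong (nextℕ n) (iter-+ d (subst (a + d <_) (sym eq) (ℕₚ.+-monoʳ-< a (ℕₚ.n<1+n d)))))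
  (nextℕ-wrap (trans eq (ℕₚ.+-suc a d)))
iter-wrap {n} d (suc j) eq lt = trans (cong (nextℕ n) (iter-wrap d j eq (ℕₚ.<-trans (ℕₚ.n<1+n j) lt))) (nextℕ-suc lt)

nthL-rotated : ∀ {n} as r bs k → n ≡ length as + suc (length bs) → k < n →
  nthL (as ++ r ∷ bs) (iter k (nextℕ n) (length as)) ≡ nthL (r ∷ bs ++ as) k
nthL-rotated {n} as r bs k eq k<n with k ℕ.<? suc (length bs)
... | yes lt = trans (cong (nthL (as ++ r ∷ bs)) (iter-+ k (subst (length as + k <_) (sym eq) (ℕₚ.+-monoʳ-< (length as) lt))))
        (trans (nthL-++ʳ as (r ∷ bs) k) (sym (nthL-++ˡ (r ∷ bs) as lt)))
... | no ge = trans (cong (nthL (as ++ r ∷ bs)) pos)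
        (trans (nthL-++ˡ as (r ∷ bs) j<) (trans (sym (nthL-++ʳ (r ∷ bs) as j)) (cong (nthL (r ∷ bs ++ as)) k≡)))
  where
  d = suc (length bs)
  j = k ∸ d
  k≡ : d + j ≡ k
  k≡ = ℕₚ.m+[n∸m]≡n (ℕₚ.≮⇒≥ ge)
  j< : j < length as
  j< = ℕₚ.+-cancelˡ-< d j (length as) (subst₂ _<_ (sym k≡) (trans eq (ℕₚ.+-comm (length as) d)) k<n)
  pos : iter k (nextℕ n) (length as) ≡ j
  pos = trans (cong (λ z → iter z (nextℕ n) (length as)) (sym (trans (ℕₚ.+-comm j d) k≡)))
    (iter-wrap (length bs) j eq (ℕₚ.<-≤-trans j< (subst (length as ≤_) (sym eq) (ℕₚ.m≤m+n (length as) d))))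

sumℕ-applyUpTo-cong : (f g : ℕ → ℕ) (k : ℕ) → (∀ j → j < k → f j ≡ g j) →
  sumℕ (applyUpTo f k) ≡ sumℕ (applyUpTo g k)
sumℕ-applyUpTo-cong f g zero p = refl
sumℕ-applyUpTo-cong f g (suc k) p =
  cong₂ _+_ (p 0 (s≤s z≤n)) (sumℕ-applyUpTo-cong (f ∘ suc) (g ∘ suc) k (λ j lt → p (suc j) (s≤s lt)))

sumℕ-count> : ∀ v xs ys → sumℕ (applyUpTo (λ k → if v <ᵇ nthL (xs ++ ys) k then 1 else 0) (length xs)) ≡ count> v xs
sumℕ-count> v [] ys = refl
sumℕ-count> v (x ∷ xs) ys = cong ((if v <ᵇ x then 1 else 0) +_) (sumℕ-count> v xs ys)

cycDist-≤ : ∀ n r s d → s ≡ r + d → cycDist n r s ≡ d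
cycDist-≤ n r s d refl with r ≤ᵇ (r + d) in eq
... | true = ℕₚ.m+n∸m≡n r d
... | false = ⊥-elim (subst T eq (ℕₚ.≤⇒≤ᵇ (ℕₚ.m≤m+n r d)))

cycDist-> : ∀ n r s d → s < r → n + s ≡ r + d → cycDist n r s ≡ d
cycDist-> n r s d lt e with r ≤ᵇ s in eq
... | true = ⊥-elim (ℕₚ.<⇒≱ lt (ℕₚ.≤ᵇ⇒≤ r s (subst T (sym eq) _)))
... | false = trans (cong (_∸ r) e) (ℕₚ.m+n∸m≡n r d)

length-before-< : ∀ {b} xs → b ∈ xs → length (before b xs) < length xs
length-before-< {b} xs mem = subst (length (before b xs) <_)
  (trans (sym (length-++ (before b xs))) (cong length (sym (split-at xs mem))))
  (ℕₚ.m<m+n (length (before b xs)) (s≤s z≤n))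

Unique-++⇒∉ : ∀ {A : Set} {b : A} xs {ys} → Unique (xs ++ ys) → b ∈ xs → b ∉ ys
Unique-++⇒∉ (x ∷ xs) u (here refl) m = Unique[x∷xs]⇒x∉xs u (∈-++⁺ʳ xs m)
Unique-++⇒∉ (x ∷ xs) (_ ∷ u) (there mem) m = Unique-++⇒∉ xs u mem m

-- The extra one is the step onto b itself. The two branches of `cycDist` correspond to whether the
-- way from b+1 to b crosses the seam of the word.
cycDist-before : ∀ {n} b l → length l ≡ n → Unique l → suc b ∈ l → b ∈ l →
  cycDist n (length (before (suc b) l)) (length (before b l)) ≡ suc (length (before b (arc (suc b) l)))
cycDist-before {n} b l len u r∈ b∈ with b ∈? before (suc b) l
... | yes m = cycDist-> n (length A) (length (before b l)) _
      (subst (_< length A) (cong length (sym before-l)) (length-before-< A m))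
      (begin
        n + length (before b l) ≡⟨ cong₂ _+_ n≡ (cong length before-l) ⟩
        (length A + suc (length R)) + length (before b A) ≡⟨ ℕₚ.+-assoc (length A) (suc (length R)) (length (before b A)) ⟩
        length A + suc (length R + length (before b A)) ≡⟨ cong (λ z → length A + suc z) (sym (length-++ R)) ⟩
        length A + suc (length (R ++ before b A)) ≡⟨ cong (λ z → length A + suc (length z)) (sym before-arc) ⟩
        length A + suc (length (before b (R ++ A))) ∎)
  where
  open ≡-Reasoning
  A = before (suc b) l
  R = after (suc b) l
  l≡ : l ≡ A ++ suc b ∷ R
  l≡ = split-at l r∈
  n≡ : n ≡ length A + suc (length R)
  n≡ = trans (sym len) (trans (cong length l≡) (length-++ A))
  before-l : before b l ≡ before b A
  before-l = trans (cong (before b) l≡) (before-++-∈ A _ m)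
  before-arc : before b (R ++ A) ≡ R ++ before b A
  before-arc = before-++-∉ R A (λ m' → Unique-++⇒∉ A (subst Unique l≡ u) m (there m'))
... | no nm = cycDist-≤ n (length A) (length (before b l)) _ (begin
        length (before b l) ≡⟨ cong length (trans (cong (before b) l≡) (before-++-∉ A _ nm)) ⟩
        length (A ++ before b (suc b ∷ R)) ≡⟨ cong (λ z → length (A ++ z)) (before-there R ℕₚ.1+n≢n) ⟩
        length (A ++ suc b ∷ before b R) ≡⟨ length-++ A ⟩
        length A + suc (length (before b R)) ≡⟨ cong (λ z → length A + suc (length z)) (sym (before-++-∈ R A b∈R)) ⟩
        length A + suc (length (before b (R ++ A))) ∎)
  where
  open ≡-Reasoning
  A = before (suc b) l
  R = after (suc b) l
  l≡ : l ≡ A ++ suc b ∷ R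
  l≡ = split-at l r∈
  b∈R : b ∈ R
  b∈R with ∈-++⁻ A (subst (b ∈_) l≡ b∈)
  ... | inj₁ m = ⊥-elim (nm m)
  ... | inj₂ (here eq) = ⊥-elim (ℕₚ.1+n≢n (sym eq))
  ... | inj₂ (there m) = m

alpha≡αL : (w : State n) → IsPerm w → ∀ b → suc b < n → alpha w b ≡ αL b (word w)
alpha≡αL {n} w perm b lt = begin
  sumℕ (List.map f (upTo (suc (cycDist n r s))))
    ≡⟨ cong sumℕ (map-upTo f (suc (cycDist n r s))) ⟩
  sumℕ (applyUpTo f (suc (cycDist n r s)))
    ≡⟨ cong (λ d → sumℕ (applyUpTo f (suc d))) dist ⟩
  -- The letters read are b+1, those of `B`, and b; the two ends are dropped below because they are
  -- not greater than b+1.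
  sumℕ (applyUpTo f (2 + length B))
    ≡⟨ sumℕ-applyUpTo-cong f g (2 + length B) f≗g ⟩
  sumℕ (applyUpTo g (2 + length B))
    ≡⟨ cong (λ d → sumℕ (applyUpTo g (suc d))) (sym (trans (length-++ B) (ℕₚ.+-comm (length B) 1))) ⟩
  sumℕ (applyUpTo g (length (suc b ∷ B ++ [ b ])))
    ≡⟨ sumℕ-applyUpTo-cong g _ (length (suc b ∷ B ++ [ b ]))
         (λ k _ → cong (λ z → if suc b <ᵇ nthL z k then 1 else 0) front) ⟩
  sumℕ (applyUpTo (λ k → if suc b <ᵇ nthL ((suc b ∷ B ++ [ b ]) ++ C) k then 1 else 0)
    (length (suc b ∷ B ++ [ b ])))
    ≡⟨ sumℕ-count> (suc b) (suc b ∷ B ++ [ b ]) C ⟩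
  count> (suc b) (suc b ∷ B ++ [ b ])
    ≡⟨ count>-small (B ++ [ b ]) (ℕₚ.<-irrefl refl) ⟩
  count> (suc b) (B ++ [ b ])
    ≡⟨ count>-++ (suc b) B [ b ] ⟩
  count> (suc b) B + count> (suc b) [ b ]
    ≡⟨ cong (count> (suc b) B +_) (count>-small [] (ℕₚ.<⇒≯ (ℕₚ.n<1+n b))) ⟩
  count> (suc b) B + 0
    ≡⟨ ℕₚ.+-identityʳ _ ⟩
  count> (suc b) B ∎
  where
  open ≡-Reasoning
  v = Vec.map toℕ w
  l = word w
  v≡l : toList v ≡ l
  v≡l = toList-map toℕ w
  r = posℕ v (suc b)
  s = posℕ v b
  A = before (suc b) l
  R = after (suc b) l
  B = before b (R ++ A)
  C = after b (R ++ A)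
  r∈ : suc b ∈ l
  r∈ = word-∈ {w = w} perm lt
  b∈ : b ∈ l
  b∈ = word-∈ {w = w} perm (ℕₚ.<-trans (ℕₚ.n<1+n b) lt)
  b∈arc : b ∈ R ++ A
  b∈arc = ∈-arc l r∈ b∈ (ℕₚ.1+n≢n ∘ sym)
  r≡ : r ≡ length A
  r≡ = trans (posℕ-before v (suc b)) (cong (length ∘ before (suc b)) v≡l)
  s≡ : s ≡ length (before b l)
  s≡ = trans (posℕ-before v b) (cong (length ∘ before b) v≡l)
  dist : cycDist n r s ≡ suc (length B)
  dist = trans (cong₂ (cycDist n) r≡ s≡) (cycDist-before b l (length-word w) (word-unique {w = w} perm) r∈ b∈)
  f g : ℕ → ℕ
  f k = if suc b <ᵇ nth v (iter k (nextℕ n) r) then 1 else 0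
  g k = if suc b <ᵇ nthL (suc b ∷ R ++ A) k then 1 else 0
  n≡ : n ≡ length A + suc (length R)
  n≡ = trans (sym (length-word w)) (trans (cong length (split-at l r∈)) (length-++ A))
  arc≡ : R ++ A ≡ B ++ b ∷ C
  arc≡ = split-at (R ++ A) b∈arc
  front : suc b ∷ R ++ A ≡ (suc b ∷ B ++ [ b ]) ++ C
  front = cong (suc b ∷_) (trans arc≡ (sym (++-assoc B [ b ] C)))
  bound : 2 + length B ≤ n
  bound = subst (2 + length B ≤_) (sym (trans n≡ (ℕₚ.+-comm (length A) (suc (length R)))))
    (s≤s (subst (suc (length B) ≤_) (length-++ R) (length-before-< (R ++ A) b∈arc)))
  f≗g : ∀ k → k < 2 + length B → f k ≡ g k
  f≗g k lt' = cong (λ z → if suc b <ᵇ z then 1 else 0) (begin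
    nth v (iter k (nextℕ n) r) ≡⟨ nth-toList v _ ⟩
    nthL (toList v) (iter k (nextℕ n) r) ≡⟨ cong₂ (λ x y → nthL x (iter k (nextℕ n) y)) (trans v≡l (split-at l r∈)) r≡ ⟩
    nthL (A ++ suc b ∷ R) (iter k (nextℕ n) (length A)) ≡⟨ nthL-rotated A (suc b) R k n≡ (ℕₚ.<-≤-trans lt' bound) ⟩
    nthL (suc b ∷ R ++ A) k ∎)

-- The exponents η

record PermWord (n : ℕ) (l : List ℕ) : Set where
  field
    unique   : Unique l
    complete : ∀ {x} → x < n → x ∈ l
    bounded  : ∀ {x} → x ∈ l → x < n

permWord : {w : State n} → IsPerm w → PermWord n (word w)
permWord {w = w} perm = record
  { unique = word-unique {w = w} perm ; complete = word-∈ {w = w} perm ; bounded = word-< w }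

from-to : ℕ → ℕ → ℕ → Bool
from-to n i b = (i ≤ᵇ b) ∧ (3 + b ≤ᵇ n)

sumFrom : (n : ℕ) → (ℕ → ℕ) → ℕ → ℕ
sumFrom n f i = sumℕ (List.map (λ b → if from-to n i b then f b else 0) (upTo n))

ηL : ℕ → ℕ → List ℕ → ℕ
ηL n i l = sumFrom n (λ b → αL b l) i

≤ᵇ-true : ∀ {a b} → a ≤ b → (a ≤ᵇ b) ≡ true
≤ᵇ-true {a} {b} le with a ≤ᵇ b | ℕₚ.≤⇒≤ᵇ le
... | true | _ = refl

≤ᵇ-false : ∀ {a b} → ¬ a ≤ b → (a ≤ᵇ b) ≡ false
≤ᵇ-false {a} {b} ¬le with a ≤ᵇ b in eq
... | true = ⊥-elim (¬le (ℕₚ.≤ᵇ⇒≤ a b (subst T (sym eq) _)))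
... | false = refl

from-to-sound : ∀ n i b → from-to n i b ≡ true → i ≤ b × 3 + b ≤ n
from-to-sound n i b eq with i ≤ᵇ b in p | 3 + b ≤ᵇ n in q
... | true | true = ℕₚ.≤ᵇ⇒≤ i b (subst T (sym p) _) , ℕₚ.≤ᵇ⇒≤ (3 + b) n (subst T (sym q) _)

sumFrom-cong : ∀ n (f g : ℕ → ℕ) i → (∀ b → i ≤ b → 3 + b ≤ n → f b ≡ g b) → sumFrom n f i ≡ sumFrom n g i
sumFrom-cong n f g i p = cong sumℕ (map-cong term (upTo n))
  where
  term : ∀ b → (if from-to n i b then f b else 0) ≡ (if from-to n i b then g b else 0)
  term b with from-to n i b in eq
  ... | true = let le , le' = from-to-sound n i b eq in p b le le'
  ... | false = refl

eta≡ηL : (w : State n) → IsPerm w → ∀ i → lookup (eta w) i ≡ ηL n (toℕ i) (word w)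
eta≡ηL {n} w perm i = trans (lookup∘tabulate _ i)
  (sumFrom-cong n (alpha w) (λ b → αL b (word w)) (toℕ i)
    (λ b _ le → alpha≡αL w perm b (ℕₚ.≤-trans (ℕₚ.n≤1+n _) le)))

sumℕ-applyUpTo-zero : (f : ℕ → ℕ) (k : ℕ) → (∀ j → f j ≡ 0) → sumℕ (applyUpTo f k) ≡ 0
sumℕ-applyUpTo-zero f zero p = refl
sumℕ-applyUpTo-zero f (suc k) p = cong₂ _+_ (p 0) (sumℕ-applyUpTo-zero (f ∘ suc) k (p ∘ suc))

sumℕ-peel : (f g : ℕ → ℕ) (i n : ℕ) → i < n → g i ≡ 0 → (∀ j → j ≢ i → f j ≡ g j) →
  sumℕ (applyUpTo f n) ≡ f i + sumℕ (applyUpTo g n)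
sumℕ-peel f g zero (suc n) lt gi p = cong (f 0 +_) (trans
  (sumℕ-applyUpTo-cong (f ∘ suc) (g ∘ suc) n (λ j _ → p (suc j) (λ ())))
  (sym (cong (_+ sumℕ (applyUpTo (g ∘ suc) n)) gi)))
sumℕ-peel f g (suc i) (suc n) (s≤s lt) gi p = begin
  f 0 + sumℕ (applyUpTo (f ∘ suc) n)
    ≡⟨ cong₂ _+_ (p 0 (λ ())) (sumℕ-peel (f ∘ suc) (g ∘ suc) i n lt gi (λ j ne → p (suc j) (ne ∘ ℕₚ.suc-injective))) ⟩
  g 0 + (f (suc i) + rest) ≡⟨ sym (ℕₚ.+-assoc (g 0) (f (suc i)) rest) ⟩
  (g 0 + f (suc i)) + rest ≡⟨ cong (_+ rest) (ℕₚ.+-comm (g 0) (f (suc i))) ⟩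
  (f (suc i) + g 0) + rest ≡⟨ ℕₚ.+-assoc (f (suc i)) (g 0) rest ⟩
  f (suc i) + (g 0 + rest) ∎
  where
  open ≡-Reasoning
  rest = sumℕ (applyUpTo (g ∘ suc) n)

-- Turns the filtered sum into a recursion, along which the effect of a swap on η is followed from
-- index k downwards.
sumFrom-step : ∀ n (f : ℕ → ℕ) i → 3 + i ≤ n → sumFrom n f i ≡ f i + sumFrom n f (suc i)
sumFrom-step n f i le = begin
  sumℕ (List.map F (upTo n)) ≡⟨ cong sumℕ (map-upTo F n) ⟩
  sumℕ (applyUpTo F n) ≡⟨ sumℕ-peel F G i n (ℕₚ.≤-trans (ℕₚ.m≤n+m (suc i) 2) le) Gi FG ⟩
  F i + sumℕ (applyUpTo G n) ≡⟨ cong₂ _+_ Fi (cong sumℕ (sym (map-upTo G n))) ⟩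
  f i + sumℕ (List.map G (upTo n)) ∎
  where
  open ≡-Reasoning
  F G : ℕ → ℕ
  F b = if from-to n i b then f b else 0
  G b = if from-to n (suc i) b then f b else 0
  Gi : G i ≡ 0
  Gi = cong (λ z → if z ∧ (3 + i ≤ᵇ n) then f i else 0) (≤ᵇ-false {suc i} {i} ℕₚ.1+n≰n)
  Fi : F i ≡ f i
  Fi = cong₂ (λ y z → if y ∧ z then f i else 0) (≤ᵇ-true {i} {i} ℕₚ.≤-refl) (≤ᵇ-true le)
  FG : ∀ j → j ≢ i → F j ≡ G j
  FG j ne with ℕₚ.<-cmp i j
  ... | tri< lt _ _ = cong (λ z → if z ∧ (3 + j ≤ᵇ n) then f j else 0)
          (trans (≤ᵇ-true (ℕₚ.<⇒≤ lt)) (sym (≤ᵇ-true lt)))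
  ... | tri≈ _ eq _ = ⊥-elim (ne (sym eq))
  ... | tri> ¬lt _ gt = cong (λ z → if z ∧ (3 + j ≤ᵇ n) then f j else 0)
          (trans (≤ᵇ-false (ℕₚ.<⇒≱ gt)) (sym (≤ᵇ-false ¬lt)))

sumFrom-end : ∀ n (f : ℕ → ℕ) i → n < 3 + i → sumFrom n f i ≡ 0
sumFrom-end n f i lt = trans (cong sumℕ (map-upTo _ n)) (sumℕ-applyUpTo-zero _ n term)
  where
  term : ∀ b → (if from-to n i b then f b else 0) ≡ 0
  term b with from-to n i b in eq
  ... | true = let le , le' = from-to-sound n i b eq in
          ⊥-elim (ℕₚ.<⇒≱ lt (ℕₚ.≤-trans (ℕₚ.+-monoʳ-≤ 3 le) le'))
  ... | false = refl

ηL-rotate : ∀ i l → PermWord n l → ηL n i (rotateL l) ≡ ηL n i l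
ηL-rotate {n} i l perm = sumFrom-cong n _ _ i (λ b _ le →
  αL-rotate b l (PermWord.unique perm) (PermWord.complete perm (ℕₚ.≤-trans (ℕₚ.n≤1+n _) le)))

module _ {n k j : ℕ} (k<j : k < j) (xs : List ℕ) (perm : PermWord n (k ∷ j ∷ xs)) where

  private
    open PermWord perm
    lo hi : List ℕ
    lo = k ∷ j ∷ xs
    hi = j ∷ k ∷ xs
    j<n : j < n
    j<n = bounded (there (here refl))
    k∉ : k ∉ xs
    k∉ m = Unique[x∷xs]⇒x∉xs unique (there m)
    ∈-xs : ∀ {x} → x < n → x ≢ k → x ≢ j → x ∈ xs
    ∈-xs lt a b with complete lt
    ... | here eq = ⊥-elim (a eq)
    ... | there (here eq) = ⊥-elim (b eq)
    ... | there (there m) = m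
    other : ∀ b → b ≢ k → suc b ≢ k → 3 + b ≤ n → αL b hi ≡ αL b lo
    other b b≢k sb≢k le = αL-other k<j xs k∉ b b≢k sb≢k
      (complete (ℕₚ.≤-trans (ℕₚ.m≤n+m (suc b) 2) le)) (complete (ℕₚ.≤-trans (ℕₚ.n≤1+n _) le))
    pred : ∀ b → suc b ≡ k → αL b lo ≡ suc (αL b hi)
    pred b refl = αL-pred k<j xs k∉ b refl (∈-xs (ℕₚ.<-trans (ℕₚ.n<1+n b) (ℕₚ.<-trans k<j j<n)) (ℕₚ.1+n≢n ∘ sym)
      (λ { refl → ℕₚ.<-asym k<j (ℕₚ.n<1+n b) }))

  ηL-above : ∀ i → k < i → ηL n i hi ≡ ηL n i lo
  ηL-above i k<i = sumFrom-cong n _ _ i (λ b i≤b le →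
    other b (λ { refl → ℕₚ.<⇒≱ k<i i≤b }) (λ { refl → ℕₚ.<-asym k<i (s≤s i≤b) }) le)

  -- The summands of this exponent start at α_k, so the loss in α_{k-1} is not seen and the gain in
  -- α_k remains.
  ηL-at-far : suc k ≢ j → ηL n k hi ≡ suc (ηL n k lo)
  ηL-at-far ne = begin
    ηL n k hi ≡⟨ sumFrom-step n _ k le ⟩
    αL k hi + ηL n (suc k) hi ≡⟨ cong₂ _+_ (αL-self k<j xs k∉ k refl ne)
                                   (ηL-above (suc k) (ℕₚ.n<1+n k)) ⟩
    suc (αL k lo) + ηL n (suc k) lo ≡⟨ cong suc (sym (sumFrom-step n _ k le)) ⟩
    suc (ηL n k lo) ∎
    where
    open ≡-Reasoning
    le : 3 + k ≤ n
    le = ℕₚ.≤-trans (s≤s (ℕₚ.≤∧≢⇒< k<j ne)) j<n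

  ηL-at-near : suc k ≡ j → ηL n k hi ≤ ηL n k lo
  ηL-at-near eq with 3 + k ℕ.≤? n
  -- Here k and j are the two largest letters, and the sum for `hi` is empty.
  ... | no ¬le = ℕₚ.≤-trans (ℕₚ.≤-reflexive (sumFrom-end n _ k (ℕₚ.≰⇒> ¬le))) z≤n
  ... | yes le = begin
    ηL n k hi ≡⟨ sumFrom-step n _ k le ⟩
    αL k hi + ηL n (suc k) hi ≡⟨ cong₂ _+_ (αL-adjacent k<j xs k∉ k refl eq) (ηL-above (suc k) (ℕₚ.n<1+n k)) ⟩
    ηL n (suc k) lo ≤⟨ ℕₚ.m≤n+m _ (αL k lo) ⟩
    αL k lo + ηL n (suc k) lo ≡⟨ sym (sumFrom-step n _ k le) ⟩
    ηL n k lo ∎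
    where open ℕₚ.≤-Reasoning

  private
    le-below : ∀ {i} → i < k → 3 + i ≤ n
    le-below lt = ℕₚ.≤-trans (s≤s (ℕₚ.≤-trans (s≤s lt) k<j)) j<n

    -- The loss in α_{k-1} cancels the gain in α_k, and both are summands for every i below k. The
    -- induction on d starts at i = k-1.
    below-far : suc k ≢ j → ∀ d i → k ≡ d + suc i → ηL n i hi ≡ ηL n i lo
    below-far ne zero i refl = begin
      ηL n i hi ≡⟨ sumFrom-step n _ i le ⟩
      αL i hi + ηL n k hi ≡⟨ cong (αL i hi +_) (ηL-at-far ne) ⟩
      αL i hi + suc (ηL n k lo) ≡⟨ ℕₚ.+-suc (αL i hi) _ ⟩
      suc (αL i hi) + ηL n k lo ≡⟨ cong (_+ ηL n k lo) (sym (pred i refl)) ⟩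
      αL i lo + ηL n k lo ≡⟨ sym (sumFrom-step n _ i le) ⟩
      ηL n i lo ∎
      where
      open ≡-Reasoning
      le = le-below (ℕₚ.n<1+n i)
    below-far ne (suc d) i eq = begin
      ηL n i hi ≡⟨ sumFrom-step n _ i le ⟩
      αL i hi + ηL n (suc i) hi ≡⟨ cong₂ _+_ (other i (ℕₚ.<⇒≢ i<k) (ℕₚ.<⇒≢ si<k) le)
                                     (below-far ne d (suc i) (trans eq (sym (ℕₚ.+-suc d (suc i))))) ⟩
      αL i lo + ηL n (suc i) lo ≡⟨ sym (sumFrom-step n _ i le) ⟩
      ηL n i lo ∎
      where
      open ≡-Reasoning
      si<k : suc i < k
      si<k = subst (suc i <_) (sym eq) (s≤s (ℕₚ.m≤n+m (suc i) d))
      i<k = ℕₚ.<-trans (ℕₚ.n<1+n i) si<k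
      le = le-below i<k

    -- Without a gain in α_k nothing compensates the loss in α_{k-1}, and the drop is strict.
    below-near : suc k ≡ j → ∀ d i → k ≡ d + suc i → suc (ηL n i hi) ≤ ηL n i lo
    below-near eq zero i refl = begin
      suc (ηL n i hi) ≡⟨ cong suc (sumFrom-step n _ i le) ⟩
      suc (αL i hi) + ηL n k hi ≤⟨ ℕₚ.+-monoʳ-≤ (suc (αL i hi)) (ηL-at-near eq) ⟩
      suc (αL i hi) + ηL n k lo ≡⟨ cong (_+ ηL n k lo) (sym (pred i refl)) ⟩
      αL i lo + ηL n k lo ≡⟨ sym (sumFrom-step n _ i le) ⟩
      ηL n i lo ∎
      where
      open ℕₚ.≤-Reasoning
      le = le-below (ℕₚ.n<1+n i)
    below-near eq (suc d) i eq' = begin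
      suc (ηL n i hi) ≡⟨ cong suc (sumFrom-step n _ i le) ⟩
      suc (αL i hi + ηL n (suc i) hi) ≡⟨ sym (ℕₚ.+-suc (αL i hi) _) ⟩
      αL i hi + suc (ηL n (suc i) hi) ≤⟨ ℕₚ.+-mono-≤ (ℕₚ.≤-reflexive (other i (ℕₚ.<⇒≢ i<k) (ℕₚ.<⇒≢ si<k) le))
                                     (below-near eq d (suc i) (trans eq' (sym (ℕₚ.+-suc d (suc i))))) ⟩
      αL i lo + ηL n (suc i) lo ≡⟨ sym (sumFrom-step n _ i le) ⟩
      ηL n i lo ∎
      where
      open ℕₚ.≤-Reasoning
      si<k : suc i < k
      si<k = subst (suc i <_) (sym eq') (s≤s (ℕₚ.m≤n+m (suc i) d))
      i<k = ℕₚ.<-trans (ℕₚ.n<1+n i) si<k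
      le = le-below i<k

    gap : ∀ {i} → i < k → k ≡ (k ∸ suc i) + suc i
    gap lt = sym (ℕₚ.m∸n+n≡m lt)

  ηL-swap-≢ : ∀ i → k ≢ i → ηL n i hi ≤ ηL n i lo
  ηL-swap-≢ i k≢i with ℕₚ.<-cmp k i | suc k ℕ.≟ j
  ... | tri< lt _ _ | _ = ℕₚ.≤-reflexive (ηL-above i lt)
  ... | tri≈ _ eq _ | _ = ⊥-elim (k≢i eq)
  ... | tri> _ _ gt | yes eq = ℕₚ.<⇒≤ (below-near eq (k ∸ suc i) i (gap gt))
  ... | tri> _ _ gt | no ne = ℕₚ.≤-reflexive (below-far ne (k ∸ suc i) i (gap gt))

  ηL-swap-≡ : ηL n k hi ≤ suc (ηL n k lo)
  ηL-swap-≡ with suc k ℕ.≟ j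
  ... | yes eq = ℕₚ.m≤n⇒m≤1+n (ηL-at-near eq)
  ... | no ne = ℕₚ.≤-reflexive (ηL-at-far ne)

  ηL-swap-far : ∀ i → k ≢ i → suc k ≢ j → ηL n i hi ≡ ηL n i lo
  ηL-swap-far i k≢i ne with ℕₚ.<-cmp k i
  ... | tri< lt _ _ = ηL-above i lt
  ... | tri≈ _ eq _ = ⊥-elim (k≢i eq)
  ... | tri> _ _ gt = below-far ne (k ∸ suc i) i (gap gt)

-- Reachability of the decreasing word

descending⇒downFrom : ∀ n l → AllPairs _>_ l → (∀ {x} → x < n → x ∈ l) → (∀ {x} → x ∈ l → x < n) → l ≡ downFrom n
descending⇒downFrom zero [] d complete bounded = refl
descending⇒downFrom zero (a ∷ l) d complete bounded with () ← bounded (here refl)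
descending⇒downFrom (suc n) [] d complete bounded with () ← complete (ℕₚ.n<1+n n)
descending⇒downFrom (suc n) (a ∷ l) (a> ∷ d) complete bounded = cong₂ List._∷_ a≡n
  (descending⇒downFrom n l d complete' (λ m → subst (_ <_) a≡n (All.lookup a> m)))
  where
  a≡n : a ≡ n
  a≡n with complete (ℕₚ.n<1+n n)
  ... | here eq = sym eq
  ... | there m = ⊥-elim (ℕₚ.<⇒≱ (All.lookup a> m) (ℕ.s≤s⁻¹ (bounded (here refl))))
  complete' : ∀ {x} → x < n → x ∈ l
  complete' lt with complete (ℕₚ.m<n⇒m<1+n lt)
  ... | here eq = ⊥-elim (ℕₚ.<-irrefl (trans eq a≡n) lt)
  ... | there m = m

-- The closure condition is a parameter because the two uses run in opposite directions: forward
-- along swaps whose smaller letter is not i, and backward along tight ones. Closure under rotation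
-- lets `swap` concern the first two letters only.
module Reach (n : ℕ) (Q : List ℕ → Set) (allowed : ℕ → ℕ → Set)
  (perm : ∀ {l} → Q l → PermWord n l)
  (turn : ∀ x xs → Q (x ∷ xs) → Q (xs ++ [ x ]))
  (swap : ∀ a b xs → allowed a b → Q (a ∷ b ∷ xs) → Q (b ∷ a ∷ xs)) where

  turnⁿ : ∀ as bs → Q (as ++ bs) → Q (bs ++ as)
  turnⁿ [] bs q = subst Q (sym (++-identityʳ bs)) q
  turnⁿ (a ∷ as) bs q = subst Q (++-assoc bs [ a ] as)
    (turnⁿ as (bs ++ [ a ]) (subst Q (++-assoc as bs [ a ]) (turn a (as ++ bs) q)))

  swap-inside : ∀ ps a b zs → allowed a b → Q (ps ++ a ∷ b ∷ zs) → Q (ps ++ b ∷ a ∷ zs)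
  swap-inside ps a b zs al q = turnⁿ (b ∷ a ∷ zs) ps (swap a b (zs ++ ps) al (turnⁿ ps (a ∷ b ∷ zs) q))

  pass : ∀ ps y bs zs → All (allowed y) bs → Q (ps ++ y ∷ bs ++ zs) → Q (ps ++ bs ++ y ∷ zs)
  pass ps y [] zs al q = q
  pass ps y (b ∷ bs) zs (a ∷ al) q = subst Q (++-assoc ps [ b ] (bs ++ y ∷ zs))
    (pass (ps ++ [ b ]) y bs zs al
      (subst Q (sym (++-assoc ps [ b ] (y ∷ bs ++ zs))) (swap-inside ps y b (bs ++ zs) a q)))

  exchange : ∀ ps ys bs zs → All (λ y → All (allowed y) bs) ys → Q (ps ++ ys ++ bs ++ zs) → Q (ps ++ bs ++ ys ++ zs)
  exchange ps [] bs zs al q = q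
  exchange ps (y ∷ ys) bs zs (a ∷ al) q = pass ps y bs (ys ++ zs) a
    (subst Q (++-assoc ps [ y ] (bs ++ ys ++ zs))
      (exchange (ps ++ [ y ]) ys bs zs al (subst Q (sym (++-assoc ps [ y ] (ys ++ bs ++ zs))) q)))

  -- Insertion sort in which the letter i comes last, so that it is never the smaller letter of a swap.
  module _ (i : ℕ) (i<n : i < n) (allow : ∀ {a b} → a < b → a ≢ i → allowed a b) where

    insert : ∀ ps ss t zs → AllPairs _>_ ss → i ∉ ss → t ∉ ss → Q (ps ++ ss ++ t ∷ zs) →
      ∃ λ ss' → AllPairs _>_ ss' × (∀ {x} → x ∈ ss' → x ≡ t ⊎ x ∈ ss) × Q (ps ++ ss' ++ zs)
    insert ps [] t zs d i∉ t∉ q = [ t ] , ([] ∷ []) , (λ { (here eq) → inj₁ eq }) , q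
    insert ps (s ∷ ss) t zs (s> ∷ d) i∉ t∉ q with t ℕ.<? s
    ... | yes t<s =
      let ss' , d' , sub , q' = insert (ps ++ [ s ]) ss t zs d (i∉ ∘ there) (t∉ ∘ there)
            (subst Q (sym (++-assoc ps [ s ] (ss ++ t ∷ zs))) q)
      in s ∷ ss'
       , (All.tabulate (λ m → smaller (sub m)) ∷ d')
       , (λ { (here eq) → inj₂ (here eq) ; (there m) → weaken (sub m) })
       , subst Q (++-assoc ps [ s ] (ss' ++ zs)) q'
      where
      smaller : ∀ {x} → x ≡ t ⊎ x ∈ ss → x < s
      smaller (inj₁ refl) = t<s
      smaller (inj₂ m) = All.lookup s> m
      weaken : ∀ {x} → x ≡ t ⊎ x ∈ ss → x ≡ t ⊎ x ∈ s ∷ ss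
      weaken (inj₁ eq) = inj₁ eq
      weaken (inj₂ m) = inj₂ (there m)
    ... | no t≮s = t ∷ s ∷ ss
       , (All.tabulate smaller ∷ (s> ∷ d))
       , (λ { (here eq) → inj₁ eq ; (there m) → inj₂ m })
       , exchange ps (s ∷ ss) [ t ] zs
           (All.tabulate (λ m → allow (smaller m) (λ { refl → i∉ m }) ∷ [])) q
      where
      s<t : s < t
      s<t = ℕₚ.≤∧≢⇒< (ℕₚ.≮⇒≥ t≮s) (λ eq → t∉ (here (sym eq)))
      smaller : ∀ {x} → x ∈ s ∷ ss → x < t
      smaller (here refl) = s<t
      smaller (there m) = ℕₚ.<-trans (All.lookup s> m) s<t

    ∉-prefix : ∀ ss t zs → Q (ss ++ t ∷ zs) → t ∉ ss
    ∉-prefix ss t zs q m = Unique-++⇒∉ ss (PermWord.unique (perm q)) m (here refl)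

    sort : ∀ ts ss → AllPairs _>_ ss → i ∉ ss → Q (ss ++ ts ++ [ i ]) → Q (downFrom n)
    -- The letter inserted last is i itself, so one hypothesis serves for both absence conditions of
    -- `insert`; in this step i moves only to the left.
    sort [] ss d i∉ q with ss' , d' , _ , q' ← insert [] ss i [] d i∉ i∉ q =
      subst Q (trans (++-identityʳ ss') (descending⇒downFrom n ss' d' (PermWord.complete p) (PermWord.bounded p))) q'
      where p = perm (subst Q (++-identityʳ ss') q')
    sort (t ∷ ts) ss d i∉ q with ss' , d' , sub , q' ← insert [] ss t (ts ++ [ i ]) d i∉ (∉-prefix ss t _ q) q =
      sort ts ss' d' i∉ss' q'
      where
      i∉ss' : i ∉ ss'
      i∉ss' = ∉-prefix (ss' ++ ts) i [] (subst Q (sym (++-assoc ss' ts [ i ])) q') ∘ ∈-++⁺ˡ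

    reach-by-sorting : ∀ {l} → Q l → Q (downFrom n)
    reach-by-sorting q with as , bs , refl ← ∈-∃++ (PermWord.complete (perm q) i<n) =
      sort (bs ++ as) [] [] (λ ()) (turn i (bs ++ as) (turnⁿ as (i ∷ bs) q))

  -- The block k, k-1, …, 0 moves backwards past larger letters until it meets the letter k+1.
  module _ (0<n : 0 < n) (allow : ∀ {a b} → suc b < a → allowed a b) where

    grow : ∀ d k rest → suc k + d ≡ n → Q (downFrom (suc k) ++ rest) → Q (downFrom n)
    grow zero k [] eq q = subst Q (trans (++-identityʳ (downFrom (suc k)))
      (cong downFrom (trans (sym (ℕₚ.+-identityʳ (suc k))) eq))) q
    grow zero k (x ∷ rest) eq q = ⊥-elim (Unique-++⇒∉ (downFrom (suc k)) (PermWord.unique (perm q))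
      (∈-downFrom⁺ (subst (x <_) (trans (sym eq) (ℕₚ.+-identityʳ (suc k)))
        (PermWord.bounded (perm q) (∈-++⁺ʳ (downFrom (suc k)) (here refl))))) (here refl))
    grow (suc d) k rest eq q with ∈-++⁻ (downFrom (suc k)) (PermWord.complete (perm q)
        (subst (suc k <_) eq (ℕₚ.m<m+n (suc k) (s≤s z≤n))))
    ... | inj₁ m = ⊥-elim (ℕₚ.<-irrefl refl (∈-downFrom⁻ m))
    -- Read cyclically, `ys` is what separates k+1 from the block that follows it. Exchanging `ys`
    -- with the block puts the block directly behind k+1.
    ... | inj₂ m with zs , ys , refl ← ∈-∃++ m =
      grow d (suc k) (ys ++ zs) (trans (sym (ℕₚ.+-suc (suc k) d)) eq)
        (turnⁿ (B ++ ys ++ zs) [ suc k ] (subst Q assoc₂ (exchange [] ys B (zs ++ [ suc k ]) al q₁)))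
      where
      B = downFrom (suc k)
      open PermWord (perm q)
      assoc₁ : B ++ zs ++ suc k ∷ ys ≡ (B ++ zs ++ [ suc k ]) ++ ys
      assoc₁ = trans (cong (B ++_) (sym (++-assoc zs [ suc k ] ys))) (sym (++-assoc B (zs ++ [ suc k ]) ys))
      assoc₂ : B ++ ys ++ zs ++ [ suc k ] ≡ (B ++ ys ++ zs) ++ [ suc k ]
      assoc₂ = trans (cong (B ++_) (sym (++-assoc ys zs [ suc k ]))) (sym (++-assoc B (ys ++ zs) [ suc k ]))
      q₁ : Q (ys ++ B ++ zs ++ [ suc k ])
      q₁ = turnⁿ (B ++ zs ++ [ suc k ]) ys (subst Q assoc₁ q)
      large : ∀ {y} → y ∈ ys → suc k < y
      large {y} m = ℕₚ.≤∧≢⇒< (ℕₚ.≮⇒≥ (λ lt → Unique-++⇒∉ B unique (∈-downFrom⁺ lt) (∈-++⁺ʳ zs (there m))))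
        (λ { refl → Unique-++⇒∉ (B ++ zs ++ [ suc k ]) (subst Unique assoc₁ unique)
               (∈-++⁺ʳ B (∈-++⁺ʳ zs (here refl))) m })
      -- Letters of the block are at most k and those of `ys` at least k+2, so k+1 always lies
      -- between the two letters of a swap.
      al : All (λ y → All (allowed y) B) ys
      al = All.tabulate (λ ym → All.tabulate (λ bm → allow (ℕₚ.≤-<-trans (∈-downFrom⁻ bm) (large ym))))

    reach-by-blocks : ∀ {l} → Q l → Q (downFrom n)
    reach-by-blocks q with as , bs , refl ← ∈-∃++ (PermWord.complete (perm q) 0<n) =
      grow (ℕ.pred n) 0 (bs ++ as) (ℕₚ.suc-pred n {{ℕ.>-nonZero 0<n}}) (turnⁿ as (0 ∷ bs) q)

-- Leading coefficients

η : Fin n → State n → ℕ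
η {n} i w = ηL n (toℕ i) (word w)

η-rotate : (i : Fin n) (w : State n) → IsPerm w → η i (rotate w) ≡ η i w
η-rotate {n} i w perm = trans (cong (ηL n (toℕ i)) (word-rotate w)) (ηL-rotate (toℕ i) (word w) (permWord {w = w} perm))

η-rotateⁿ : (i : Fin n) (k : ℕ) (w : State n) → IsPerm w → η i (rotateⁿ k w) ≡ η i w
η-rotateⁿ i zero w perm = refl
η-rotateⁿ i (suc k) w perm = trans (η-rotate i (rotateⁿ k w) (IsPerm-rotateⁿ k {w} perm)) (η-rotateⁿ i k w perm)

swap-words : (w : State (suc (suc m))) (p : Fin (suc (suc m))) → ∃ λ xs →
  word (rotateⁿ (toℕ p) w) ≡ toℕ (lookup w p) ∷ toℕ (lookup w (next p)) ∷ xs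
  × word (rotateⁿ (toℕ p) (swapAt w p)) ≡ toℕ (lookup w (next p)) ∷ toℕ (lookup w p) ∷ xs
swap-words w p = subst (λ q → ∃ λ xs →
    word (rotateⁿ (toℕ p) w) ≡ toℕ (lookup w q) ∷ toℕ (lookup w (next q)) ∷ xs
    × word (rotateⁿ (toℕ p) (swapAt w q)) ≡ toℕ (lookup w (next q)) ∷ toℕ (lookup w q) ∷ xs)
  (nextⁿ-toℕ p) (at (rotateⁿ (toℕ p) w) refl)
  where
  k = toℕ p
  q = nextⁿ k Fin.zero
  at : ∀ u → rotateⁿ k w ≡ u → ∃ λ xs →
    word (rotateⁿ k w) ≡ toℕ (lookup w q) ∷ toℕ (lookup w (next q)) ∷ xs
    × word (rotateⁿ k (swapAt w q)) ≡ toℕ (lookup w (next q)) ∷ toℕ (lookup w q) ∷ xs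
  at (x ∷ y ∷ v) eq = List.map toℕ (toList v)
    , trans (cong word eq) (sym (cong₂ (λ a b → a ∷ b ∷ _) (AtHead.lookup-a h) (AtHead.lookup-b h)))
    , trans (cong word (trans (AtHead.swapped h) (cong swapHead eq)))
        (sym (cong₂ (λ a b → b ∷ a ∷ _) (AtHead.lookup-a h) (AtHead.lookup-b h)))
    where h = at-head k w (cong word eq)

-- The state w is the one after the transition and w' the one before it, as in the incoming terms of
-- the balance equation.
record SwapEffect (i : Fin n) (w : State n) (p : Fin n) : Set where
  private
    k = lookup w (next p)
    w' = swapAt w p
  field
    η-free     : k ≢ i → η i w ≤ η i w'
    η-jump     : k ≡ i → η i w ≤ suc (η i w')
    η-free-far : k ≢ i → suc (toℕ k) < toℕ (lookup w p) → η i w ≡ η i w'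
    η-jump-far : k ≡ i → suc (toℕ k) < toℕ (lookup w p) → η i w ≡ suc (η i w')

swap-effect : (i : Fin (suc (suc m))) (w : State (suc (suc m))) (p : Fin (suc (suc m))) →
  IsPerm w → Desc w p → SwapEffect i w p
swap-effect {m} i w p perm desc with xs , eq , eq' ← swap-words w p = record
  { η-free     = λ ne → subst₂ _≤_ hi≡ lo≡ (ηL-swap-≢ desc xs pw (toℕ i) (ne ∘ Finₚ.toℕ-injective))
  ; η-jump     = λ { refl → subst₂ (λ a b → a ≤ suc b) hi≡ lo≡ (ηL-swap-≡ desc xs pw) }
  ; η-free-far = λ ne far → trans (sym hi≡) (trans (ηL-swap-far desc xs pw (toℕ i) (ne ∘ Finₚ.toℕ-injective) (ℕₚ.<⇒≢ far)) lo≡)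
  ; η-jump-far = λ { refl far → trans (sym hi≡) (trans (ηL-at-far desc xs pw (ℕₚ.<⇒≢ far)) (cong suc lo≡)) }
  }
  where
  w' = swapAt w p
  perm' : IsPerm w'
  perm' = IsPerm-swapAt {w = w} p perm
  pw : PermWord (suc (suc m)) (toℕ (lookup w (next p)) ∷ toℕ (lookup w p) ∷ xs)
  pw = subst (PermWord (suc (suc m))) eq' (permWord {w = rotateⁿ (toℕ p) w'} (IsPerm-rotateⁿ (toℕ p) {w'} perm'))
  hi≡ : ηL (suc (suc m)) (toℕ i) (toℕ (lookup w p) ∷ toℕ (lookup w (next p)) ∷ xs) ≡ η i w
  hi≡ = trans (cong (ηL (suc (suc m)) (toℕ i)) (sym eq)) (η-rotateⁿ i (toℕ p) w perm)
  lo≡ : ηL (suc (suc m)) (toℕ i) (toℕ (lookup w (next p)) ∷ toℕ (lookup w p) ∷ xs) ≡ η i w'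
  lo≡ = trans (cong (ηL (suc (suc m)) (toℕ i)) (sym eq')) (η-rotateⁿ i (toℕ p) w' perm')

co-neg : (i : Fin V) (s : ℕ) (f : Poly V) → co i s (-P f) ≈ (-P co i s f)
co-neg i s f e with lookup e i
... | zero = refl
... | suc _ = refl

co-when : (i : Fin V) (s : ℕ) {P : Set} (P? : Dec P) (f : Poly V) → co i s (when P? f) ≈ when P? (co i s f)
co-when i s (yes _) f = ≈-refl
co-when i s (no _) f = co-zero i s ≈-refl

word-swapAt-zero : (w : State (suc (suc m))) {a b : ℕ} {l : List ℕ} → word w ≡ a ∷ b ∷ l →
  word (swapAt w Fin.zero) ≡ b ∷ a ∷ l
word-swapAt-zero w eq = trans (cong word (swapAt-zero w)) (word-headSwap w eq)

Vanishing : Fin n → (State n → Poly n) → Set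
Vanishing i φ = ∀ w → IsPerm w → ∀ s → s < η i w → co i s (φ w) ≈ 0P

-- The normalisation is kept out, so that solutions are closed under negation and under
-- multiplication by xᵢ; both operations are applied later.
record Solution (φ : State n → Poly n) : Set where
  field
    poly       : ∀ w → IsPerm w → IsPoly (φ w)
    stationary : ∀ w → IsPerm w → Stationary φ w
    invariant  : ∀ w → IsPerm w → φ (rotate w) ≈ φ w

module Leading (i : Fin (suc (suc m))) (φ : State (suc (suc m)) → Poly (suc (suc m)))
  (sol : Solution φ) (vanishing : Vanishing i φ) where

  open Solution sol

  c : State (suc (suc m)) → Poly (suc (suc m))
  c w = co i (η i w) (φ w)

  c-poly : ∀ w → IsPerm w → IsPoly (c w)
  c-poly w perm = IsPoly-co i (η i w) (poly w perm)

  c-rotate : ∀ w → IsPerm w → c (rotate w) ≈ c w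
  c-rotate w perm e = trans (cong (λ s → co i s (φ (rotate w)) e) (η-rotate i w perm))
    (co-cong i (η i w) (invariant w perm) e)

  incoming : State (suc (suc m)) → Fin (suc (suc m)) → Poly (suc (suc m))
  incoming w p = when (desc? w p) (co i (η i w) (X (lookup w (next p)) (φ (swapAt w p))))

  free? : (k : Fin (suc (suc m))) → Dec (k ≢ i)
  free? k = ¬? (k Fin.≟ i)

  -- In an outgoing term with rate xᵢ the relevant coefficient of φ w is the one just below its
  -- level, which is zero. Only free rates remain on the left; the right-hand side is kept
  -- unevaluated and analysed by `classify`.
  leading-balance : ∀ w → IsPerm w →
    ∑ (List.allFin _) (λ p → when (asc? w p ×-dec free? (lookup w p)) (X (lookup w p) (c w))) ≈ ∑ (List.allFin _) (incoming w)
  leading-balance w perm = ≈-trans (∑-cong (List.allFin _) (λ p → ≈-sym (outgoing p))) (≈-trans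
    (≈-sym (co-∑ i (η i w) (List.allFin _) (λ p → when (asc? w p) (X (lookup w p) (φ w)))))
    (≈-trans (co-cong i (η i w) (stationary w perm))
      (≈-trans (co-∑ i (η i w) (List.allFin _) (λ p → when (desc? w p) (X (lookup w (next p)) (φ (swapAt w p)))))
        (∑-cong (List.allFin _) (λ p → co-when i (η i w) (desc? w p) (X (lookup w (next p)) (φ (swapAt w p))))))))
    where
    jump-vanishes : ∀ s → s ≡ η i w → co i s (X i (φ w)) ≈ 0P
    jump-vanishes zero _ = co-X-zero i (φ w)
    jump-vanishes (suc s) eq = ≈-trans (co-X-suc i s (φ w)) (vanishing w perm s (ℕₚ.≤-reflexive eq))
    term : ∀ k {P : Set} (P? : Dec P) (f? : Dec (k ≢ i)) →
      co i (η i w) (when P? (X k (φ w))) ≈ when (P? ×-dec f?) (X k (c w))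
    term k (no _) f? = co-zero i (η i w) ≈-refl
    term k (yes _) (yes k≢i) = co-X-≢ i k (η i w) k≢i (φ w)
    term k (yes _) (no ¬k≢i) with k Fin.≟ i
    ... | yes refl = jump-vanishes (η i w) refl
    ... | no k≢i = ⊥-elim (¬k≢i k≢i)
    outgoing : ∀ p → co i (η i w) (when (asc? w p) (X (lookup w p) (φ w)))
      ≈ when (asc? w p ×-dec free? (lookup w p)) (X (lookup w p) (c w))
    outgoing p = term (lookup w p) (asc? w p) (free? (lookup w p))

  data Incoming (w : State (suc (suc m))) (p : Fin (suc (suc m))) : Set where
    absent : incoming w p ≈ 0P → Incoming w p
    free   : Desc w p → lookup w (next p) ≢ i → η i (swapAt w p) ≡ η i w →
      incoming w p ≈ X (lookup w (next p)) (c (swapAt w p)) → Incoming w p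
    jump   : lookup w (next p) ≡ i → η i w ≡ suc (η i (swapAt w p)) →
      incoming w p ≈ c (swapAt w p) → Incoming w p

  incoming-free : ∀ w p → Desc w p → lookup w (next p) ≢ i → η i (swapAt w p) ≡ η i w →
    incoming w p ≈ X (lookup w (next p)) (c (swapAt w p))
  incoming-free w p desc k≢i eq = ≈-trans (when-yes (desc? w p) desc) (≈-trans
    (co-X-≢ i (lookup w (next p)) (η i w) k≢i (φ (swapAt w p)))
    (λ e → cong (λ s → X (lookup w (next p)) (co i s (φ (swapAt w p))) e) (sym eq)))

  incoming-jump : ∀ w p → Desc w p → lookup w (next p) ≡ i → η i w ≡ suc (η i (swapAt w p)) →
    incoming w p ≈ c (swapAt w p)
  incoming-jump w p desc k≡i eq = ≈-trans (when-yes (desc? w p) desc) (≈-trans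
    (λ e → cong₂ (λ s k → co i s (X k (φ (swapAt w p))) e) eq k≡i)
    (co-X-suc i (η i (swapAt w p)) (φ (swapAt w p))))

  -- Where the bound on the change of η is strict, the power of xᵢ asked of the source lies below
  -- the level of that source, and the term vanishes.
  classify : ∀ w p → IsPerm w → Incoming w p
  classify w p perm = go (desc? w p) (lookup w (next p) Fin.≟ i)
    where
    k = lookup w (next p)
    w' = swapAt w p
    perm' : IsPerm w'
    perm' = IsPerm-swapAt {w = w} p perm
    go : Dec (Desc w p) → Dec (k ≡ i) → Incoming w p
    go (no ¬desc) _ = absent (when-no (desc? w p) ¬desc)
    go (yes desc) (no k≢i) with ℕₚ.m≤n⇒m<n∨m≡n (SwapEffect.η-free (swap-effect i w p perm desc) k≢i)
    ... | inj₁ lt = absent (≈-trans (when-yes (desc? w p) desc) (≈-trans (co-X-≢ i k (η i w) k≢i (φ w'))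
            (X-zero k (vanishing w' perm' (η i w) lt))))
    ... | inj₂ eq = free desc k≢i (sym eq) (incoming-free w p desc k≢i (sym eq))
    go (yes desc) (yes k≡i) with ℕₚ.m≤n⇒m<n∨m≡n (SwapEffect.η-jump (swap-effect i w p perm desc) k≡i)
    ... | inj₂ eq = jump k≡i eq (incoming-jump w p desc k≡i eq)
    ... | inj₁ lt = absent (≈-trans (when-yes (desc? w p) desc)
            (≈-trans (λ e → cong (λ k → co i (η i w) (X k (φ w')) e) k≡i) (low (η i w) lt)))
      where
      low : ∀ s → s < suc (η i w') → co i s (X i (φ w')) ≈ 0P
      low zero _ = co-X-zero i (φ w')
      low (suc s) lt = ≈-trans (co-X-suc i s (φ w')) (vanishing w' perm' s (ℕ.s≤s⁻¹ lt))

  tight : ∀ w p → IsPerm w → suc (toℕ (lookup w (next p))) < toℕ (lookup w p) →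
    incoming w p ≈ 0P → c (swapAt w p) ≈ 0P
  tight w p perm far z = go (lookup w (next p) Fin.≟ i)
    where
    desc : Desc w p
    desc = ℕₚ.<-trans (ℕₚ.n<1+n _) far
    effect = swap-effect i w p perm desc
    go : Dec (lookup w (next p) ≡ i) → c (swapAt w p) ≈ 0P
    go (yes k≡i) = ≈-trans (≈-sym (incoming-jump w p desc k≡i (SwapEffect.η-jump-far effect k≡i far))) z
    go (no k≢i) = X-cancel (lookup w (next p))
      (≈-trans (≈-sym (incoming-free w p desc k≢i (sym (SwapEffect.η-free-far effect k≢i far)))) z)

  module _ (w₀ : State (suc (suc m))) (word-w₀ : word w₀ ≡ downFrom (suc (suc m))) where

    at-w₀ : (N : State (suc (suc m)) → Set) → (∃ λ w → word w ≡ downFrom (suc (suc m)) × N w) → N w₀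
    at-w₀ N (w , eq , Nw) = subst N (word-injective (trans eq (sym word-w₀))) Nw

    -- By induction on the level η, the states of one level with negative leading coefficient are
    -- closed under free swaps, hence would contain w₀.
    NonNeg-spreads : NonNeg (c w₀) → ∀ w → IsPerm w → NonNeg (c w)
    NonNeg-spreads c₀≥0 w perm = level (η i w) w perm refl
      where
      level : ∀ ℓ w → IsPerm w → η i w ≡ ℓ → NonNeg (c w)
      level = <-rec _ λ ℓ rec w perm eq → ¬Negative⇒NonNeg (c-poly w perm)
          (impossible ℓ (λ w' perm' lt → rec lt w' perm' refl) w perm eq)
        where
        impossible : ∀ ℓ → (∀ w → IsPerm w → η i w < ℓ → NonNeg (c w)) →
          ∀ w → IsPerm w → η i w ≡ ℓ → ¬ Negative (c w)
        impossible ℓ lower w perm eq neg =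
          let _ , _ , ne , nn = at-w₀ N (reach-by-sorting (toℕ i) (Finₚ.toℕ<n i) _,_ (w , refl , perm , eq , neg))
          in ne (NonNeg-antisym c₀≥0 nn)
          where
          N : State (suc (suc m)) → Set
          N w = IsPerm w × η i w ≡ ℓ × Negative (c w)
          N? : ∀ w → Dec (N w)
          N? w with permNegative? c c-poly w | η i w ℕ.≟ ℓ
          ... | yes (perm , neg) | yes eq = yes (perm , eq , neg)
          ... | no ¬pn | _ = no (λ (perm , _ , neg) → ¬pn (perm , neg))
          ... | _ | no ne = no (λ (_ , eq , _) → ne eq)
          Q : List ℕ → Set
          Q l = ∃ λ w → word w ≡ l × N w
          incoming-ok : ∀ w → N w → ∀ p → NonNeg (incoming w p +P
            when ((desc? w p ×-dec free? (lookup w (next p))) ×-dec N? (swapAt w p))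
              (X (lookup w (next p)) (-P c (swapAt w p))))
          incoming-ok w (perm , eq , _) p = go (classify w p perm) (N? w')
            where
            k = lookup w (next p)
            w' = swapAt w p
            perm' : IsPerm w'
            perm' = IsPerm-swapAt {w = w} p perm
            inside? : Dec ((Desc w p × k ≢ i) × N w')
            inside? = (desc? w p ×-dec free? k) ×-dec N? w'
            cancelling : Poly (suc (suc m))
            cancelling = when inside? (X k (-P c w'))
            cancelling≥0 : NonNeg cancelling
            cancelling≥0 = NonNeg-when inside? (λ (_ , _ , _ , _ , nn) → NonNeg-X k nn)
            go : Incoming w p → Dec (N w') → NonNeg (incoming w p +P cancelling)
            go (absent z) _ = NonNeg-+ (NonNeg-zero z) cancelling≥0
            -- A jump arrives from the next lower level, where the sign is known by induction.
            go (jump k≡i eq' z) _ = NonNeg-+ (NonNeg-resp (≈-sym z)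
              (lower w' perm' (subst (η i w' <_) eq (ℕₚ.≤-reflexive (sym eq'))))) cancelling≥0
            -- A free term comes from the same level, so a source outside N has a nonnegative
            -- coefficient.
            go (free d k≢i eq' z) (no ¬N) = NonNeg-+ (NonNeg-resp (≈-sym z) (NonNeg-X k
              (¬Negative⇒NonNeg (c-poly w' perm') (λ neg → ¬N (perm' , trans eq' eq , neg))))) cancelling≥0
            go (free d k≢i eq' z) (yes Nw') = NonNeg-zero (λ e → trans
              (cong₂ ℤ._+_ (z e) (≈-trans (when-yes inside? ((d , k≢i) , Nw')) (X-neg k (c w')) e))
              (ℤₚ.+-inverseʳ (X k (c w') e)))
          -- A free swap that lowers the level would also be a leak out of N, so the level is
          -- preserved along with the sign.
          closed : ∀ w p → N w → Asc w p → lookup w p ≢ i → N (swapAt w p)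
          closed w p Nw asc k≢i with N? (swapAt w p)
          ... | yes N' = N'
          ... | no ¬N = ⊥-elim (proj₁ (proj₂ (proj₂ Nw)) (no-leak c N N? (_≢ i) free? incoming
                  (λ w Nw → proj₂ (proj₂ (proj₂ Nw))) (λ w Nw → leading-balance w (proj₁ Nw)) incoming-ok w p Nw asc k≢i ¬N))
          turn : ∀ x xs → Q (x ∷ xs) → Q (xs ++ [ x ])
          turn x xs (w , eq , perm , lev , ne , nn) = rotate w , trans (word-rotate w) (cong rotateL eq)
            , IsPerm-rotate {w = w} perm , trans (η-rotate i w perm) lev
            , (λ z → ne (≈-trans (≈-sym (c-rotate w perm)) z))
            , NonNeg-resp (-P-cong (≈-sym (c-rotate w perm))) nn
          swap : ∀ a b xs → a < b × a ≢ toℕ i → Q (a ∷ b ∷ xs) → Q (b ∷ a ∷ xs)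
          swap a b xs (a<b , a≢i) (w , eq , Nw) = swapAt w Fin.zero , word-swapAt-zero w eq
            , closed w Fin.zero Nw (subst₂ _<_ (sym (word-lookup₀ w eq)) (sym (word-lookup₁ w eq)) a<b)
                (λ k≡i → a≢i (trans (sym (word-lookup₀ w eq)) (cong toℕ k≡i)))
          open Reach (suc (suc m)) Q (λ a b → a < b × a ≢ toℕ i)
            (λ (w , eq , Nw) → subst (PermWord (suc (suc m))) eq (permWord {w = w} (proj₁ Nw))) turn swap

    -- Without negative coefficients the incoming terms cannot cancel, so a zero at w makes each of
    -- them vanish. For a tight transition the term is the coefficient of its source, up to a
    -- variable that can be cancelled.
    zero-spreads : (∀ w → IsPerm w → NonNeg (c w)) → ∀ w → IsPerm w → c w ≈ 0P → c w₀ ≈ 0P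
    zero-spreads c≥0 w perm z = proj₂ (at-w₀ N (reach-by-blocks (s≤s z≤n) (λ far → far) (w , refl , perm , z)))
      where
      N : State (suc (suc m)) → Set
      N w = IsPerm w × c w ≈ 0P
      Q : List ℕ → Set
      Q l = ∃ λ w → word w ≡ l × N w
      incoming≥0 : ∀ w → IsPerm w → ∀ p → NonNeg (incoming w p)
      incoming≥0 w perm p = go (classify w p perm)
        where
        perm' : IsPerm (swapAt w p)
        perm' = IsPerm-swapAt {w = w} p perm
        go : Incoming w p → NonNeg (incoming w p)
        go (absent z) = NonNeg-zero z
        go (free _ _ _ z) = NonNeg-resp (≈-sym z) (NonNeg-X (lookup w (next p)) (c≥0 (swapAt w p) perm'))
        go (jump _ _ z) = NonNeg-resp (≈-sym z) (c≥0 (swapAt w p) perm')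
      incoming-zero : ∀ w → N w → ∀ p → incoming w p ≈ 0P
      incoming-zero w (perm , z) p = NonNeg-∑-zero (List.allFin _) (incoming≥0 w perm)
        (≈-trans (≈-sym (leading-balance w perm)) (∑-zero (List.allFin _) (λ p →
          when-zero (asc? w p ×-dec free? (lookup w p)) (X-zero (lookup w p) z))))
        (∈-allFin p)
      turn : ∀ x xs → Q (x ∷ xs) → Q (xs ++ [ x ])
      turn x xs (w , eq , perm , z) = rotate w , trans (word-rotate w) (cong rotateL eq)
        , IsPerm-rotate {w = w} perm , ≈-trans (c-rotate w perm) z
      swap : ∀ a b xs → suc b < a → Q (a ∷ b ∷ xs) → Q (b ∷ a ∷ xs)
      swap a b xs far (w , eq , Nw) = swapAt w Fin.zero , word-swapAt-zero w eq
        , IsPerm-swapAt {w = w} Fin.zero (proj₁ Nw)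
        , tight w Fin.zero (proj₁ Nw)
            (subst₂ (λ x y → suc x < y) (sym (word-lookup₁ w eq)) (sym (word-lookup₀ w eq)) far)
            (incoming-zero w Nw Fin.zero)
      open Reach (suc (suc m)) Q (λ a b → suc b < a)
        (λ (w , eq , Nw) → subst (PermWord (suc (suc m))) eq (permWord {w = w} (proj₁ Nw))) turn swap

-- Zeros of the leading coefficients

Solution-neg : {φ : State n → Poly n} → Solution φ → Solution (λ w → -P φ w)
Solution-neg {φ = φ} sol = record
  { poly = λ w perm → IsPoly-neg (poly w perm)
  ; stationary = λ w perm → Stationary-neg φ w (stationary w perm)
  ; invariant = λ w perm → -P-cong (invariant w perm)
  }
  where open Solution sol

Solution-X : (i : Fin n) {φ : State n → Poly n} → Solution φ → Solution (λ w → X i (φ w))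
Solution-X {n} i {φ} sol = record
  { poly = λ w perm → IsPoly-X i (poly w perm)
  ; stationary = λ w perm → ≈-trans (pull (asc? w) (lookup w) (λ _ → w)) (≈-trans (X-cong i (stationary w perm))
      (≈-sym (pull (desc? w) (λ p → lookup w (next p)) (swapAt w))))
  ; invariant = λ w perm → X-cong i (invariant w perm)
  }
  where
  open Solution sol
  pull : {T : Fin n → Set} (T? : ∀ p → Dec (T p)) (k : Fin n → Fin n) (u : Fin n → State n) →
    ∑ (List.allFin n) (λ p → when (T? p) (X (k p) (X i (φ (u p)))))
    ≈ X i (∑ (List.allFin n) (λ p → when (T? p) (X (k p) (φ (u p)))))
  pull T? k u = ≈-trans (∑-cong (List.allFin n) (λ p → term (T? p) (k p) (φ (u p))))
    (≈-sym (X-∑ i (List.allFin n) (λ p → when (T? p) (X (k p) (φ (u p))))))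
    where
    term : {T : Set} (T? : Dec T) (k : Fin n) (f : Poly n) → when T? (X k (X i f)) ≈ X i (when T? (X k f))
    term (yes _) k f = X-comm k i f
    term (no _) k f = ≈-sym (X-zero i ≈-refl)

-- The decreasing state is found by walking from the given permutation with an unconditional `Q`,
-- which spares its construction as a vector.
reach-decreasing : (w : State (suc (suc m))) → IsPerm w → ∃ λ w₀ → word w₀ ≡ downFrom (suc (suc m)) × IsPerm w₀
reach-decreasing {m} w perm = reach-by-blocks (s≤s z≤n) (λ far → far) (w , refl , perm)
  where
  Q : List ℕ → Set
  Q l = ∃ λ w → word w ≡ l × IsPerm w
  open Reach (suc (suc m)) Q (λ a b → suc b < a)
    (λ (w , eq , perm) → subst (PermWord (suc (suc m))) eq (permWord {w = w} perm))
    (λ x xs (w , eq , perm) → rotate w , trans (word-rotate w) (cong rotateL eq) , IsPerm-rotate {w = w} perm)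
    (λ a b xs _ (w , eq , perm) → swapAt w Fin.zero , word-swapAt-zero w eq , IsPerm-swapAt {w = w} Fin.zero perm)

-- The sign at the decreasing word decides. If it is zero, the coefficients of φ and of its negative
-- are all nonnegative, hence zero. A nonzero sign spreads to all states, and then the zero at w
-- would propagate to the decreasing word.
leading-zero-everywhere : (i : Fin (suc (suc m))) (φ : State (suc (suc m)) → Poly (suc (suc m))) →
  Solution φ → Vanishing i φ → ∀ w → IsPerm w → co i (η i w) (φ w) ≈ 0P →
  ∀ w' → IsPerm w' → co i (η i w') (φ w') ≈ 0P
leading-zero-everywhere {m} i φ sol vanishing w perm z with w₀ , eq₀ , perm₀ ← reach-decreasing w perm =
  go (sign (L⁺.c w₀) (L⁺.c-poly w₀ perm₀))
  where
  vanishing⁻ : Vanishing i (λ w → -P φ w)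
  vanishing⁻ w perm s lt = ≈-trans (co-neg i s (φ w)) (-P-zero (vanishing w perm s lt))
  module L⁺ = Leading i φ sol vanishing
  module L⁻ = Leading i (λ w → -P φ w) (Solution-neg sol) vanishing⁻
  c⁻≈ : ∀ w → L⁻.c w ≈ (-P L⁺.c w)
  c⁻≈ w = co-neg i (η i w) (φ w)
  go : Sign (L⁺.c w₀) → ∀ w' → IsPerm w' → L⁺.c w' ≈ 0P
  go (nought z₀) w' perm' = NonNeg-antisym
    (L⁺.NonNeg-spreads w₀ eq₀ (NonNeg-zero z₀) w' perm')
    (NonNeg-resp (c⁻≈ w') (L⁻.NonNeg-spreads w₀ eq₀ (NonNeg-zero (≈-trans (c⁻≈ w₀) (-P-zero z₀))) w' perm'))
  go (plus ne nn) = ⊥-elim (ne (L⁺.zero-spreads w₀ eq₀ (L⁺.NonNeg-spreads w₀ eq₀ nn) w perm z))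
  go (minus ne nn) = ⊥-elim (ne (≈-trans (≈-sym (-P-involutive (L⁺.c w₀))) (-P-zero (≈-trans (≈-sym (c⁻≈ w₀))
    (L⁻.zero-spreads w₀ eq₀ (L⁻.NonNeg-spreads w₀ eq₀ (NonNeg-resp (≈-sym (c⁻≈ w₀)) nn)) w perm
      (≈-trans (c⁻≈ w) (-P-zero z)))))))

-- Exact powers of the variables

Xⁿ : Fin V → ℕ → Poly V → Poly V
Xⁿ i zero f = f
Xⁿ i (suc K) f = X i (Xⁿ i K f)

co-Xⁿ-< : (i : Fin V) (K s : ℕ) (f : Poly V) → s < K → co i s (Xⁿ i K f) ≈ 0P
co-Xⁿ-< i (suc K) zero f lt = co-X-zero i (Xⁿ i K f)
co-Xⁿ-< i (suc K) (suc s) f (s≤s lt) = ≈-trans (co-X-suc i s (Xⁿ i K f)) (co-Xⁿ-< i K s f lt)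

co-Xⁿ-+ : (i : Fin V) (K s : ℕ) (f : Poly V) → co i (K + s) (Xⁿ i K f) ≈ co i s f
co-Xⁿ-+ i zero s f = ≈-refl
co-Xⁿ-+ i (suc K) s f = ≈-trans (co-X-suc i (K + s) (Xⁿ i K f)) (co-Xⁿ-+ i K s f)

Solution-Xⁿ : (i : Fin n) (K : ℕ) {φ : State n → Poly n} → Solution φ → Solution (λ w → Xⁿ i K (φ w))
Solution-Xⁿ i zero sol = sol
Solution-Xⁿ i (suc K) sol = Solution-X i (Solution-Xⁿ i K sol)

η-bound : (i : Fin n) → ∃ λ U → ∀ w → η i w ≤ U
η-bound {n} i = sum (allVecs n n) , λ w → ∈-sum (∈-allVecs w)
  where
  sum : List (State n) → ℕ
  sum [] = 0
  sum (w ∷ ws) = η i w + sum ws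
  ∈-sum : ∀ {w ws} → w ∈ ws → η i w ≤ sum ws
  ∈-sum (here refl) = ℕₚ.m≤m+n _ _
  ∈-sum (there m) = ℕₚ.≤-trans (∈-sum m) (ℕₚ.m≤n+m _ _)

module Valuation (i : Fin (suc (suc m))) (ψ : State (suc (suc m)) → Poly (suc (suc m))) (sol : Solution ψ)
  (w₁ : State (suc (suc m))) (perm₁ : IsPerm w₁)
  (exact : ∀ e → lookup e i ≢ η i w₁ → ψ w₁ e ≡ 0ℤ) (nonzero : ¬ (ψ w₁ ≈ 0P)) where

  shifted : ℕ → State (suc (suc m)) → Poly (suc (suc m))
  shifted K w = Xⁿ i K (ψ w)

  -- Multiplying by a high power of xᵢ makes the vanishing trivial; the power is then removed step by step.
  descend : ∀ K → Vanishing i (shifted (suc K)) → Vanishing i (shifted K)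
  descend K vanishing w perm s lt = ≈-trans (≈-sym (co-X-suc i s (shifted K w))) (go (ℕₚ.m≤n⇒m<n∨m≡n lt))
    where
    -- The shifted polynomial at w₁ contains xᵢ only to the power η + K + 1, so its coefficient at η
    -- vanishes.
    w₁-leading : co i (η i w₁) (shifted (suc K) w₁) ≈ 0P
    w₁-leading with η i w₁ ℕ.<? suc K
    ... | yes lt₁ = co-Xⁿ-< i (suc K) (η i w₁) (ψ w₁) lt₁
    ... | no ge = ≈-trans (λ e → cong (λ t → co i t (shifted (suc K) w₁) e) (sym split)) (≈-trans
            (co-Xⁿ-+ i (suc K) r (ψ w₁))
            (co-vanish i r (λ e er → exact e (λ eη → ℕₚ.<-irrefl (trans (sym er) eη)
              (subst (r <_) split (s≤s (ℕₚ.m≤n+m r K)))))))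
      where
      r = η i w₁ ∸ suc K
      split : suc K + r ≡ η i w₁
      split = ℕₚ.m+[n∸m]≡n (ℕₚ.≮⇒≥ ge)
    go : suc s < η i w ⊎ suc s ≡ η i w → co i (suc s) (shifted (suc K) w) ≈ 0P
    go (inj₁ lt') = vanishing w perm (suc s) lt'
    go (inj₂ eq) = ≈-trans (λ e → cong (λ t → co i t (shifted (suc K) w) e) eq)
      (leading-zero-everywhere i (shifted (suc K)) (Solution-Xⁿ i (suc K) sol) vanishing w₁ perm₁ w₁-leading w perm)

  vanishing : Vanishing i ψ
  vanishing = down (proj₁ (η-bound i)) (λ w perm s lt →
    co-Xⁿ-< i (proj₁ (η-bound i)) s (ψ w) (ℕₚ.<-≤-trans lt (proj₂ (η-bound i) w)))
    where
    down : ∀ K → Vanishing i (shifted K) → Vanishing i ψ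
    down zero v = v
    down (suc K) v = down K (descend K v)

  -- A zero would spread to w₁, where the leading power of xᵢ is the only one present.
  leading-nonzero : ∀ w → IsPerm w → ¬ (co i (η i w) (ψ w) ≈ 0P)
  leading-nonzero w perm z = nonzero ψ₁≈0
    where
    z₁ : co i (η i w₁) (ψ w₁) ≈ 0P
    z₁ = leading-zero-everywhere i ψ sol vanishing w perm z w₁ perm₁
    ψ₁≈0 : ψ w₁ ≈ 0P
    ψ₁≈0 e with lookup e i ℕ.≟ η i w₁
    ... | yes eq = co-eval i (η i w₁) z₁ e eq
    ... | no ne = exact e ne

-- The normalisation of the identity state

toList-tabulate : (f : Fin n → 𝒜) → toList (Vec.tabulate f) ≡ List.tabulate f
toList-tabulate {zero} f = refl
toList-tabulate {suc n} f = cong (f Fin.zero ∷_) (toList-tabulate (f ∘ Fin.suc))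

IsPerm-allFin : (n : ℕ) → IsPerm (allFin n)
IsPerm-allFin n = subst Unique (sym (toList-tabulate {n} (λ i → i))) (allFin⁺ n)

tabulate-toℕ : (f : ℕ → 𝒜) (n : ℕ) → List.tabulate {n = n} (f ∘ toℕ) ≡ applyUpTo f n
tabulate-toℕ f zero = refl
tabulate-toℕ f (suc n) = cong (f 0 ∷_) (tabulate-toℕ (f ∘ suc) n)

map-toℕ-allFin : (f : ℕ → 𝒜) (n : ℕ) → List.map (f ∘ toℕ) (List.allFin n) ≡ applyUpTo f n
map-toℕ-allFin f n = trans (map-tabulate (λ i → i) (f ∘ toℕ)) (tabulate-toℕ f n)

word-allFin : (n : ℕ) → word (allFin n) ≡ upTo n
word-allFin n = trans (cong (List.map toℕ) (toList-tabulate {n} (λ i → i))) (map-toℕ-allFin (λ i → i) n)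

applyUpTo-+ : (f : ℕ → 𝒜) (a k : ℕ) → applyUpTo f (a + k) ≡ applyUpTo f a ++ applyUpTo (λ x → f (a + x)) k
applyUpTo-+ f zero k = refl
applyUpTo-+ f (suc a) k = cong (f 0 ∷_) (applyUpTo-+ (f ∘ suc) a k)

upTo-split : ∀ n b → suc b < n → ∃ λ rest → upTo n ≡ upTo b ++ b ∷ suc b ∷ rest
upTo-split n b lt = rest
  , trans (cong upTo (sym n≡)) (trans (applyUpTo-+ (λ x → x) b (2 + d))
      (cong₂ (λ x y → upTo b ++ x ∷ y ∷ rest) (ℕₚ.+-identityʳ b) (ℕₚ.+-comm b 1)))
  where
  d = n ∸ (2 + b)
  rest = applyUpTo (λ x → b + suc (suc x)) d
  n≡ : b + (2 + d) ≡ n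
  n≡ = trans (sym (ℕₚ.+-assoc b 2 d)) (trans (cong (_+ d) (ℕₚ.+-comm b 2)) (ℕₚ.m+[n∸m]≡n lt))

-- When b+1 directly follows b, the way from b+1 back to b goes around the whole ring and meets
-- every other letter.
αL-increasing : ∀ b l as rest → Unique l → l ≡ as ++ b ∷ suc b ∷ rest → αL b l ≡ count> (suc b) l
αL-increasing b l as rest u refl = begin
  count> (suc b) (before b (arc (suc b) l))
    ≡⟨ cong (count> (suc b) ∘ before b) (cong₂ _++_ after≡ before≡) ⟩
  count> (suc b) (before b (rest ++ as ++ [ b ]))
    ≡⟨ cong (count> (suc b)) (trans (before-++-∉ rest _ b∉rest) (cong (rest ++_)
         (trans (before-++-∉ as _ b∉as) (trans (cong (as ++_) (before-here b [])) (++-identityʳ as))))) ⟩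
  count> (suc b) (rest ++ as)
    ≡⟨ trans (count>-++ (suc b) rest as) (ℕₚ.+-comm (count> (suc b) rest) _) ⟩
  count> (suc b) as + count> (suc b) rest
    ≡⟨ cong (count> (suc b) as +_) (sym (trans (count>-small {x = b} (suc b ∷ rest) (ℕₚ.<⇒≯ (ℕₚ.n<1+n b)))
         (count>-small {x = suc b} rest (ℕₚ.<-irrefl refl)))) ⟩
  count> (suc b) as + count> (suc b) (b ∷ suc b ∷ rest)
    ≡⟨ sym (count>-++ (suc b) as _) ⟩
  count> (suc b) l ∎
  where
  open ≡-Reasoning
  l≡ : l ≡ (as ++ [ b ]) ++ suc b ∷ rest
  l≡ = sym (++-assoc as [ b ] (suc b ∷ rest))
  sb∉ : suc b ∉ as ++ [ b ]
  sb∉ mem = Unique-++⇒∉ (as ++ [ b ]) (subst Unique l≡ u) mem (here refl)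
  b∉rest : b ∉ rest
  b∉rest mem = Unique-++⇒∉ (as ++ [ b ]) (subst Unique l≡ u) (∈-++⁺ʳ as (here refl)) (there mem)
  b∉as : b ∉ as
  b∉as mem = Unique-++⇒∉ as u mem (here refl)
  after≡ : after (suc b) l ≡ rest
  after≡ = trans (cong (after (suc b)) l≡) (trans (after-++-∉ (as ++ [ b ]) _ sb∉) (after-here (suc b) rest))
  before≡ : before (suc b) l ≡ as ++ [ b ]
  before≡ = trans (cong (before (suc b)) l≡) (trans (before-++-∉ (as ++ [ b ]) _ sb∉)
    (trans (cong ((as ++ [ b ]) ++_) (before-here (suc b) rest)) (++-identityʳ (as ++ [ b ]))))

count>-applyUpTo : ∀ v f n → count> v (applyUpTo f n) ≡ sumℕ (applyUpTo (λ j → if v <ᵇ f j then 1 else 0) n)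
count>-applyUpTo v f zero = refl
count>-applyUpTo v f (suc n) = cong ((if v <ᵇ f 0 then 1 else 0) +_) (count>-applyUpTo v (f ∘ suc) n)

sumℕ-applyUpTo-+ : (f g : ℕ → ℕ) (n : ℕ) →
  sumℕ (applyUpTo (λ j → f j + g j) n) ≡ sumℕ (applyUpTo f n) + sumℕ (applyUpTo g n)
sumℕ-applyUpTo-+ f g zero = refl
sumℕ-applyUpTo-+ f g (suc n) = trans (cong ((f 0 + g 0) +_) (sumℕ-applyUpTo-+ (f ∘ suc) (g ∘ suc) n))
  (interchange (f 0) (g 0) _ _)

-- The contribution of the pair i, j to the exponent of xᵢ in the normalising monomial.
gaps : ℕ → ℕ → ℕ
gaps i j = if i <ᵇ j then j ∸ i ∸ 1 else 0

gaps-suc : ∀ i j → gaps i j ≡ (if suc i <ᵇ j then 1 else 0) + gaps (suc i) j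
gaps-suc i zero = refl
gaps-suc zero (suc zero) = refl
gaps-suc zero (suc (suc j)) = refl
gaps-suc (suc i) (suc j) = gaps-suc i j

gaps-small : ∀ i j → j ≤ suc i → gaps i j ≡ 0
gaps-small i zero le = refl
gaps-small zero (suc .zero) (s≤s z≤n) = refl
gaps-small (suc i) (suc j) (s≤s le) = gaps-small i j le

-- Passing from i to i+1 lowers both sides by the number of letters above i+1: on the left each such
-- j loses one, on the right this number is α_i of the increasing word.
gaps≡ηL : ∀ n d i → n ≡ d + i → sumℕ (applyUpTo (gaps i) n) ≡ ηL n i (upTo n)
gaps≡ηL n d i eq with 3 + i ℕ.≤? n
... | no ¬le = trans (trans (sumℕ-applyUpTo-cong (gaps i) (λ _ → 0) n
          (λ j lt → gaps-small i j (ℕ.s≤s⁻¹ (ℕₚ.≤-trans lt (ℕ.s≤s⁻¹ (ℕₚ.≰⇒> ¬le))))))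
        (sumℕ-applyUpTo-zero (λ _ → 0) n (λ _ → refl))) (sym (sumFrom-end n _ i (ℕₚ.≰⇒> ¬le)))
gaps≡ηL n zero i refl | yes le = ⊥-elim (ℕₚ.m+1+n≰m i (subst (_≤ i) (ℕₚ.+-comm 3 i) le))
gaps≡ηL n (suc d) i eq | yes le with rest , split ← upTo-split n i (ℕₚ.≤-trans (ℕₚ.n≤1+n _) le) = begin
  sumℕ (applyUpTo (gaps i) n)
    ≡⟨ sumℕ-applyUpTo-cong (gaps i) _ n (λ j _ → gaps-suc i j) ⟩
  sumℕ (applyUpTo (λ j → (if suc i <ᵇ j then 1 else 0) + gaps (suc i) j) n)
    ≡⟨ sumℕ-applyUpTo-+ (λ j → if suc i <ᵇ j then 1 else 0) (gaps (suc i)) n ⟩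
  sumℕ (applyUpTo (λ j → if suc i <ᵇ j then 1 else 0) n) + sumℕ (applyUpTo (gaps (suc i)) n)
    ≡⟨ cong₂ _+_ (sym (count>-applyUpTo (suc i) (λ j → j) n)) (gaps≡ηL n d (suc i) (trans eq (sym (ℕₚ.+-suc d i)))) ⟩
  count> (suc i) (upTo n) + ηL n (suc i) (upTo n)
    ≡⟨ cong (_+ ηL n (suc i) (upTo n)) (sym (αL-increasing i (upTo n) (upTo i) rest unique split)) ⟩
  αL i (upTo n) + ηL n (suc i) (upTo n)
    ≡⟨ sym (sumFrom-step n _ i le) ⟩
  ηL n i (upTo n) ∎
  where
  open ≡-Reasoning
  unique : Unique (upTo n)
  unique = subst Unique (word-allFin n) (word-unique {w = allFin n} (IsPerm-allFin n))

normExp≡η : (n : ℕ) (i : Fin n) → lookup (normExp n) i ≡ η i (allFin n)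
normExp≡η n i = begin
  lookup (normExp n) i ≡⟨ lookup∘tabulate _ i ⟩
  sumℕ (List.map (gaps (toℕ i) ∘ toℕ) (List.allFin n)) ≡⟨ cong sumℕ (map-toℕ-allFin (gaps (toℕ i)) n) ⟩
  sumℕ (applyUpTo (gaps (toℕ i)) n)
    ≡⟨ gaps≡ηL n (n ∸ toℕ i) (toℕ i) (sym (ℕₚ.m∸n+n≡m (ℕₚ.<⇒≤ (Finₚ.toℕ<n i)))) ⟩
  ηL n (toℕ i) (upTo n) ≡⟨ cong (ηL n (toℕ i)) (sym (word-allFin n)) ⟩
  η i (allFin n) ∎
  where open ≡-Reasoning

-- Reconstruction of a state from η

above : ℕ → List ℕ → List ℕ
above v = filter (v ℕ.<?_)

count>≡length-above : ∀ v xs → count> v xs ≡ length (above v xs)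
count>≡length-above v [] = refl
count>≡length-above v (x ∷ xs) with v <ᵇ x
... | true = cong suc (count>≡length-above v xs)
... | false = count>≡length-above v xs

above-suc : ∀ v xs → suc v ∉ xs → above v xs ≡ above (suc v) xs
above-suc v [] nm = refl
above-suc v (x ∷ xs) nm with ℕₚ.<-cmp (suc v) x
... | tri< lt _ _ = trans (filter-accept (v ℕ.<?_) (ℕₚ.<-trans (ℕₚ.n<1+n v) lt))
      (trans (cong (x ∷_) (above-suc v xs (nm ∘ there))) (sym (filter-accept (suc v ℕ.<?_) lt)))
... | tri≈ _ eq _ = ⊥-elim (nm (here eq))
... | tri> ¬lt _ gt = trans (filter-reject (v ℕ.<?_) (ℕₚ.≤⇒≯ (ℕ.s≤s⁻¹ gt)))
      (trans (above-suc v xs (nm ∘ there)) (sym (filter-reject (suc v ℕ.<?_) ¬lt)))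

++-injective : (as as' : List 𝒜) {bs bs' : List 𝒜} → length as ≡ length as' → as ++ bs ≡ as' ++ bs' → as ≡ as' × bs ≡ bs'
++-injective [] [] len eq = refl , eq
++-injective (a ∷ as) (a' ∷ as') len eq
  with refl ← ∷-injectiveˡ eq | p , q ← ++-injective as as' (ℕₚ.suc-injective len) (∷-injectiveʳ eq) =
  cong (a ∷_) p , q

∈-arc⁻ : ∀ {x r} l → r ∈ l → x ∈ arc r l → x ∈ l
∈-arc⁻ {x} {r} l r∈ mem with ∈-++⁻ (after r l) mem
... | inj₁ m = subst (x ∈_) (sym (split-at l r∈)) (∈-++⁺ʳ (before r l) (there m))
... | inj₂ m = subst (x ∈_) (sym (split-at l r∈)) (∈-++⁺ˡ m)

arc-++-comm : ∀ r as bs → Unique (as ++ bs) → r ∈ as ++ bs → arc r (as ++ bs) ≡ arc r (bs ++ as)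
arc-++-comm r [] bs u mem = cong (arc r) (sym (++-identityʳ bs))
arc-++-comm r (a ∷ as) bs u mem = begin
  arc r (a ∷ as ++ bs) ≡⟨ sym (arc-rotate (a ∷ as ++ bs) u mem) ⟩
  arc r ((as ++ bs) ++ [ a ]) ≡⟨ cong (arc r) (++-assoc as bs [ a ]) ⟩
  arc r (as ++ bs ++ [ a ]) ≡⟨ arc-++-comm r as (bs ++ [ a ])
      (subst Unique (++-assoc as bs [ a ]) (Unique-resp-↭ (++-comm [ a ] (as ++ bs)) u))
      (subst (r ∈_) (++-assoc as bs [ a ]) (turned mem)) ⟩
  arc r ((bs ++ [ a ]) ++ as) ≡⟨ cong (arc r) (++-assoc bs [ a ] as) ⟩
  arc r (bs ++ a ∷ as) ∎
  where
  open ≡-Reasoning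
  turned : r ∈ a ∷ (as ++ bs) → r ∈ (as ++ bs) ++ [ a ]
  turned (here eq) = ∈-++⁺ʳ (as ++ bs) (here eq)
  turned (there m) = ∈-++⁺ˡ m

-- The ring is first cut in front of r, giving `r ∷ arc r l`, and then read from b; r turns up
-- between the part behind b and the part before it.
arc-change : ∀ {b r} l → Unique l → r ∈ l → b ∈ l → r ≢ b →
  arc b l ≡ after b (arc r l) ++ r ∷ before b (arc r l)
arc-change {b} {r} l u r∈ b∈ r≢b = begin
  arc b l ≡⟨ cong (arc b) (split-at l r∈) ⟩
  arc b (before r l ++ r ∷ after r l)
    ≡⟨ arc-++-comm b (before r l) (r ∷ after r l) (subst Unique (split-at l r∈) u) (subst (b ∈_) (split-at l r∈) b∈) ⟩
  arc b (r ∷ arc r l) ≡⟨ cong₂ _++_ (after-there (arc r l) r≢b) (before-there (arc r l) r≢b) ⟩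
  after b (arc r l) ++ r ∷ before b (arc r l) ∎
  where open ≡-Reasoning

∉-arc : ∀ r l → Unique l → r ∈ l → r ∉ arc r l
∉-arc r l u r∈ mem with ∈-++⁻ (after r l) mem
... | inj₁ m = Unique-++⇒∉ (before r l ++ [ r ]) (subst Unique
        (trans (split-at l r∈) (sym (++-assoc (before r l) [ r ] (after r l)))) u)
        (∈-++⁺ʳ (before r l) (here refl)) m
... | inj₂ m = ∉-before r l m

module _ {n : ℕ} {l l' : List ℕ} (pw : PermWord n l) (pw' : PermWord n l')
  (same-α : ∀ b → 3 + b ≤ n → αL b l ≡ αL b l') where

  -- The position of b among the letters above b is given by α_b, counted from b+1.
  arcs-agree : ∀ d b → suc b + d ≡ n → above b (arc b l) ≡ above b (arc b l')
  arcs-agree zero b eq = trans (empty pw) (sym (empty pw'))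
    where
    n≡ : suc b ≡ n
    n≡ = trans (sym (ℕₚ.+-identityʳ (suc b))) eq
    empty : ∀ {l} → PermWord n l → above b (arc b l) ≡ []
    empty {l} p = filter-none (b ℕ.<?_) (All.tabulate (λ {x} m lt →
      ℕₚ.<⇒≱ (bounded (∈-arc⁻ l (complete b<n) m)) (subst (_≤ x) n≡ lt)))
      where
      open PermWord p
      b<n : b < n
      b<n = ℕₚ.≤-reflexive n≡
  arcs-agree (suc d) b eq = trans (decompose pw)
    (trans (cong₂ (λ p q → p ++ suc b ∷ q) (proj₂ parts) (proj₁ parts)) (sym (decompose pw')))
    where
    sb<n : suc b < n
    sb<n = subst (suc b <_) eq (ℕₚ.m<m+n (suc b) (s≤s z≤n))
    b<n : b < n
    b<n = ℕₚ.<-trans (ℕₚ.n<1+n b) sb<n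
    -- Starting from b+1, these are the larger letters met before b and those met after it. The
    -- first part has length α_b, so α_b fixes where the known cyclic word is cut.
    near far : List ℕ → List ℕ
    near l = above (suc b) (before b (arc (suc b) l))
    far l = above (suc b) (after b (arc (suc b) l))
    module _ {l : List ℕ} (p : PermWord n l) where
      open PermWord p
      Z = arc (suc b) l
      Z≡ : Z ≡ before b Z ++ b ∷ after b Z
      Z≡ = split-at Z (∈-arc l (complete sb<n) (complete b<n) (ℕₚ.1+n≢n ∘ sym))
      sb∉Z : suc b ∉ before b Z ++ b ∷ after b Z
      sb∉Z = subst (suc b ∉_) Z≡ (∉-arc (suc b) l unique (complete sb<n))
      decompose : above b (arc b l) ≡ far l ++ suc b ∷ near l
      decompose = begin
        above b (arc b l) ≡⟨ cong (above b) (arc-change l unique (complete sb<n) (complete b<n) ℕₚ.1+n≢n) ⟩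
        above b (after b Z ++ suc b ∷ before b Z) ≡⟨ filter-++ (b ℕ.<?_) (after b Z) _ ⟩
        above b (after b Z) ++ above b (suc b ∷ before b Z)
          ≡⟨ cong₂ _++_ (above-suc b (after b Z) (sb∉Z ∘ ∈-++⁺ʳ (before b Z) ∘ there))
               (trans (filter-accept (b ℕ.<?_) (ℕₚ.n<1+n b)) (cong (suc b ∷_) (above-suc b (before b Z) (sb∉Z ∘ ∈-++⁺ˡ)))) ⟩
        far l ++ suc b ∷ near l ∎
        where open ≡-Reasoning
      recompose : above (suc b) Z ≡ near l ++ far l
      recompose = begin
        above (suc b) Z ≡⟨ cong (above (suc b)) Z≡ ⟩
        above (suc b) (before b Z ++ b ∷ after b Z) ≡⟨ filter-++ (suc b ℕ.<?_) (before b Z) _ ⟩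
        near l ++ above (suc b) (b ∷ after b Z)
          ≡⟨ cong (near l ++_) (filter-reject (suc b ℕ.<?_) (ℕₚ.<⇒≯ (ℕₚ.n<1+n b))) ⟩
        near l ++ far l ∎
        where open ≡-Reasoning
    same : near l ++ far l ≡ near l' ++ far l'
    same = trans (sym (recompose pw)) (trans (arcs-agree d (suc b) (trans (sym (ℕₚ.+-suc (suc b) d)) eq)) (recompose pw'))
    length-near : length (near l) ≡ length (near l')
    length-near with 3 + b ℕ.≤? n
    ... | yes le = trans (sym (count>≡length-above (suc b) (before b (Z pw))))
          (trans (same-α b le) (count>≡length-above (suc b) (before b (Z pw'))))
    -- Now b+1 is the largest letter: there is no α_b among the hypotheses, and no letter above b+1
    -- to be placed.
    ... | no ¬le = trans (empty pw) (sym (empty pw'))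
      where
      empty : ∀ {l} → PermWord n l → length (near l) ≡ 0
      empty {l} p = cong length (filter-none (suc b ℕ.<?_) {before b (Z p)} (All.tabulate (λ {x} m lt → ¬le
        (ℕₚ.≤-trans (s≤s lt) (PermWord.bounded p (∈-arc⁻ l (PermWord.complete p sb<n) (subst (x ∈_) (sym (Z≡ p)) (∈-++⁺ˡ m))))))))
    parts : near l ≡ near l' × far l ≡ far l'
    parts = ++-injective (near l) (near l') length-near same

  arc-0-agree : 0 < n → arc 0 l ≡ arc 0 l'
  arc-0-agree 0<n = trans (sym (all-positive pw))
    (trans (arcs-agree (ℕ.pred n) 0 (ℕₚ.suc-pred n {{ℕ.>-nonZero 0<n}})) (all-positive pw'))
    where
    all-positive : ∀ {l} → PermWord n l → above 0 (arc 0 l) ≡ arc 0 l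
    all-positive {l} p = filter-all (0 ℕ.<?_) (All.tabulate (λ m → ℕₚ.n≢0⇒n>0 (λ { refl →
      ∉-arc 0 l (PermWord.unique p) (PermWord.complete p 0<n) m })))

η-determines-state : (w w' : State (suc m)) → IsPerm w → IsPerm w' → eta w ≡ eta w' → CycEquiv w w'
-- After k turns w has 0 in front, and after k' turns so does w'. The remaining turns of a full
-- rotation undo the k' turns of w'.
η-determines-state {m} w w' perm perm' eq = (suc m ∸ k') + k , (begin
  rotateⁿ ((suc m ∸ k') + k) w ≡⟨ rotateⁿ-+ (suc m ∸ k') k w ⟩
  rotateⁿ (suc m ∸ k') (rotateⁿ k w) ≡⟨ cong (rotateⁿ (suc m ∸ k')) fronts ⟩
  rotateⁿ (suc m ∸ k') (rotateⁿ k' w') ≡⟨ sym (rotateⁿ-+ (suc m ∸ k') k' w') ⟩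
  rotateⁿ ((suc m ∸ k') + k') w' ≡⟨ cong (λ j → rotateⁿ j w') (ℕₚ.m∸n+n≡m k'≤) ⟩
  rotateⁿ (suc m) w' ≡⟨ rotateⁿ-full w' ⟩
  w' ∎)
  where
  open ≡-Reasoning
  l = word w
  l' = word w'
  pw = permWord {w = w} perm
  pw' = permWord {w = w'} perm'
  k = length (before 0 l)
  k' = length (before 0 l')
  k'≤ : k' ≤ suc m
  k'≤ = subst (k' ≤_) (length-word w') (ℕₚ.<⇒≤ (length-before-< l' (PermWord.complete pw' (s≤s z≤n))))
  same-η : ∀ i → i < suc m → ηL (suc m) i l ≡ ηL (suc m) i l'
  same-η i lt = subst (λ j → ηL (suc m) j l ≡ ηL (suc m) j l') (Finₚ.toℕ-fromℕ< lt)
    (trans (sym (eta≡ηL w perm (fromℕ< lt))) (trans (cong (λ v → lookup v (fromℕ< lt)) eq) (eta≡ηL w' perm' (fromℕ< lt))))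
  same-α : ∀ b → 3 + b ≤ suc m → αL b l ≡ αL b l'
  -- Each α is the difference of two consecutive exponents of η.
  same-α b le = ℕₚ.+-cancelʳ-≡ (ηL (suc m) (suc b) l) (αL b l) (αL b l') (begin
    αL b l + ηL (suc m) (suc b) l ≡⟨ sym (sumFrom-step (suc m) _ b le) ⟩
    ηL (suc m) b l ≡⟨ same-η b (ℕₚ.≤-trans (ℕₚ.m≤n+m (suc b) 2) le) ⟩
    ηL (suc m) b l' ≡⟨ sumFrom-step (suc m) _ b le ⟩
    αL b l' + ηL (suc m) (suc b) l' ≡⟨ cong (αL b l' +_) (sym (same-η (suc b) (ℕₚ.≤-trans (ℕₚ.n≤1+n _) le))) ⟩
    αL b l' + ηL (suc m) (suc b) l ∎)
  front : (u : State (suc m)) → IsPerm u → word (rotateⁿ (length (before 0 (word u))) u) ≡ 0 ∷ arc 0 (word u)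
  front u p = word-rotateⁿ (before 0 (word u)) (0 ∷ after 0 (word u)) u (split-at (word u) (word-∈ {w = u} p (s≤s z≤n)))
  fronts : rotateⁿ k w ≡ rotateⁿ k' w'
  fronts = word-injective (trans (front w perm)
    (trans (cong (0 ∷_) (arc-0-agree pw pw' same-α (s≤s z≤n))) (sym (front w' perm'))))

-- Largest monomial divisors of the steady state

theorem1p3 : (n : ℕ) → 3 ≤ n →
    (ψ : State n → Poly n) →
    (∀ w → IsPerm w → IsPoly (ψ w)) →
    (∀ w → IsPerm w → Balance ψ w) →
    ψ (allFin n) ≈ mono (normExp n) →
    (∀ w → IsPerm w → IsLargestMonoDiv (eta w) (ψ w))
    × (∀ (w w' : State n) → IsPerm w → IsPerm w' → eta w ≡ eta w' → CycEquiv w w')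
theorem1p3 n@(suc (suc _)) (s≤s (s≤s _)) ψ poly balance norm = largest , η-determines-state
  where
  stationary : ∀ w → IsPerm w → Stationary ψ w
  stationary w perm = Balance⇒Stationary ψ w (balance w perm)
  sol : Solution ψ
  sol = record { poly = poly ; stationary = stationary ; invariant = rotation-invariant ψ poly stationary }
  exact : ∀ i e → lookup e i ≢ η i (allFin n) → ψ (allFin n) e ≡ 0ℤ
  exact i e ne = trans (norm e) (mono-≢ (normExp n) e (λ { refl → ne (normExp≡η n i) }))
  nonzero : ¬ (ψ (allFin n) ≈ 0P)
  nonzero z with () ← trans (sym (mono-≡ (normExp n))) (trans (sym (norm (normExp n))) (z (normExp n)))
  module Val (i : Fin n) = Valuation i ψ sol (allFin n) (IsPerm-allFin n) (exact i) nonzero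
  largest : ∀ w → IsPerm w → IsLargestMonoDiv (eta w) (ψ w)
  largest w perm = support⇒∣P (poly w perm)
      (λ e i lt → co-eval i (lookup e i) {ψ w}
        (Val.vanishing i w perm (lookup e i) (subst (lookup e i <_) (eta≡ηL w perm i) lt)) e refl)
    -- An exponent of xᵢ in b larger than η would make the coefficient of the power η of xᵢ vanish.
    , λ b b∣ψ i → ℕₚ.≮⇒≥ (λ lt → Val.leading-nonzero i w perm (co-vanish i (η i w)
        (λ e eq → ∣P-support b∣ψ e i (subst (_< lookup b i) (trans (eta≡ηL w perm i) (sym eq)) lt))))
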